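{- Let $q$ be a prime power and $n\ge1$. Let $L_0$ and $L_1$ be $q^2$-linear polynomials over $\mathbb F_{q^{2n}}$ of degree less than $q^{2n}$, let $C_0$ and $C_1$ be coefficient matrices (with respect to some bases of $\mathbb F_{q^{2n}}/\mathbb F_{q^2}$) of $\sigma_{L_0}$ and $\sigma_{L_1}$ respectively, and suppose that $C_0$ and $C_1$ are both nonsingular. Then the following conditions are equivalent: (1) $\sigma_{L_0}$ and $\sigma_{L_1}$ are equivalent; (2) $C_0^*C_0^{ -1}$ and $C_1^*C_1^{ -1}$ are conjugate in $\mathrm{GL}_n(q^2)$; (3) $PM_{L_0}^*M_{L_0}^{ -1}$ and $PM_{L_1}^*M_{L_1}^{ -1}$ are conjugate in $\mathrm{GL}_n(q^{2n})$, where $P$ is the $n\times n$ permutation matrix whose $(1,n)$ entry and $(i+1,i)$ entries ($1\le i\le n-1$) equal $1$ and all other entries are $0$.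
   Context: $\mathrm{Tr}$ is the trace map of $\mathbb F_{q^{2n}}/\mathbb F_{q^2}$. A $q^2$-linear polynomial over $\mathbb F_{q^{2n}}$ is one of the form $L(x)=\sum_i a_ix^{q^{2i}}$; for such $L$, $\sigma_L(u,v)=\mathrm{Tr}(uL(v^q))$ is a sesquilinear form of $\mathbb F_{q^{2n}}/\mathbb F_{q^2}$ (linear in $u$, semilinear in $v$ with respect to $c\mapsto c^q$). The coefficient matrix of a sesquilinear form $\sigma$ with respect to a basis $\beta_1,\dots,\beta_n$ is the matrix with $(i,j)$ entry $\sigma(\beta_i,\beta_j)$. Two sesquilinear forms $\sigma,\sigma'$ are equivalent if there is an $\mathbb F_{q^2}$-linear automorphism $\tau$ of $\mathbb F_{q^{2n}}$ with $\sigma(u,v)=\sigma'(\tau(u),\tau(v))$ for all $u,v$. For a matrix $M$, $M^*$ is the transpose of $M$ with each entry raised to its $q$-th power. $\mathrm{GL}_n(Q)$ denotes the group of nonsingular $n\times n$ matrices over $\mathbb F_Q$. For $L(x)=\sum_{i=0}^{n-1}a_ix^{q^{2i}}$, $M_L$ is the $n\times n$ matrix whose $(i,j)$ entry ($1\le i,j\le n$) is $a_{(j-i)\bmod n}^{\,q^{2(i-1)}}$, i.e. first row $(a_0,a_1,\dots,a_{n-1})$ and each subsequent row obtained by cyclically shifting the previous row one step to the right and raising entries to the $q^2$-th power. -}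

module Defs where

open import Data.Nat as ℕ using (ℕ; zero; suc; _∸_; _≡ᵇ_; NonZero; _≤_)
open import Data.Nat.DivMod using (_mod_; _%_)
open import Data.Nat.Primality using (Prime)
open import Data.Fin as Fin using (Fin; toℕ)
open import Data.Bool using (if_then_else_)
open import Data.Product using (∃; ∃₂; _×_; _,_)
open import Relation.Binary.PropositionalEquality using (_≡_; _≢_)
open import Relation.Nullary using (yes; no)
open import Algebra.Structures using (IsCommutativeRing)
open import Function.Bundles using (_↔_; _⇔_)

record FiniteField : Set₁ where
  infixl 6 _+_
  infixl 7 _*_
  field
    Carrier : Set
    _+_ _*_ : Carrier → Carrier → Carrier
    -_ : Carrier → Carrier
    0# 1# : Carrier
    isCommutativeRing : IsCommutativeRing _≡_ _+_ _*_ -_ 0# 1#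
    0≢1 : 0# ≢ 1#
    inverse : ∀ x → x ≢ 0# → ∃ λ y → x * y ≡ 1#
    size : ℕ
    enumeration : Carrier ↔ Fin size

IsPrimePower : ℕ → Set
IsPrimePower q = ∃₂ λ p k → Prime p × 1 ≤ k × q ≡ p ℕ.^ k

module _ (F : FiniteField) where
  open FiniteField F

  pow : Carrier → ℕ → Carrier
  pow x zero = 1#
  pow x (suc m) = x * pow x m

  Σ : ∀ {m} → (Fin m → Carrier) → Carrier
  Σ {zero} f = 0#
  Σ {suc m} f = f Fin.zero + Σ (λ i → f (Fin.suc i))

  Matrix : ℕ → Set
  Matrix m = Fin m → Fin m → Carrier

  _⊗_ : ∀ {m} → Matrix m → Matrix m → Matrix m
  (A ⊗ B) i j = Σ λ k → A i k * B k j

  Id : ∀ {m} → Matrix m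
  Id i j with i Fin.≟ j
  ... | yes _ = 1#
  ... | no _ = 0#

  _≐_ : ∀ {m} → Matrix m → Matrix m → Set
  A ≐ B = ∀ i j → A i j ≡ B i j

  IsInverse : ∀ {m} → Matrix m → Matrix m → Set
  IsInverse A B = (A ⊗ B) ≐ Id × (B ⊗ A) ≐ Id

  Nonsingular : ∀ {m} → Matrix m → Set
  Nonsingular A = ∃ λ B → IsInverse A B

  -- membership in the subfield F_{q^2} = { x | x^{q^2} = x }
  InSub : ℕ → Carrier → Set
  InSub q x = pow x (q ℕ.^ 2) ≡ x

  Tr : (q n : ℕ) → Carrier → Carrier
  Tr q n x = Σ {n} λ i → pow x (q ℕ.^ (2 ℕ.* toℕ i))

  -- q^2-linear polynomial L(x) = Σ_{i<n} a_i x^{q^{2i}} (degree < q^{2n}),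
  -- given by its coefficient vector a
  evalLin : (q : ℕ) {n : ℕ} → (Fin n → Carrier) → Carrier → Carrier
  evalLin q a x = Σ λ i → a i * pow x (q ℕ.^ (2 ℕ.* toℕ i))

  σ : (q n : ℕ) → (Fin n → Carrier) → Carrier → Carrier → Carrier
  σ q n a u v = Tr q n (u * evalLin q a (pow v q))

  IsBasis : (q n : ℕ) → (Fin n → Carrier) → Set
  IsBasis q n β =
    (∀ x → ∃ λ (c : Fin n → Carrier) → (∀ i → InSub q (c i)) × x ≡ Σ (λ i → c i * β i))
    × (∀ (c : Fin n → Carrier) → (∀ i → InSub q (c i)) → Σ (λ i → c i * β i) ≡ 0# → ∀ i → c i ≡ 0#)

  coefMatrix : (q n : ℕ) → (Fin n → Carrier) → (Fin n → Carrier) → Matrix n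
  coefMatrix q n a β i j = σ q n a (β i) (β j)

  star : (q : ℕ) {m : ℕ} → Matrix m → Matrix m
  star q A i j = pow (A j i) q

  IsSubLinearAut : (q : ℕ) → (Carrier → Carrier) → Set
  IsSubLinearAut q τ =
    (∀ x y → τ (x + y) ≡ τ x + τ y)
    × (∀ c x → InSub q c → τ (c * x) ≡ c * τ x)
    × ∃ λ (τ' : Carrier → Carrier) → (∀ x → τ' (τ x) ≡ x) × (∀ x → τ (τ' x) ≡ x)

  EquivalentForms : (q n : ℕ) → (Fin n → Carrier) → (Fin n → Carrier) → Set
  EquivalentForms q n a₀ a₁ =
    ∃ λ τ → IsSubLinearAut q τ × (∀ u v → σ q n a₀ u v ≡ σ q n a₁ (τ u) (τ v))

  ConjugateGLSub : (q : ℕ) {m : ℕ} → Matrix m → Matrix m → Set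
  ConjugateGLSub q A B = ∃₂ λ X Y →
    (∀ i j → InSub q (X i j)) × (∀ i j → InSub q (Y i j)) × IsInverse X Y × (X ⊗ (A ⊗ Y)) ≐ B

  ConjugateGL : ∀ {m} → Matrix m → Matrix m → Set
  ConjugateGL A B = ∃₂ λ X Y → IsInverse X Y × (X ⊗ (A ⊗ Y)) ≐ B

  ML : (q n : ℕ) .{{_ : NonZero n}} → (Fin n → Carrier) → Matrix n
  ML q n a i j = pow (a (((toℕ j ℕ.+ n) ∸ toℕ i) mod n)) (q ℕ.^ (2 ℕ.* toℕ i))

  -- permutation matrix P: 1 at (1,n) and (i+1,i) (1-indexed); 0-indexed:
  -- P i j = 1 iff i = (j+1) mod n
  Pmat : (n : ℕ) .{{_ : NonZero n}} → Matrix n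
  Pmat n i j = if toℕ i ≡ᵇ (suc (toℕ j) % n) then 1# else 0#

  Cond2 : (q : ℕ) {n : ℕ} → Matrix n → Matrix n → Set
  Cond2 q C₀ C₁ = ∃₂ λ D₀ D₁ → IsInverse C₀ D₀ × IsInverse C₁ D₁ ×
    ConjugateGLSub q (star q C₀ ⊗ D₀) (star q C₁ ⊗ D₁)

  Cond3 : (q n : ℕ) .{{_ : NonZero n}} → (Fin n → Carrier) → (Fin n → Carrier) → Set
  Cond3 q n a₀ a₁ = ∃₂ λ N₀ N₁ → IsInverse (ML q n a₀) N₀ × IsInverse (ML q n a₁) N₁ ×
    ConjugateGL (Pmat n ⊗ (star q (ML q n a₀) ⊗ N₀)) (Pmat n ⊗ (star q (ML q n a₁) ⊗ N₁))

{-# OPTIONS --safe #-}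

-- Write K = F_{q²} and V = (β_i^{q^{2k}})_{i,k}. For the coefficient matrix C of σ_L one has
-- C = V M_L V*, and V** = V P, whence C* C⁻¹ = V (P M_L* M_L⁻¹) V⁻¹. So (3) says that the
-- cosquares C* C⁻¹ are conjugate over F, and (2) ⇔ (3) reduces to the descent of conjugacy from
-- F to K, proved by counting solutions of linear systems. Equivalence of forms is *-congruence of
-- coefficient matrices over K, which makes the cosquares conjugate. Conversely, if A and B have
-- equal cosquares, then A B⁻¹ is a self-adjoint unit of the finite commutative ring K[A B⁻¹],
-- and every such unit is a norm Z Z†, because Hilbert 90 holds in that ring and the ring is
-- finite; then A = Z B Z*.
module Submission where

open import Defs
open import Algebra.Bundles using (AbelianGroup; CommutativeMonoid; CommutativeRing; Ring)
import Algebra.Properties.CommutativeMonoid.Sum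
import Algebra.Properties.CommutativeSemigroup
import Algebra.Properties.CommutativeSemiring.Binomial
import Algebra.Properties.CommutativeSemiring.Exp
import Algebra.Properties.Group
import Algebra.Properties.Monoid
import Algebra.Properties.Ring
import Algebra.Properties.Semiring.Exp
import Algebra.Properties.Semiring.Mult
import Algebra.Properties.Semiring.Sum
import Algebra.Solver.Ring.NaturalCoefficients.Default
open import Data.Bool as Bool using (true; false; if_then_else_)
open import Data.Fin as Fin using (Fin; toℕ)
import Data.Fin.Permutation as Perm
import Data.Fin.Properties as Fin
open import Data.List as List using (List; []; _∷_)
open import Data.List.Membership.Propositional using (_∈_)
import Data.List.Membership.Propositional.Properties as List
open import Data.List.Relation.Unary.All as All using (All; []; _∷_)
open import Data.List.Relation.Unary.Any using (here; there)
open import Data.Nat as ℕ using (ℕ; zero; suc)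
import Data.Nat.Combinatorics as ℕ
import Data.Nat.Divisibility as ℕ
import Data.Nat.DivMod as ℕ
import Data.Nat.Primality as ℕ
import Data.Nat.Properties as ℕ
open import Data.Product using (∃; ∃₂; _×_; _,_; proj₁; proj₂)
open import Data.Sum using (inj₁; inj₂)
open import Data.Vec using (Vec; []; _∷_; replicate)
open import Function.Base using (_∘_)
open import Function.Bundles using (Inverse; _⇔_; mk⇔)
open import Function.Properties.Inverse using (↔⇒↣)
open import Level using (0ℓ)
open import Relation.Binary.Bundles using (Setoid)
open import Relation.Binary.Definitions using (DecidableEquality)
open import Relation.Binary.PropositionalEquality as ≡ using (_≡_; _≢_)
import Relation.Binary.Reasoning.Setoid
open import Relation.Nullary using (¬_; Dec; yes; no; contradiction)
open import Relation.Nullary.Decidable using (_×-dec_; ¬?; map′; via-injection; ¬¬-excluded-middle)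
open import Relation.Unary using (Pred; Decidable)

-- An equation A = Z B Z* says that T = A B⁻¹ is Z times its adjoint B Z* B⁻¹, which singles out T.
-- In general K[T] is not a field, and this shapes Hilbert 90. If g g† = 1, then h = c + g c†
-- satisfies h = g h† whatever c is, but h must also be a unit, and c = 1 fails wherever 1 + g is
-- not invertible. An element d of K with d^q ≠ d repairs this: where 1 + g is nilpotent, d + g d†
-- differs from the unit d - d† by a nilpotent element. In the descent, the n coordinate matrices
-- over K of a conjugator over F all intertwine, but none of them need be invertible, and K may be
-- too small for a generic combination; hence the counting. K[T] is given by generators, and whether
-- an element lies in the image of a map on its units is not decided. Counting there takes the form
-- of an injective self-map, and Z is first obtained under a double negation; the congruence can be
-- tested on each of the finitely many matrices, and this removes the double negation.

-- Injective self-maps of finite setoids.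

module FinitelyCoded {c ℓ} (S : Setoid c ℓ) {M : ℕ}
  (code : Setoid.Carrier S → Fin M)
  (code-injective : ∀ {x y} → code x ≡ code y → Setoid._≈_ S x y) where

  open Setoid S

  sequence-collides : (f : ℕ → Carrier) → ∃₂ λ i p → f i ≈ f (i ℕ.+ suc p)
  sequence-collides f =
    let i , j , i<j , eq = Fin.pigeonhole (ℕ.n<1+n M) (code ∘ f ∘ toℕ)
        p , i+1+p≡j = ℕ.m≤n⇒∃[o]m+o≡n i<j
    in toℕ i , p , trans (code-injective eq)
         (reflexive (≡.cong f (≡.trans (≡.sym i+1+p≡j) (≡.sym (ℕ.+-suc (toℕ i) p)))))

  -- Two members of the orbit of `y` agree; injectivity strips their common iterates, so the orbit
  -- returns to `y`, and the member before the return is the preimage. The search stays on one orbit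
  -- and thus covers setoids that have a code but no list of their elements.
  injective⇒surjective : (f : Carrier → Carrier) →
    (∀ {x y} → f x ≈ f y → x ≈ y) →
    ∀ y → ∃ λ x → f x ≈ y
  injective⇒surjective f f-injective y =
    let i , p , eq = sequence-collides (λ k → iterate k y)
    in iterate p y , sym (iterate-injective i (trans eq (reflexive (iterate-+ i (suc p)))))
    where
    iterate : ℕ → Carrier → Carrier
    iterate zero x = x
    iterate (suc k) x = f (iterate k x)

    iterate-+ : ∀ i k → iterate (i ℕ.+ k) y ≡ iterate i (iterate k y)
    iterate-+ zero k = ≡.refl
    iterate-+ (suc i) k = ≡.cong f (iterate-+ i k)

    iterate-injective : ∀ i {x z} → iterate i x ≈ iterate i z → x ≈ z
    iterate-injective zero eq = eq
    iterate-injective (suc i) eq = iterate-injective i (f-injective eq)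

-- Double negation commutes with finite conjunctions, so under a double negation finitely many
-- questions may be taken as decided at once.
¬¬-Fin-choice : ∀ {p n} {P : Fin n → Set p} → (∀ i → ¬ ¬ P i) → ¬ ¬ (∀ i → P i)
¬¬-Fin-choice {n = zero} h k = k λ ()
¬¬-Fin-choice {n = suc n} h k = h Fin.zero λ p₀ →
  ¬¬-Fin-choice (h ∘ Fin.suc) λ ps → k λ { Fin.zero → p₀ ; (Fin.suc i) → ps i }

-- Tate cohomology of finite modules.

module _ {c ℓ} (G : AbelianGroup c ℓ) where
  open AbelianGroup G

  -- The vanishing of one Tate cohomology group of a finite module over a cyclic
  -- group implies that of the other: |G| = |ker N||im N| = |ker δ||im δ|.
  module Herbrand {M : ℕ}
    (code : Carrier → Fin M)
    (code-cong : ∀ {x y} → x ≈ y → code x ≡ code y)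
    (code-injective : ∀ {x y} → code x ≡ code y → x ≈ y)
    (N δ : Carrier → Carrier)
    (N-cong : ∀ {x y} → x ≈ y → N x ≈ N y) (δ-cong : ∀ {x y} → x ≈ y → δ x ≈ δ y)
    (N-homo : ∀ x y → N (x ∙ y) ≈ N x ∙ N y) (δ-homo : ∀ x y → δ (x ∙ y) ≈ δ x ∙ δ y)
    (δN≈ε : ∀ x → δ (N x) ≈ ε)
    (kerN⊆imδ : ∀ x → N x ≈ ε → ∃ λ h → δ h ≈ x)
    where

    open FinitelyCoded setoid code code-injective
    open Algebra.Properties.Group group
    open Relation.Binary.Reasoning.Setoid setoid

    module Section (f : Carrier → Carrier) (f-cong : ∀ {x y} → x ≈ y → f x ≈ f y)
      (f-homo : ∀ x y → f (x ∙ y) ≈ f x ∙ f y)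
      (im? : ∀ i → Dec (∃ λ g → code (f g) ≡ i)) where

      f-ε : f ε ≈ ε
      f-ε = identityˡ-unique (f ε) (f ε) (trans (sym (f-homo ε ε)) (f-cong (identityˡ ε)))

      pick : ∀ {i} → Dec (∃ λ g → code (f g) ≡ i) → Carrier
      pick (yes (g , _)) = g
      pick (no _) = ε

      section : Carrier → Carrier
      section y = pick (im? (code y))

      -- The section sees its argument only through the code, so equivalent arguments receive the
      -- very same preimage.
      section-cong : ∀ {x y} → x ≈ y → section x ≡ section y
      section-cong x≈y = ≡.cong (λ i → pick (im? i)) (code-cong x≈y)

      f-section : ∀ {y} g → f g ≈ y → f (section y) ≈ y
      f-section {y} g fg≈y with im? (code y)
      ... | yes (_ , eq) = code-injective eq
      ... | no ¬im with () ← ¬im (g , code-cong fg≈y)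

    -- The counting is packed into one self-map: `g` is determined by `κ g` in ker N and by `N g`,
    -- and `Θ` merges the two into `t (κ g) ∙ N g`, from which δ recovers `κ g`. So `Θ` is
    -- injective, hence surjective, and a suitable value of it exhibits `a` as a norm. The double
    -- negation pays for deciding the images of N and δ, on which the sections `s` and `t` rest.
    kerδ⊆imN : ∀ a → δ a ≈ ε → ¬ ¬ (∃ λ g → N g ≈ a)
    kerδ⊆imN a δa≈ε k =
      ¬¬-Fin-choice (λ i → ¬¬-excluded-middle) λ imN? →
      ¬¬-Fin-choice (λ i → ¬¬-excluded-middle) λ imδ? → k (solution imN? imδ?)
      where
      solution : (∀ i → Dec (∃ λ g → code (N g) ≡ i)) →
                 (∀ i → Dec (∃ λ g → code (δ g) ≡ i)) → ∃ λ g → N g ≈ a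
      -- The chosen preimage `t ε` of the neutral element lies in ker δ but may be nontrivial, so
      -- the target carries it as a factor to be cancelled.
      solution imN? imδ? = let g , Θg≈ta = injective⇒surjective Θ Θ-injective (t ε ∙ a) in g , solves g Θg≈ta
        where
        open Section N N-cong N-homo imN? using () renaming
          (section to s; section-cong to s-cong; f-section to N-s)
        open Section δ δ-cong δ-homo imδ? using () renaming
          (section to t; section-cong to t-cong; f-section to δ-t; f-ε to δ-ε)

        κ : Carrier → Carrier
        κ g = g ∙ s (N g) ⁻¹

        κ∙s : ∀ g → κ g ∙ s (N g) ≈ g
        κ∙s g = //-rightDividesˡ (s (N g)) g

        Nκ : ∀ g → N (κ g) ≈ ε
        Nκ g = identityˡ-unique _ (N g) (begin
          N (κ g) ∙ N g               ≈⟨ ∙-congˡ (N-s g refl) ⟨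
          N (κ g) ∙ N (s (N g))       ≈⟨ N-homo _ _ ⟨
          N (κ g ∙ s (N g))           ≈⟨ N-cong (κ∙s g) ⟩
          N g                         ∎)

        δtκ : ∀ g → δ (t (κ g)) ≈ κ g
        δtκ g = let h , δh≈κ = kerN⊆imδ (κ g) (Nκ g) in δ-t h δh≈κ

        Θ : Carrier → Carrier
        Θ g = t (κ g) ∙ N g

        δΘ : ∀ g → δ (Θ g) ≈ κ g
        δΘ g = begin
          δ (t (κ g) ∙ N g)           ≈⟨ δ-homo _ _ ⟩
          δ (t (κ g)) ∙ δ (N g)       ≈⟨ ∙-cong (δtκ g) (δN≈ε g) ⟩
          κ g ∙ ε                     ≈⟨ identityʳ _ ⟩
          κ g                         ∎

        N-from-Θ : ∀ {g b y} → κ g ≈ y → Θ g ≈ t y ∙ b → N g ≈ b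
        N-from-Θ {g} {b} {y} κg≈y eq = ∙-cancelˡ (t y) _ _
          (trans (∙-congʳ (reflexive (≡.sym (t-cong κg≈y)))) eq)

        Θ-injective : ∀ {g h} → Θ g ≈ Θ h → g ≈ h
        Θ-injective {g} {h} eq = begin
          g                           ≈⟨ κ∙s g ⟨
          κ g ∙ s (N g)               ≈⟨ ∙-cong κ≈ (reflexive (s-cong (N-from-Θ κ≈ eq))) ⟩
          κ h ∙ s (N h)               ≈⟨ κ∙s h ⟩
          h                           ∎
          where
          κ≈ : κ g ≈ κ h
          κ≈ = trans (sym (δΘ g)) (trans (δ-cong eq) (δΘ h))

        solves : ∀ g → Θ g ≈ t ε ∙ a → N g ≈ a
        solves g eq = N-from-Θ (begin
          κ g                         ≈⟨ δΘ g ⟨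
          δ (Θ g)                     ≈⟨ δ-cong eq ⟩
          δ (t ε ∙ a)                 ≈⟨ δ-homo _ _ ⟩
          δ (t ε) ∙ δ a               ≈⟨ ∙-cong (δ-t ε δ-ε) δa≈ε ⟩
          ε ∙ ε                       ≈⟨ identityˡ ε ⟩
          ε                           ∎) eq

-- Units and idempotents of finite commutative rings.

module FiniteRing {c ℓ} (R : CommutativeRing c ℓ) {M : ℕ}
  (code : CommutativeRing.Carrier R → Fin M)
  (code-injective : ∀ {x y} → code x ≡ code y → CommutativeRing._≈_ R x y) where

  open CommutativeRing R

  open FinitelyCoded setoid code code-injective
  open Algebra.Properties.Ring ring
  open Algebra.Properties.Semiring.Exp semiring
  open Algebra.Properties.CommutativeSemiring.Exp commutativeSemiring using (^-distrib-*)
  open Algebra.Properties.CommutativeSemigroup *-commutativeSemigroup using (interchange)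
  open Relation.Binary.Reasoning.Setoid setoid

  Unit : Carrier → Set _
  Unit u = ∃ λ v → u * v ≈ 1#

  unit-cancel : ∀ {u} → Unit u → ∀ {y} → u * y ≈ 0# → y ≈ 0#
  unit-cancel {u} (v , uv≈1) {y} uy≈0 = begin
    y             ≈⟨ *-identityˡ y ⟨
    1# * y        ≈⟨ *-congʳ (trans (*-comm v u) uv≈1) ⟨
    v * u * y     ≈⟨ *-assoc v u y ⟩
    v * (u * y)   ≈⟨ *-congˡ uy≈0 ⟩
    v * 0#        ≈⟨ zeroʳ v ⟩
    0#            ∎

  -- This keeps inverses inside the ring: an element that becomes invertible in some larger ring is
  -- regular, hence already a unit here.
  regular⇒unit : ∀ u → (∀ y → u * y ≈ 0# → y ≈ 0#) → Unit u
  regular⇒unit u regular = injective⇒surjective (u *_) u*-injective 1#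
    where
    u*-injective : ∀ {x y} → u * x ≈ u * y → x ≈ y
    u*-injective {x} {y} eq = x∙y⁻¹≈ε⇒x≈y _ _ (regular (x - y) (begin
      u * (x - y)     ≈⟨ x[y-z]≈xy-xz u x y ⟩
      u * x - u * y   ≈⟨ x≈y⇒x∙y⁻¹≈ε eq ⟩
      0#              ∎))

  -- From x^a = x^(a+b) with a, b ≥ 1 one gets x^(ab) = x^(ab + tb) for all t; take t = a.
  idempotent-power : ∀ x → ∃ λ k → x ^ suc k * x ^ suc k ≈ x ^ suc k
  idempotent-power x = let i , p , eq = sequence-collides (x ^_) in p ℕ.+ i ℕ.* suc p , idempotent i p eq
    where
    idempotent : ∀ i p → x ^ i ≈ x ^ (i ℕ.+ suc p) →
      x ^ (suc i ℕ.* suc p) * x ^ (suc i ℕ.* suc p) ≈ x ^ (suc i ℕ.* suc p)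
    idempotent i p eq = begin
      x ^ (a ℕ.* b) * x ^ (a ℕ.* b)            ≈⟨ ^-homo-* x (a ℕ.* b) (a ℕ.* b) ⟨
      x ^ (a ℕ.* b ℕ.+ a ℕ.* b)                ≡⟨ ≡.cong (λ z → x ^ (z ℕ.+ a ℕ.* b)) (ℕ.*-suc a p) ⟩
      x ^ (a ℕ.+ a ℕ.* p ℕ.+ a ℕ.* b)          ≈⟨ shifts (a ℕ.* p) a ⟨
      x ^ (a ℕ.+ a ℕ.* p)                      ≡⟨ ≡.cong (x ^_) (ℕ.*-suc a p) ⟨
      x ^ (a ℕ.* b)                            ∎
      where
      a = suc i
      b = suc p

      shift : ∀ r → x ^ (a ℕ.+ r) ≈ x ^ (a ℕ.+ (r ℕ.+ b))
      shift r = begin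
        x ^ (a ℕ.+ r)                          ≈⟨ ^-homo-* x a r ⟩
        x ^ a * x ^ r                          ≈⟨ *-congʳ (*-congˡ eq) ⟩
        x ^ (a ℕ.+ b) * x ^ r                  ≈⟨ ^-homo-* x (a ℕ.+ b) r ⟨
        x ^ (a ℕ.+ b ℕ.+ r)                    ≡⟨ ≡.cong (x ^_) (≡.trans (ℕ.+-assoc a b r)
                                                    (≡.cong (a ℕ.+_) (ℕ.+-comm b r))) ⟩
        x ^ (a ℕ.+ (r ℕ.+ b))                  ∎

      shifts : ∀ r t → x ^ (a ℕ.+ r) ≈ x ^ (a ℕ.+ r ℕ.+ t ℕ.* b)
      shifts r zero = reflexive (≡.cong (x ^_) (≡.sym (ℕ.+-identityʳ (a ℕ.+ r))))
      shifts r (suc t) = begin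
        x ^ (a ℕ.+ r)                          ≈⟨ shift r ⟩
        x ^ (a ℕ.+ (r ℕ.+ b))                  ≈⟨ shifts (r ℕ.+ b) t ⟩
        x ^ (a ℕ.+ (r ℕ.+ b) ℕ.+ t ℕ.* b)      ≡⟨ ≡.cong (λ z → x ^ (z ℕ.+ t ℕ.* b)) (ℕ.+-assoc a r b) ⟨
        x ^ (a ℕ.+ r ℕ.+ b ℕ.+ t ℕ.* b)        ≡⟨ ≡.cong (x ^_) (ℕ.+-assoc (a ℕ.+ r) b (t ℕ.* b)) ⟩
        x ^ (a ℕ.+ r ℕ.+ suc t ℕ.* b)          ∎

  -- Some power of `g` is idempotent, and the only idempotent unit is `1#`.
  unit-torsion : ∀ g → Unit g → ∃ λ k → g ^ suc k ≈ 1#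
  unit-torsion g (v , gv≈1) =
    let k , idem = idempotent-power g in k , (begin
      g ^ suc k                             ≈⟨ *-identityʳ _ ⟨
      g ^ suc k * 1#                        ≈⟨ *-congˡ (inverse-power (suc k)) ⟨
      g ^ suc k * (g ^ suc k * v ^ suc k)   ≈⟨ *-assoc _ _ _ ⟨
      g ^ suc k * g ^ suc k * v ^ suc k     ≈⟨ *-congʳ idem ⟩
      g ^ suc k * v ^ suc k                 ≈⟨ inverse-power (suc k) ⟩
      1#                                    ∎)
    where
    inverse-power : ∀ m → g ^ m * v ^ m ≈ 1#
    inverse-power m = begin
      g ^ m * v ^ m   ≈⟨ ^-distrib-* g v m ⟨
      (g * v) ^ m     ≈⟨ ^-congˡ m gv≈1 ⟩
      1# ^ m          ≈⟨ ^-zeroˡ m ⟩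
      1#              ∎
      where
      ^-zeroˡ : ∀ m → 1# ^ m ≈ 1#
      ^-zeroˡ zero = refl
      ^-zeroˡ (suc m) = trans (*-identityˡ _) (^-zeroˡ m)

  idempotent-^ : ∀ {e} → e * e ≈ e → ∀ k → e ^ suc k ≈ e
  idempotent-^ {e} idem zero = *-identityʳ e
  idempotent-^ {e} idem (suc k) = trans (*-congˡ (idempotent-^ idem k)) idem

  -- Elements carry an inverse as data while equality ignores it, so `⁻¹-cong` amounts to the
  -- uniqueness of inverses.
  unitGroup : AbelianGroup _ _
  unitGroup = record
    { Carrier = ∃ Unit
    ; _≈_ = λ u v → proj₁ u ≈ proj₁ v
    ; _∙_ = λ { (u , u⁻¹ , uu⁻¹≈1) (v , v⁻¹ , vv⁻¹≈1) → u * v , u⁻¹ * v⁻¹ , (begin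
        u * v * (u⁻¹ * v⁻¹)      ≈⟨ interchange u v u⁻¹ v⁻¹ ⟩
        u * u⁻¹ * (v * v⁻¹)      ≈⟨ *-cong uu⁻¹≈1 vv⁻¹≈1 ⟩
        1# * 1#                  ≈⟨ *-identityˡ 1# ⟩
        1#                       ∎) }
    ; ε = 1# , 1# , *-identityˡ 1#
    ; _⁻¹ = λ { (u , u⁻¹ , uu⁻¹≈1) → u⁻¹ , u , trans (*-comm u⁻¹ u) uu⁻¹≈1 }
    ; isAbelianGroup = record
      { isGroup = record
        { isMonoid = record
          { isSemigroup = record
            { isMagma = record
              { isEquivalence = record { refl = refl ; sym = sym ; trans = trans }
              ; ∙-cong = *-cong }
            ; assoc = λ u v w → *-assoc (proj₁ u) (proj₁ v) (proj₁ w) }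
          ; identity = (λ u → *-identityˡ (proj₁ u)) , (λ u → *-identityʳ (proj₁ u)) }
        ; inverse = (λ { (u , u⁻¹ , uu⁻¹≈1) → trans (*-comm u⁻¹ u) uu⁻¹≈1 }) , (λ u → proj₂ (proj₂ u))
        ; ⁻¹-cong = λ { {u , u⁻¹ , uu⁻¹≈1} {v , v⁻¹ , vv⁻¹≈1} u≈v → begin
            u⁻¹                  ≈⟨ *-identityʳ u⁻¹ ⟨
            u⁻¹ * 1#             ≈⟨ *-congˡ (trans (*-congʳ u≈v) vv⁻¹≈1) ⟨
            u⁻¹ * (u * v⁻¹)      ≈⟨ *-assoc u⁻¹ u v⁻¹ ⟨
            u⁻¹ * u * v⁻¹        ≈⟨ *-congʳ (trans (*-comm u⁻¹ u) uu⁻¹≈1) ⟩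
            1# * v⁻¹             ≈⟨ *-identityˡ v⁻¹ ⟩
            v⁻¹                  ∎ } }
      ; comm = λ u v → *-comm (proj₁ u) (proj₁ v) } }

-- Hilbert 90 and norms in finite commutative rings with involution.

module _ {c ℓ} (R : CommutativeRing c ℓ) where
  open CommutativeRing R

  -- The data `d`, `δ` express that d - d† is a unit; in the application `d` is a scalar moved by
  -- the involution.
  module FiniteRingWithInvolution {M : ℕ}
    (code : Carrier → Fin M)
    (code-cong : ∀ {x y} → x ≈ y → code x ≡ code y)
    (code-injective : ∀ {x y} → code x ≡ code y → x ≈ y)
    (_† : Carrier → Carrier)
    (†-cong : ∀ {x y} → x ≈ y → x † ≈ y †)
    (†-involutive : ∀ x → (x †) † ≈ x)
    (†-homo-+ : ∀ x y → (x + y) † ≈ x † + y †)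
    (†-homo-* : ∀ x y → (x * y) † ≈ x † * y †)
    (†-1# : 1# † ≈ 1#)
    (d δ : Carrier) (d≈δ+d† : d ≈ δ + d †) (δ-unit : ∃ λ v → δ * v ≈ 1#) where

    open FiniteRing R code code-injective
    open Algebra.Properties.Ring ring
    open Algebra.Properties.Semiring.Exp semiring
    open Algebra.Properties.CommutativeSemiring.Exp commutativeSemiring using (^-distrib-*)
    open Algebra.Properties.CommutativeSemigroup *-commutativeSemigroup using (interchange)
    open Relation.Binary.Reasoning.Setoid setoid
    open Algebra.Solver.Ring.NaturalCoefficients.Default commutativeSemiring

    †-^ : ∀ x n → (x ^ n) † ≈ (x †) ^ n
    †-^ x zero = †-1#
    †-^ x (suc n) = trans (†-homo-* x (x ^ n)) (*-congˡ (†-^ x n))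

    -- On e R the element 1 + g is invertible, on (1 - e) R it is nilpotent; the
    -- Hilbert 90 combination c + g c† is formed with c = e + (1 - e) d.
    hilbert90 : ∀ g → g * g † ≈ 1# → ∃ λ h → Unit h × h ≈ g * h †
    hilbert90 g gg†≈1 = h , regular⇒unit h h-regular , sym gh†≈h
      where
      x = 1# + g
      k = proj₁ (idempotent-power x)
      o = proj₁ (unit-torsion g (g † , gg†≈1))
      e = x ^ suc k
      ee≈e = proj₂ (idempotent-power x)
      f = 1# - e

      e+f≈1 : e + f ≈ 1#
      e+f≈1 = trans (+-comm e f) (trans (+-assoc 1# (- e) e) (trans (+-congˡ (-‿inverseˡ e)) (+-identityʳ 1#)))

      x≈gx† : x ≈ g * x †
      x≈gx† = begin
        1# + g               ≈⟨ +-comm 1# g ⟩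
        g + 1#               ≈⟨ +-cong (*-identityʳ g) gg†≈1 ⟨
        g * 1# + g * g †     ≈⟨ distribˡ g 1# (g †) ⟨
        g * (1# + g †)       ≈⟨ *-congˡ (trans (†-homo-+ 1# g) (+-congʳ †-1#)) ⟨
        g * x †              ∎

      x^n≈e : x ^ (suc k ℕ.* suc o) ≈ e
      x^n≈e = trans (sym (^-assocʳ x (suc k) (suc o))) (idempotent-^ ee≈e o)

      g^n≈1 : g ^ (suc k ℕ.* suc o) ≈ 1#
      g^n≈1 = begin
        g ^ (suc k ℕ.* suc o)   ≡⟨ ≡.cong (g ^_) (ℕ.*-comm (suc k) (suc o)) ⟩
        g ^ (suc o ℕ.* suc k)   ≈⟨ ^-assocʳ g (suc o) (suc k) ⟨
        (g ^ suc o) ^ suc k     ≈⟨ ^-congˡ (suc k) (proj₂ (unit-torsion g (g † , gg†≈1))) ⟩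
        1# ^ suc k              ≈⟨ idempotent-^ (*-identityˡ 1#) k ⟩
        1#                      ∎

      -- The exponent is a multiple of `suc k`, so it turns `x` into `e`, and of the exponent
      -- `suc o` that kills `g`, so the factor `g` in `x ≈ g * x †` disappears.
      e†≈e : e † ≈ e
      e†≈e = sym (begin
        e                                              ≈⟨ x^n≈e ⟨
        x ^ (suc k ℕ.* suc o)                          ≈⟨ ^-congˡ (suc k ℕ.* suc o) x≈gx† ⟩
        (g * x †) ^ (suc k ℕ.* suc o)                  ≈⟨ ^-distrib-* g (x †) (suc k ℕ.* suc o) ⟩
        g ^ (suc k ℕ.* suc o) * (x †) ^ (suc k ℕ.* suc o)  ≈⟨ *-cong g^n≈1 (sym (†-^ x (suc k ℕ.* suc o))) ⟩
        1# * (x ^ (suc k ℕ.* suc o)) †                 ≈⟨ *-identityˡ _ ⟩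
        (x ^ (suc k ℕ.* suc o)) †                      ≈⟨ †-cong x^n≈e ⟩
        e †                                            ∎)

      f†≈f : f † ≈ f
      f†≈f = +-cancelˡ e (f †) f (begin
        e + f †     ≈⟨ +-congʳ e†≈e ⟨
        e † + f †   ≈⟨ †-homo-+ e f ⟨
        (e + f) †   ≈⟨ †-cong e+f≈1 ⟩
        1# †        ≈⟨ †-1# ⟩
        1#          ≈⟨ e+f≈1 ⟨
        e + f       ∎)

      c₀ = e + f * d
      h = c₀ + g * c₀ †

      c₀† : c₀ † ≈ e + f * d †
      c₀† = trans (†-homo-+ e (f * d)) (+-cong e†≈e (trans (†-homo-* f d) (*-congʳ f†≈f)))

      gh†≈h : g * h † ≈ h
      gh†≈h = begin
        g * h †
          ≈⟨ *-congˡ (trans (†-homo-+ c₀ (g * c₀ †)) (+-congˡ (trans (†-homo-* g (c₀ †)) (*-congˡ (†-involutive c₀))))) ⟩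
        g * (c₀ † + g † * c₀)
          ≈⟨ solve 4 (λ g g' a b → g :* (b :+ g' :* a) := g :* g' :* a :+ g :* b) refl g (g †) c₀ (c₀ †) ⟩
        g * g † * c₀ + g * c₀ †            ≈⟨ +-congʳ (trans (*-congʳ gg†≈1) (*-identityˡ c₀)) ⟩
        h                                  ∎

      -- The factor equals `δ + x * d †`, a unit plus a multiple of `x`. Multiplied by `x ^ m` while
      -- `x ^ suc m` kills `y`, it leaves only δ x^m y = 0, so the exponent drops by one.
      nilpotent-part : ∀ {y} → (d + g * d †) * y ≈ 0# → ∀ m → x ^ m * y ≈ 0# → y ≈ 0#
      nilpotent-part {y} eq zero x^my≈0 = trans (sym (*-identityˡ y)) x^my≈0
      nilpotent-part {y} eq (suc m) x^my≈0 = nilpotent-part eq m (unit-cancel δ-unit (begin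
        δ * (x ^ m * y)                                       ≈⟨ +-identityʳ _ ⟨
        δ * (x ^ m * y) + 0#                                  ≈⟨ +-congˡ (trans (*-congˡ x^my≈0) (zeroʳ (d †))) ⟨
        δ * (x ^ m * y) + d † * (x * x ^ m * y)               ≈⟨ solve 5 (λ δ d' g z y →
                                                                   δ :* (z :* y) :+ d' :* ((con 1 :+ g) :* z :* y)
              := z :* ((δ :+ d' :+ g :* d') :* y)) refl δ (d †) g (x ^ m) y ⟩
        x ^ m * ((δ + d † + g * d †) * y)                     ≈⟨ *-congˡ (*-congʳ (+-congʳ d≈δ+d†)) ⟨
        x ^ m * ((d + g * d †) * y)                           ≈⟨ *-congˡ eq ⟩
        x ^ m * 0#                                            ≈⟨ zeroʳ _ ⟩
        0#                                                    ∎))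

      ef≈0 : e * f ≈ 0#
      ef≈0 = +-cancelˡ e _ _ (begin
        e + e * f       ≈⟨ +-congʳ ee≈e ⟨
        e * e + e * f   ≈⟨ distribˡ e e f ⟨
        e * (e + f)     ≈⟨ *-congˡ e+f≈1 ⟩
        e * 1#          ≈⟨ *-identityʳ e ⟩
        e               ≈⟨ +-identityʳ e ⟨
        e + 0#          ∎)

      ff≈f : f * f ≈ f
      ff≈f = begin
        f * f           ≈⟨ +-identityˡ _ ⟨
        0# + f * f      ≈⟨ +-congʳ ef≈0 ⟨
        e * f + f * f   ≈⟨ distribʳ f e f ⟨
        (e + f) * f     ≈⟨ *-congʳ e+f≈1 ⟩
        1# * f          ≈⟨ *-identityˡ f ⟩
        f               ∎

      h≈ : h ≈ e + f * d + g * (e + f * d †)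
      h≈ = +-congˡ (*-congˡ c₀†)

      eh≈xe : e * h ≈ x * e
      eh≈xe = begin
        e * h                                                    ≈⟨ *-congˡ h≈ ⟩
        e * (e + f * d + g * (e + f * d †))                      ≈⟨ solve 5 (λ e f d d' g →
                                                                      e :* (e :+ f :* d :+ g :* (e :+ f :* d'))
              := (con 1 :+ g) :* (e :* e) :+ (e :* f) :* (d :+ g :* d')) refl e f d (d †) g ⟩
        x * (e * e) + e * f * (d + g * d †)
          ≈⟨ +-cong (*-congˡ ee≈e) (trans (*-congʳ ef≈0) (zeroˡ _)) ⟩
        x * e + 0#                                               ≈⟨ +-identityʳ _ ⟩
        x * e                                                    ∎

      fh≈ : f * h ≈ (d + g * d †) * f
      fh≈ = begin
        f * h                                                    ≈⟨ *-congˡ h≈ ⟩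
        f * (e + f * d + g * (e + f * d †))                      ≈⟨ solve 5 (λ e f d d' g →
                                                                      f :* (e :+ f :* d :+ g :* (e :+ f :* d'))
              := (con 1 :+ g) :* (e :* f) :+ (d :+ g :* d') :* (f :* f)) refl e f d (d †) g ⟩
        x * (e * f) + (d + g * d †) * (f * f)
          ≈⟨ +-cong (trans (*-congˡ ef≈0) (zeroʳ x)) (*-congˡ ff≈f) ⟩
        0# + (d + g * d †) * f                                   ≈⟨ +-identityˡ _ ⟩
        (d + g * d †) * f                                        ∎

      -- On the summand of `e` the element `h` acts as `x`, which is invertible there since
      -- `x ^ suc k` is `e`; this forces e y = 0. Then `y` lies in the summand of `f`, where `h`
      -- acts as `d + g * d †` and `x` is nilpotent.
      h-regular : ∀ y → h * y ≈ 0# → y ≈ 0#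
      h-regular y hy≈0 = nilpotent-part (begin
        (d + g * d †) * y                  ≈⟨ *-congˡ fy≈y ⟨
        (d + g * d †) * (f * y)            ≈⟨ *-assoc _ f y ⟨
        (d + g * d †) * f * y              ≈⟨ *-congʳ fh≈ ⟨
        f * h * y                          ≈⟨ *-assoc f h y ⟩
        f * (h * y)                        ≈⟨ trans (*-congˡ hy≈0) (zeroʳ f) ⟩
        0#                                 ∎) (suc k) ey≈0
        where
        ey≈0 : e * y ≈ 0#
        ey≈0 = begin
          e * y                            ≈⟨ *-congʳ ee≈e ⟨
          x * x ^ k * e * y
            ≈⟨ solve 4 (λ x z e y → x :* z :* e :* y := z :* (x :* e :* y)) refl x (x ^ k) e y ⟩
          x ^ k * (x * e * y)              ≈⟨ *-congˡ (*-congʳ eh≈xe) ⟨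
          x ^ k * (e * h * y)              ≈⟨ *-congˡ (*-assoc e h y) ⟩
          x ^ k * (e * (h * y))            ≈⟨ *-congˡ (trans (*-congˡ hy≈0) (zeroʳ e)) ⟩
          x ^ k * 0#                       ≈⟨ zeroʳ _ ⟩
          0#                               ∎
        fy≈y : f * y ≈ y
        fy≈y = begin
          f * y                            ≈⟨ +-identityˡ _ ⟨
          0# + f * y                       ≈⟨ +-congʳ ey≈0 ⟨
          e * y + f * y                    ≈⟨ distribʳ y e f ⟨
          (e + f) * y                      ≈⟨ *-congʳ e+f≈1 ⟩
          1# * y                           ≈⟨ *-identityˡ y ⟩
          y                                ∎

    private
      conjugate-unit : ∀ u → Unit u → Unit (u †)
      conjugate-unit u (v , uv≈1) = v † , trans (sym (†-homo-* u v)) (trans (†-cong uv≈1) †-1#)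

      open AbelianGroup unitGroup using () renaming
        (Carrier to Units; _∙_ to _·_; _⁻¹ to _⁻¹; ε to ε; _≈_ to _≃_; ⁻¹-cong to ⁻¹-cong)

      conjugate : Units → Units
      conjugate (u , unit) = u † , conjugate-unit u unit

      norm quotient : Units → Units
      norm u = u · conjugate u
      quotient u = u · conjugate u ⁻¹

      quotient-norm : ∀ u → quotient (norm u) ≃ ε
      quotient-norm u@(a , b , ab≈1) = begin
        a * a † * (b * b †) †              ≈⟨ *-congˡ (trans (†-homo-* b (b †)) (*-congˡ (†-involutive b))) ⟩
        a * a † * (b † * b)
          ≈⟨ solve 4 (λ a a' b b' → a :* a' :* (b' :* b) := (a :* b) :* (a' :* b')) refl a (a †) b (b †) ⟩
        a * b * (a † * b †)                ≈⟨ *-cong ab≈1 (proj₂ (conjugate-unit a (b , ab≈1))) ⟩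
        1# * 1#                            ≈⟨ *-identityˡ 1# ⟩
        1#                                 ∎

      norm-kernel : ∀ u → norm u ≃ ε → ∃ λ h → quotient h ≃ u
      norm-kernel (g , _) gg†≈1 =
        let h , h-unit , h≈gh† = hilbert90 g gg†≈1
            v , h†v≈1 = conjugate-unit h h-unit
        in (h , h-unit) , (begin
          h * v           ≈⟨ *-congʳ h≈gh† ⟩
          g * h † * v     ≈⟨ *-assoc g (h †) v ⟩
          g * (h † * v)   ≈⟨ *-congˡ h†v≈1 ⟩
          g * 1#          ≈⟨ *-identityʳ g ⟩
          g               ∎)

      norm-homo : ∀ u v → norm (u · v) ≃ norm u · norm v
      norm-homo (a , _) (b , _) = trans (*-congˡ (†-homo-* a b)) (interchange a b (a †) (b †))

      quotient-homo : ∀ u v → quotient (u · v) ≃ quotient u · quotient v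
      quotient-homo (a , a' , _) (b , b' , _) = trans (*-congˡ (†-homo-* a' b')) (interchange a b (a' †) (b' †))

      norm-cong : ∀ {u v} → u ≃ v → norm u ≃ norm v
      norm-cong a≈b = *-cong a≈b (†-cong a≈b)

      quotient-cong : ∀ {u v} → u ≃ v → quotient u ≃ quotient v
      quotient-cong {u} {v} a≈b = *-cong a≈b (⁻¹-cong {conjugate u} {conjugate v} (†-cong a≈b))

    -- Being self-adjoint means lying in the kernel of u ↦ u / u†. Hilbert 90 is the vanishing of
    -- one cohomology group of the unit group, and the Herbrand argument turns it into the vanishing
    -- of the other.
    selfadjoint-unit-is-norm : ∀ t → Unit t → t † ≈ t → ¬ ¬ (∃ λ z → z * z † ≈ t)
    selfadjoint-unit-is-norm t t-unit@(s , ts≈1) t†≈t k =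
      kerδ⊆imN (t , t-unit) (trans (*-congʳ (sym t†≈t)) (proj₂ (conjugate-unit t t-unit))) λ { ((z , _) , eq) → k (z , eq) }
      where
      open Herbrand unitGroup (code ∘ proj₁) code-cong code-injective norm quotient
        (λ {u} {v} → norm-cong {u} {v}) (λ {u} {v} → quotient-cong {u} {v})
        norm-homo quotient-homo quotient-norm norm-kernel

-- Binomial coefficients and primes.

prime∤! : ∀ {p} → ℕ.Prime p → ∀ m → m ℕ.< p → ¬ p ℕ.∣ m ℕ.!
prime∤! pp zero 0<p p∣1 = contradiction (ℕ.∣1⇒≡1 p∣1) λ { ≡.refl → ℕ.¬prime[1] pp }
prime∤! pp (suc m) m<p p∣ with ℕ.euclidsLemma (suc m) (m ℕ.!) pp p∣
... | inj₁ p∣1+m = ℕ.<⇒≱ m<p (ℕ.∣⇒≤ p∣1+m)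
... | inj₂ p∣m! = prime∤! pp m (ℕ.<-trans (ℕ.n<1+n m) m<p) p∣m!

-- The prime divides p!, which is the binomial coefficient times k! (p - k)!, but it divides neither
-- of these two factorials, whose factors are all smaller.
prime∣C : ∀ {p} → ℕ.Prime p → ∀ k → 0 ℕ.< k → k ℕ.< p → p ℕ.∣ (p ℕ.C k)
prime∣C {p@(suc p-1)} pp k@(suc k-1) 0<k k<p
  with ℕ.euclidsLemma (p ℕ.C k) (k ℕ.! ℕ.* (p ℕ.∸ k) ℕ.!) pp
         (≡.subst (p ℕ.∣_) (≡.sym C*≡) (ℕ.m∣m*n (p-1 ℕ.!)))
  where
  instance _ = k ℕ.!* (p ℕ.∸ k) !≢0
  C*≡ : (p ℕ.C k) ℕ.* (k ℕ.! ℕ.* (p ℕ.∸ k) ℕ.!) ≡ p ℕ.!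
  C*≡ = ≡.trans (≡.cong (ℕ._* (k ℕ.! ℕ.* (p ℕ.∸ k) ℕ.!)) (ℕ.nCk≡n!/k![n-k]! (ℕ.<⇒≤ k<p)))
                (ℕ.m/n*n≡m (ℕ.k![n∸k]!∣n! (ℕ.<⇒≤ k<p)))
... | inj₁ p∣C = p∣C
... | inj₂ p∣k![p-k]! with ℕ.euclidsLemma (k ℕ.!) ((p ℕ.∸ k) ℕ.!) pp p∣k![p-k]!
...   | inj₁ p∣k! = contradiction p∣k! (prime∤! pp k k<p)
...   | inj₂ p∣[p-k]! = contradiction p∣[p-k]! (prime∤! pp (p ℕ.∸ k) (ℕ.s≤s (ℕ.m∸n≤m p-1 k-1)))

prime-power≥2 : ∀ {q} → IsPrimePower q → 2 ℕ.≤ q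
prime-power≥2 (p , k , pp , 1≤k , ≡.refl) =
  ℕ.≤-trans (ℕ.nonTrivial⇒n>1 p) (≡.subst (ℕ._≤ p ℕ.^ k) (ℕ.*-identityʳ p) (ℕ.^-monoʳ-≤ p 1≤k))
  where
  instance
    p≢0 = ℕ.prime⇒nonZero pp
    p≢1 = ℕ.prime⇒nonTrivial pp

-- Finite sums, Fermat's theorem and the Frobenius map.

module _ {c ℓ} (M : CommutativeMonoid c ℓ) where
  open CommutativeMonoid M
  open Algebra.Properties.CommutativeMonoid.Sum M

  sum-ε : ∀ {m} (t : Fin m → Carrier) → (∀ i → t i ≈ ε) → sum t ≈ ε
  sum-ε {zero} t t≈ε = refl
  sum-ε {suc m} t t≈ε = trans (∙-cong (t≈ε Fin.zero) (sum-ε (t ∘ Fin.suc) (t≈ε ∘ Fin.suc))) (identityˡ ε)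

  sum-single : ∀ {m} (t : Fin m → Carrier) j → (∀ i → i ≢ j → t i ≈ ε) → sum t ≈ t j
  sum-single t Fin.zero h = trans
    (∙-congˡ (sum-ε (t ∘ Fin.suc) (λ i → h (Fin.suc i) λ ()))) (identityʳ _)
  sum-single t (Fin.suc j) h = trans
    (∙-cong (h Fin.zero λ ()) (sum-single (t ∘ Fin.suc) j (λ i i≢j → h (Fin.suc i) (i≢j ∘ Fin.suc-injective))))
    (identityˡ _)

module Field (F : FiniteField) where
  open FiniteField F

  commutativeRing : CommutativeRing _ _
  commutativeRing = record { isCommutativeRing = isCommutativeRing }

  open CommutativeRing commutativeRing public
    hiding (Carrier; _≈_; _+_; _*_; -_; 0#; 1#; isCommutativeRing; refl; sym; trans; reflexive; isEquivalence; setoid)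
  open Algebra.Properties.Ring ring public
    using (-‿distribˡ-*; -‿distribʳ-*; x∙y⁻¹≈ε⇒x≈y; +-identityˡ-unique; +-inverseʳ-unique)
  open Algebra.Properties.Semiring.Exp semiring using (^-assocʳ) renaming (_^_ to _^ˢ_)
  open Algebra.Properties.CommutativeSemiring.Exp commutativeSemiring using (^-distrib-*)
  private
    module Mult = Algebra.Properties.Semiring.Mult semiring
    module Sum = Algebra.Properties.Semiring.Sum semiring
    module Prod = Algebra.Properties.CommutativeMonoid.Sum *-commutativeMonoid
  open Mult using () renaming (_×_ to _×ⁿ_)
  open ≡.≡-Reasoning

  _≟_ : DecidableEquality Carrier
  _≟_ = via-injection (↔⇒↣ enumeration) Fin._≟_

  index : Carrier → Fin size
  index = Inverse.to enumeration

  element : Fin size → Carrier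
  element = Inverse.from enumeration

  element-index : ∀ x → element (index x) ≡ x
  element-index x = Inverse.inverseʳ enumeration ≡.refl

  index-element : ∀ i → index (element i) ≡ i
  index-element i = Inverse.inverseˡ enumeration ≡.refl

  index-injective : ∀ {x y} → index x ≡ index y → x ≡ y
  index-injective {x} {y} eq = ≡.trans (≡.sym (element-index x)) (≡.trans (≡.cong element eq) (element-index y))

  *-cancelˡ : ∀ x {y z} → x ≢ 0# → x * y ≡ x * z → y ≡ z
  *-cancelˡ x {y} {z} x≢0 eq = let x⁻¹ , xx⁻¹≡1 = inverse x x≢0 in begin
    y                ≡⟨ cancel x⁻¹ xx⁻¹≡1 y ⟨
    x⁻¹ * (x * y)    ≡⟨ ≡.cong (x⁻¹ *_) eq ⟩
    x⁻¹ * (x * z)    ≡⟨ cancel x⁻¹ xx⁻¹≡1 z ⟩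
    z                ∎
    where
    cancel : ∀ x⁻¹ → x * x⁻¹ ≡ 1# → ∀ y → x⁻¹ * (x * y) ≡ y
    cancel x⁻¹ xx⁻¹≡1 y = begin
      x⁻¹ * (x * y)    ≡⟨ *-assoc x⁻¹ x y ⟨
      x⁻¹ * x * y      ≡⟨ ≡.cong (_* y) (≡.trans (*-comm x⁻¹ x) xx⁻¹≡1) ⟩
      1# * y           ≡⟨ *-identityˡ y ⟩
      y                ∎

  *-zero-divisor : ∀ x {y} → x ≢ 0# → x * y ≡ 0# → y ≡ 0#
  *-zero-divisor x x≢0 eq = *-cancelˡ x x≢0 (≡.trans eq (≡.sym (zeroʳ x)))

  infixr 8 _^_
  _^_ : Carrier → ℕ → Carrier
  _^_ = pow F

  ^≡^ˢ : ∀ x n → x ^ n ≡ x ^ˢ n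
  ^≡^ˢ x zero = ≡.refl
  ^≡^ˢ x (suc n) = ≡.cong (x *_) (^≡^ˢ x n)

  ^-^ : ∀ x m n → (x ^ m) ^ n ≡ x ^ (m ℕ.* n)
  ^-^ x m n rewrite ^≡^ˢ (x ^ m) n | ^≡^ˢ x m | ^≡^ˢ x (m ℕ.* n) = ^-assocʳ x m n

  ^-distrib : ∀ x y n → (x * y) ^ n ≡ x ^ n * y ^ n
  ^-distrib x y n rewrite ^≡^ˢ (x * y) n | ^≡^ˢ x n | ^≡^ˢ y n = ^-distrib-* x y n

  1^ : ∀ n → 1# ^ n ≡ 1#
  1^ zero = ≡.refl
  1^ (suc n) = ≡.trans (*-identityˡ _) (1^ n)

  ^≢0 : ∀ x n → x ≢ 0# → x ^ n ≢ 0#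
  ^≢0 x zero x≢0 eq = 0≢1 (≡.sym eq)
  ^≢0 x (suc n) x≢0 eq = ^≢0 x n x≢0 (*-zero-divisor x x≢0 eq)

  ∑ : ∀ {m} → (Fin m → Carrier) → Carrier
  ∑ = Σ F

  ∑≡sum : ∀ {m} (f : Fin m → Carrier) → ∑ f ≡ Sum.sum f
  ∑≡sum {zero} f = ≡.refl
  ∑≡sum {suc m} f = ≡.cong (f Fin.zero +_) (∑≡sum (f ∘ Fin.suc))

  ∑-cong : ∀ {m} {f g : Fin m → Carrier} → (∀ i → f i ≡ g i) → ∑ f ≡ ∑ g
  ∑-cong {zero} eq = ≡.refl
  ∑-cong {suc m} eq = ≡.cong₂ _+_ (eq Fin.zero) (∑-cong (eq ∘ Fin.suc))

  ∑-+ : ∀ {m} (f g : Fin m → Carrier) → ∑ (λ i → f i + g i) ≡ ∑ f + ∑ g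
  ∑-+ f g rewrite ∑≡sum (λ i → f i + g i) | ∑≡sum f | ∑≡sum g = Sum.∑-distrib-+ f g

  *-∑ : ∀ {m} x (f : Fin m → Carrier) → x * ∑ f ≡ ∑ (λ i → x * f i)
  *-∑ x f rewrite ∑≡sum (λ i → x * f i) | ∑≡sum f = Sum.*-distribˡ-sum x f

  ∑-* : ∀ {m} (f : Fin m → Carrier) x → ∑ f * x ≡ ∑ (λ i → f i * x)
  ∑-* f x rewrite ∑≡sum (λ i → f i * x) | ∑≡sum f = Sum.*-distribʳ-sum x f

  ∑-swap : ∀ {m n} (f : Fin m → Fin n → Carrier) → ∑ (λ i → ∑ (f i)) ≡ ∑ (λ j → ∑ (λ i → f i j))
  ∑-swap f = begin
    ∑ (λ i → ∑ (f i))                        ≡⟨ ∑-cong (λ i → ∑≡sum (f i)) ⟩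
    ∑ (λ i → Sum.sum (f i))                  ≡⟨ ∑≡sum (λ i → Sum.sum (f i)) ⟩
    Sum.sum (λ i → Sum.sum (f i))            ≡⟨ Sum.∑-comm f ⟩
    Sum.sum (λ j → Sum.sum (λ i → f i j))    ≡⟨ ∑≡sum (λ j → Sum.sum (λ i → f i j)) ⟨
    ∑ (λ j → Sum.sum (λ i → f i j))          ≡⟨ ∑-cong (λ j → ∑≡sum (λ i → f i j)) ⟨
    ∑ (λ j → ∑ (λ i → f i j))                ∎

  ∑-single : ∀ {m} (f : Fin m → Carrier) j → (∀ i → i ≢ j → f i ≡ 0#) → ∑ f ≡ f j
  ∑-single f j h = ≡.trans (∑≡sum f) (sum-single +-commutativeMonoid f j h)

  ∑-0 : ∀ {m} (f : Fin m → Carrier) → (∀ i → f i ≡ 0#) → ∑ f ≡ 0#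
  ∑-0 f h = ≡.trans (∑≡sum f) (sum-ε +-commutativeMonoid f h)

  ∑-permute : ∀ {m n} (f : Fin n → Carrier) (π : Perm.Permutation m n) → ∑ f ≡ ∑ (λ i → f (π Perm.⟨$⟩ʳ i))
  ∑-permute f π rewrite ∑≡sum f | ∑≡sum (λ i → f (π Perm.⟨$⟩ʳ i)) = Sum.sum-permute f π

  -- For nonzero `x` the product over the field is compared with itself under y ↦ x y. Zero stays in
  -- the index set: `f` replaces it by `1#`, and `h` supplies the missing factor `x` at that one
  -- place. Hence the exponent is `size` itself, and ∏ f is cancelled from ∏ f * x = ∏ f * x^size.
  fermat : ∀ x → x ^ size ≡ x
  fermat x with x ≟ 0#
  ... | yes ≡.refl = zero-power size ≡.refl
    where
    zero-power : ∀ n → n ≡ size → 0# ^ n ≡ 0#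
    zero-power zero eq with () ← ≡.subst Fin (≡.sym eq) (index 0#)
    zero-power (suc n) eq = zeroˡ _
  ... | no x≢0 = ≡.sym (*-cancelˡ (∏ f) ∏f≢0 (begin
    ∏ f * x                               ≡⟨ ≡.cong (∏ f *_) ∏h ⟨
    ∏ f * ∏ h                             ≡⟨ ≡.cong (_* ∏ h) (Prod.sum-permute (f ∘ element) π) ⟩
    ∏′ (λ i → f (element (index (x * element i)))) * ∏ h
              ≡⟨ ≡.cong (_* ∏ h) (Prod.sum-cong-≋ (λ i → ≡.cong f (element-index (x * element i)))) ⟩
    ∏ (λ y → f (x * y)) * ∏ h             ≡⟨ Prod.∑-distrib-+ (λ i → f (x * element i)) (h ∘ element) ⟨
    ∏ (λ y → f (x * y) * h y)             ≡⟨ Prod.sum-cong-≋ (λ i → fh (element i)) ⟩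
    ∏ (λ y → f y * x)                     ≡⟨ Prod.∑-distrib-+ (f ∘ element) (λ _ → x) ⟩
    ∏ f * ∏ (λ _ → x)                     ≡⟨ ≡.cong (∏ f *_) (Prod.sum-replicate size) ⟩
    ∏ f * (x ^ˢ size)                     ≡⟨ ≡.cong (∏ f *_) (^≡^ˢ x size) ⟨
    ∏ f * x ^ size                        ∎))
    where
    ∏′ = Prod.sum

    ∏ : (Carrier → Carrier) → Carrier
    ∏ g = ∏′ (g ∘ element)

    π : Perm.Permutation size size
    π = let x⁻¹ , xx⁻¹≡1 = inverse x x≢0
            undo : ∀ a b → a * b ≡ 1# → ∀ i → index (a * element (index (b * element i))) ≡ i
            undo a b ab≡1 i = begin
              index (a * element (index (b * element i)))   ≡⟨ ≡.cong (λ z → index (a * z)) (element-index _) ⟩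
              index (a * (b * element i))                   ≡⟨ ≡.cong index (*-assoc a b _) ⟨
              index (a * b * element i)                     ≡⟨ ≡.cong (λ z → index (z * element i)) ab≡1 ⟩
              index (1# * element i)                        ≡⟨ ≡.cong index (*-identityˡ _) ⟩
              index (element i)                             ≡⟨ index-element i ⟩
              i                                             ∎
        in Perm.permutation (λ i → index (x * element i)) (λ i → index (x⁻¹ * element i))
             (undo x x⁻¹ xx⁻¹≡1) (undo x⁻¹ x (≡.trans (*-comm x⁻¹ x) xx⁻¹≡1))

    f h : Carrier → Carrier
    f y with y ≟ 0#
    ... | yes _ = 1#
    ... | no _ = y
    h y with y ≟ 0#
    ... | yes _ = x
    ... | no _ = 1#

    f≢0 : ∀ y → f y ≢ 0#
    f≢0 y with y ≟ 0#
    ... | yes _ = λ eq → 0≢1 (≡.sym eq)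
    ... | no y≢0 = y≢0

    fh : ∀ y → f (x * y) * h y ≡ f y * x
    fh y with y ≟ 0# | (x * y) ≟ 0#
    ... | yes _ | yes _ = ≡.refl
    ... | yes ≡.refl | no xy≢0 = contradiction (zeroʳ x) xy≢0
    ... | no y≢0 | yes xy≡0 = contradiction (*-zero-divisor x x≢0 xy≡0) y≢0
    ... | no _ | no _ = ≡.trans (*-identityʳ _) (*-comm x y)

    ∏f≢0 : ∏ f ≢ 0#
    ∏f≢0 = product≢0 (f ∘ element) (f≢0 ∘ element)
      where
      product≢0 : ∀ {m} (t : Fin m → Carrier) → (∀ i → t i ≢ 0#) → ∏′ t ≢ 0#
      product≢0 {zero} t t≢0 eq = 0≢1 (≡.sym eq)
      product≢0 {suc m} t t≢0 eq =
        product≢0 (t ∘ Fin.suc) (t≢0 ∘ Fin.suc) (*-zero-divisor (t Fin.zero) (t≢0 Fin.zero) eq)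

    h0≡x : h 0# ≡ x
    h0≡x with 0# ≟ 0#
    ... | yes _ = ≡.refl
    ... | no 0≢0 = contradiction ≡.refl 0≢0

    ∏h : ∏ h ≡ x
    ∏h = begin
      ∏ h                        ≡⟨ sum-single *-commutativeMonoid (h ∘ element) (index 0#) h≡1 ⟩
      h (element (index 0#))     ≡⟨ ≡.cong h (element-index 0#) ⟩
      h 0#                       ≡⟨ h0≡x ⟩
      x                          ∎
      where
      h≡1 : ∀ i → i ≢ index 0# → h (element i) ≡ 1#
      h≡1 i i≢0 with element i ≟ 0#
      ... | yes eq = contradiction (≡.trans (≡.sym (index-element i)) (≡.cong index eq)) i≢0
      ... | no _ = ≡.refl

  -- Translation by `1#` permutes the field, so the sum of all elements is unchanged when `1#` is
  -- added to each of them.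
  size×1≡0 : size ×ⁿ 1# ≡ 0#
  size×1≡0 = +-identityˡ-unique _ (Sum.sum element) (begin
    size ×ⁿ 1# + Sum.sum element                    ≡⟨ ≡.cong (_+ Sum.sum element) (Sum.sum-replicate size) ⟨
    Sum.sum {size} (λ _ → 1#) + Sum.sum element     ≡⟨ Sum.∑-distrib-+ (λ _ → 1#) element ⟨
    Sum.sum (λ i → 1# + element i)                  ≡⟨ Sum.sum-cong-≋ (λ i → element-index (1# + element i)) ⟨
    Sum.sum (λ i → element (index (1# + element i))) ≡⟨ Sum.sum-permute element π ⟨
    Sum.sum element                                 ∎)
    where
    undo : ∀ a b → a + b ≡ 0# → ∀ i → index (a + element (index (b + element i))) ≡ i
    undo a b ab≡0 i = begin
      index (a + element (index (b + element i)))   ≡⟨ ≡.cong (λ z → index (a + z)) (element-index _) ⟩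
      index (a + (b + element i))                   ≡⟨ ≡.cong index (+-assoc a b _) ⟨
      index (a + b + element i)                     ≡⟨ ≡.cong (λ z → index (z + element i)) ab≡0 ⟩
      index (0# + element i)                        ≡⟨ ≡.cong index (+-identityˡ _) ⟩
      index (element i)                             ≡⟨ index-element i ⟩
      i                                             ∎
    π : Perm.Permutation size size
    π = Perm.permutation (λ i → index (1# + element i)) (λ i → index (- 1# + element i))
          (undo 1# (- 1#) (-‿inverseʳ 1#)) (undo (- 1#) 1# (-‿inverseˡ 1#))

  -- The m-th power of p·1 is size·1 = 0, and a field has no nonzero nilpotent elements.
  characteristic : ∀ p m → size ≡ p ℕ.^ m → ∀ x → p ×ⁿ x ≡ 0#
  characteristic p m size≡p^m x = begin
    p ×ⁿ x             ≡⟨ ≡.cong (p ×ⁿ_) (*-identityˡ x) ⟨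
    p ×ⁿ (1# * x)      ≡⟨ Mult.×-assoc-* p 1# x ⟨
    (p ×ⁿ 1#) * x      ≡⟨ ≡.cong (_* x) p×1≡0 ⟩
    0# * x             ≡⟨ zeroˡ x ⟩
    0#                 ∎
    where
    ×1-^ : ∀ m → (p ℕ.^ m) ×ⁿ 1# ≡ (p ×ⁿ 1#) ^ m
    ×1-^ zero = +-identityʳ 1#
    ×1-^ (suc m) = ≡.trans (Mult.×1-homo-* p (p ℕ.^ m)) (≡.cong ((p ×ⁿ 1#) *_) (×1-^ m))

    p×1≡0 : p ×ⁿ 1# ≡ 0#
    p×1≡0 with (p ×ⁿ 1#) ≟ 0#
    ... | yes eq = eq
    ... | no p×1≢0 = contradiction (≡.trans (≡.sym (×1-^ m)) (≡.trans (≡.cong (_×ⁿ 1#) (≡.sym size≡p^m)) size×1≡0))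
                                   (^≢0 _ m p×1≢0)

  ^p-homo-+ : ∀ p m → ℕ.Prime p → size ≡ p ℕ.^ m → ∀ x y → (x + y) ^ p ≡ x ^ p + y ^ p
  ^p-homo-+ zero m pp _ = contradiction pp ℕ.¬prime[0]
  ^p-homo-+ p@(suc p-1) m pp size≡p^m x y = begin
    (x + y) ^ p                                   ≡⟨ ^≡^ˢ (x + y) p ⟩
    (x + y) ^ˢ p                                  ≡⟨ theorem p x y ⟩
    Sum.sum (binomialTerm x y p)                  ≡⟨⟩
    term Fin.zero + Sum.sum (term ∘ Fin.suc)      ≡⟨ ≡.cong (term Fin.zero +_) (Sum.sum-init-last (term ∘ Fin.suc)) ⟩
    term Fin.zero + (Sum.sum (λ i → term (Fin.suc (Fin.inject₁ i))) + term (Fin.suc (Fin.fromℕ p-1)))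
              ≡⟨ ≡.cong₂ _+_ term-first (≡.cong₂ _+_ (sum-ε +-commutativeMonoid _ term-middle) term-last) ⟩
    y ^ p + (0# + x ^ p)                          ≡⟨ ≡.cong (y ^ p +_) (+-identityˡ _) ⟩
    y ^ p + x ^ p                                 ≡⟨ +-comm _ _ ⟩
    x ^ p + y ^ p                                 ∎
    where
    open Algebra.Properties.CommutativeSemiring.Binomial commutativeSemiring
    term = binomialTerm x y p

    term-first : term Fin.zero ≡ y ^ p
    term-first = ≡.trans (+-identityʳ _) (≡.trans (*-identityˡ _) (≡.sym (^≡^ˢ y p)))

    term-last : term (Fin.suc (Fin.fromℕ p-1)) ≡ x ^ p
    term-last rewrite Fin.toℕ-fromℕ p-1 | ℕ.nCn≡1 p | ℕ.n∸n≡0 p-1 =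
      ≡.trans (+-identityʳ _) (≡.trans (*-identityʳ _) (≡.sym (^≡^ˢ x p)))

    term-middle : ∀ i → term (Fin.suc (Fin.inject₁ i)) ≡ 0#
    term-middle i rewrite Fin.toℕ-inject₁ i
      with ℕ.divides c eq ← prime∣C pp (suc (toℕ i)) ℕ.z<s (ℕ.s<s (Fin.toℕ<n i)) = begin
        (p ℕ.C suc (toℕ i)) ×ⁿ z   ≡⟨ ≡.cong (_×ⁿ z) eq ⟩
        (c ℕ.* p) ×ⁿ z             ≡⟨ Mult.×-assocˡ z c p ⟨
        c ×ⁿ (p ×ⁿ z)              ≡⟨ ≡.cong (c ×ⁿ_) (characteristic p m size≡p^m z) ⟩
        c ×ⁿ 0#                    ≡⟨ Sum.sum-replicate c ⟨
        Sum.sum {c} (λ _ → 0#)     ≡⟨ Sum.sum-replicate-zero c ⟩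
        0#                         ∎
        where z = (x ^ˢ suc (toℕ i)) * (y ^ˢ (p ℕ.∸ suc (toℕ i)))

  ^p^j-homo-+ : ∀ p m j → ℕ.Prime p → size ≡ p ℕ.^ m → ∀ x y →
    (x + y) ^ (p ℕ.^ j) ≡ x ^ (p ℕ.^ j) + y ^ (p ℕ.^ j)
  ^p^j-homo-+ p m zero pp eq x y = ≡.trans (*-identityʳ _) (≡.sym (≡.cong₂ _+_ (*-identityʳ x) (*-identityʳ y)))
  ^p^j-homo-+ p m (suc j) pp eq x y = begin
    (x + y) ^ (p ℕ.* p ℕ.^ j)                     ≡⟨ ^-^ (x + y) p (p ℕ.^ j) ⟨
    ((x + y) ^ p) ^ (p ℕ.^ j)                     ≡⟨ ≡.cong (_^ (p ℕ.^ j)) (^p-homo-+ p m pp eq x y) ⟩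
    (x ^ p + y ^ p) ^ (p ℕ.^ j)                   ≡⟨ ^p^j-homo-+ p m j pp eq (x ^ p) (y ^ p) ⟩
    (x ^ p) ^ (p ℕ.^ j) + (y ^ p) ^ (p ℕ.^ j)     ≡⟨ ≡.cong₂ _+_ (^-^ x p (p ℕ.^ j)) (^-^ y p (p ℕ.^ j)) ⟩
    x ^ (p ℕ.* p ℕ.^ j) + y ^ (p ℕ.* p ℕ.^ j)     ∎

  prime-power-frobenius-+ : ∀ {q} → IsPrimePower q → ∀ N m → size ≡ q ℕ.^ N → ∀ x y →
    (x + y) ^ (q ℕ.^ m) ≡ x ^ (q ℕ.^ m) + y ^ (q ℕ.^ m)
  prime-power-frobenius-+ (p , k , pp , _ , ≡.refl) N m eq x y rewrite ℕ.^-*-assoc p k m =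
    ^p^j-homo-+ p (k ℕ.* N) (k ℕ.* m) pp (≡.trans eq (ℕ.^-*-assoc p k N)) x y

-- Counting decidable subsets of finite sets.

count : ∀ {p m} {P : Pred (Fin m) p} → Decidable P → ℕ
count {m = zero} P? = 0
count {m = suc m} P? with P? Fin.zero
... | yes _ = suc (count (P? ∘ Fin.suc))
... | no _ = count (P? ∘ Fin.suc)

count-split : ∀ {p r m} {P : Pred (Fin m) p} {R : Pred (Fin m) r} (P? : Decidable P) (R? : Decidable R) →
  count P? ≡ count (λ i → P? i ×-dec ¬? (R? i)) ℕ.+ count (λ i → P? i ×-dec R? i)
count-split {m = zero} P? R? = ≡.refl
count-split {m = suc m} P? R? with P? Fin.zero | R? Fin.zero
... | yes _ | yes _ = ≡.trans (≡.cong suc (count-split (P? ∘ Fin.suc) (R? ∘ Fin.suc))) (≡.sym (ℕ.+-suc _ _))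
... | yes _ | no _ = ≡.cong suc (count-split (P? ∘ Fin.suc) (R? ∘ Fin.suc))
... | no _ | _ = count-split (P? ∘ Fin.suc) (R? ∘ Fin.suc)

-- `select` and `rank` identify the subset with `Fin (count P?)`. The laws below compare first
-- components only, as proofs of `P` may differ.
select : ∀ {p m} {P : Pred (Fin m) p} (P? : Decidable P) → Fin (count P?) → ∃ P
select {m = suc m} P? j with P? Fin.zero
select {m = suc m} P? Fin.zero | yes p = Fin.zero , p
select {m = suc m} P? (Fin.suc j) | yes _ = let i , p = select (P? ∘ Fin.suc) j in Fin.suc i , p
select {m = suc m} P? j | no _ = let i , p = select (P? ∘ Fin.suc) j in Fin.suc i , p

rank : ∀ {p m} {P : Pred (Fin m) p} (P? : Decidable P) → ∃ P → Fin (count P?)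
rank {m = suc m} P? (i , p) with P? Fin.zero
rank {m = suc m} P? (Fin.zero , p) | yes _ = Fin.zero
rank {m = suc m} P? (Fin.suc i , p) | yes _ = Fin.suc (rank (P? ∘ Fin.suc) (i , p))
rank {m = suc m} P? (Fin.zero , p) | no ¬p = contradiction p ¬p
rank {m = suc m} P? (Fin.suc i , p) | no _ = rank (P? ∘ Fin.suc) (i , p)

select-rank : ∀ {p m} {P : Pred (Fin m) p} (P? : Decidable P) (x : ∃ P) → proj₁ (select P? (rank P? x)) ≡ proj₁ x
select-rank {m = suc m} P? (i , p) with P? Fin.zero
select-rank {m = suc m} P? (Fin.zero , p) | yes _ = ≡.refl
select-rank {m = suc m} P? (Fin.suc i , p) | yes _ = ≡.cong Fin.suc (select-rank (P? ∘ Fin.suc) (i , p))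
select-rank {m = suc m} P? (Fin.zero , p) | no ¬p = contradiction p ¬p
select-rank {m = suc m} P? (Fin.suc i , p) | no _ = ≡.cong Fin.suc (select-rank (P? ∘ Fin.suc) (i , p))

select-injective : ∀ {p m} {P : Pred (Fin m) p} (P? : Decidable P) {j k} →
  proj₁ (select P? j) ≡ proj₁ (select P? k) → j ≡ k
select-injective {m = suc m} P? {j} {k} eq with P? Fin.zero
select-injective {m = suc m} P? {Fin.zero} {Fin.zero} eq | yes _ = ≡.refl
select-injective {m = suc m} P? {Fin.suc j} {Fin.suc k} eq | yes _ =
  ≡.cong Fin.suc (select-injective (P? ∘ Fin.suc) (Fin.suc-injective eq))
... | no _ = select-injective (P? ∘ Fin.suc) (Fin.suc-injective eq)

rank-injective : ∀ {p m} {P : Pred (Fin m) p} (P? : Decidable P) {x y : ∃ P} → rank P? x ≡ rank P? y → proj₁ x ≡ proj₁ y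
rank-injective P? {x} {y} eq =
  ≡.trans (≡.sym (select-rank P? x)) (≡.trans (≡.cong (proj₁ ∘ select P?) eq) (select-rank P? y))

^-cancelˡ-≤ : ∀ a b n .{{_ : ℕ.NonZero n}} → a ℕ.^ n ℕ.≤ b ℕ.^ n → a ℕ.≤ b
^-cancelˡ-≤ a b n a^n≤b^n with a ℕ.≤? b
... | yes a≤b = a≤b
... | no a≰b = contradiction a^n≤b^n (ℕ.<⇒≱ (ℕ.^-monoˡ-< n (ℕ.≰⇒> a≰b)))

funToFin-injective : ∀ {m n} {f g : Fin m → Fin n} → Fin.funToFin f ≡ Fin.funToFin g → ∀ i → f i ≡ g i
funToFin-injective {f = f} {g} eq i =
  ≡.trans (≡.sym (Fin.finToFun-funToFin f i)) (≡.trans (≡.cong (λ z → Fin.finToFun z i) eq) (Fin.finToFun-funToFin g i))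

funToFin-cong : ∀ {m n} {f g : Fin m → Fin n} → (∀ i → f i ≡ g i) → Fin.funToFin f ≡ Fin.funToFin g
funToFin-cong {zero} eq = ≡.refl
funToFin-cong {suc m} eq = ≡.cong₂ Fin.combine (eq Fin.zero) (funToFin-cong (eq ∘ Fin.suc))

finToFun-injective : ∀ {m n} {i j : Fin (m ℕ.^ n)} → (∀ k → Fin.finToFun {m} {n} i k ≡ Fin.finToFun j k) → i ≡ j
finToFun-injective {m} {n} {i} {j} eq =
  ≡.trans (≡.sym (Fin.funToFin-finToFin {n} {m} i)) (≡.trans (funToFin-cong eq) (Fin.funToFin-finToFin {n} {m} j))

-- The map `Φ` may mix the components of a tuple. In the application an n-tuple of solutions over K
-- is one solution over F, and only there is a map between the two solution sets available.
count-≤-by-powers : ∀ {p r m k} {P : Pred (Fin m) p} {R : Pred (Fin k) r} (P? : Decidable P) (R? : Decidable R) →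
  ∀ n .{{_ : ℕ.NonZero n}} (Φ : (Fin n → ∃ P) → (Fin n → ∃ R)) →
  (∀ {x y} → (∀ t → proj₁ (Φ x t) ≡ proj₁ (Φ y t)) → ∀ t → proj₁ (x t) ≡ proj₁ (y t)) →
  count P? ℕ.≤ count R?
count-≤-by-powers P? R? n Φ Φ-injective = ^-cancelˡ-≤ _ _ n (Fin.injective⇒≤ {f = Ψ} Ψ-injective)
  where
  Ψ : Fin (count P? ℕ.^ n) → Fin (count R? ℕ.^ n)
  Ψ i = Fin.funToFin (λ t → rank R? (Φ (λ s → select P? (Fin.finToFun i s)) t))

  Ψ-injective : ∀ {i j} → Ψ i ≡ Ψ j → i ≡ j
  Ψ-injective eq = finToFun-injective (λ t → select-injective P? (Φ-injective (λ s → rank-injective R? (funToFin-injective eq s)) t))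

-- Roots of monic polynomials.

module MonicPolynomials (F : FiniteField) where
  open FiniteField F
  open Field F
  open ≡.≡-Reasoning

  -- A vector lists the lower coefficients of a monic polynomial, constant term first; the leading 1
  -- is the value at `[]`. The degree is thus the length, and no vector encodes zero.
  eval : ∀ {m} → Vec Carrier m → Carrier → Carrier
  eval [] x = 1#
  eval (c ∷ cs) x = c + x * eval cs x

  -- Synthetic division by x - a: the coefficients of the quotient are the values at `a` of the
  -- successive tails.
  quotient : ∀ {m} → Carrier → Vec Carrier (suc m) → Vec Carrier m
  quotient a (c ∷ []) = []
  quotient a (c ∷ cs@(_ ∷ _)) = eval cs a ∷ quotient a cs

  add-sub : ∀ a x → a + (x + - a) ≡ x
  add-sub a x = ≡.trans (+-comm a (x + - a))
    (≡.trans (+-assoc x (- a) a) (≡.trans (≡.cong (x +_) (-‿inverseˡ a)) (+-identityʳ x)))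

  eval-quotient : ∀ {m} a (cs : Vec Carrier (suc m)) x →
    eval cs x ≡ eval cs a + (x + - a) * eval (quotient a cs) x
  eval-quotient a (c ∷ []) x = begin
    c + x * 1#                               ≡⟨ ≡.cong (λ z → c + z * 1#) (add-sub a x) ⟨
    c + (a + (x + - a)) * 1#                 ≡⟨ ≡.cong (c +_) (distribʳ 1# a (x + - a)) ⟩
    c + (a * 1# + (x + - a) * 1#)            ≡⟨ +-assoc c _ _ ⟨
    c + a * 1# + (x + - a) * 1#              ∎
  eval-quotient a (c ∷ cs@(_ ∷ _)) x = begin
    c + x * eval cs x                        ≡⟨ ≡.cong (λ z → c + x * z) (eval-quotient a cs x) ⟩
    c + x * (u + t * v)                      ≡⟨ ≡.cong (c +_) (distribˡ x u (t * v)) ⟩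
    c + (x * u + x * (t * v))                ≡⟨ ≡.cong₂ (λ y z → c + (y * u + z)) (≡.sym (add-sub a x)) (swap x t v) ⟩
    c + ((a + t) * u + t * (x * v))          ≡⟨ ≡.cong (λ z → c + (z + t * (x * v))) (distribʳ u a t) ⟩
    c + (a * u + t * u + t * (x * v))        ≡⟨ ≡.cong (c +_) (+-assoc (a * u) (t * u) _) ⟩
    c + (a * u + (t * u + t * (x * v)))      ≡⟨ ≡.cong (λ z → c + (a * u + z)) (distribˡ t u (x * v)) ⟨
    c + (a * u + t * (u + x * v))            ≡⟨ +-assoc c _ _ ⟨
    c + a * u + t * (u + x * v)              ∎
    where
    t = x + - a
    u = eval cs a
    v = eval (quotient a cs) x
    swap : ∀ x y z → x * (y * z) ≡ y * (x * z)
    swap x y z = ≡.trans (≡.sym (*-assoc x y z)) (≡.trans (≡.cong (_* z) (*-comm x y)) (*-assoc y x z))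

  #roots≤degree : ∀ {k m} (cs : Vec Carrier m) (roots : Fin k → Carrier) →
    (∀ {i j} → roots i ≡ roots j → i ≡ j) → (∀ i → eval cs (roots i) ≡ 0#) → k ℕ.≤ m
  #roots≤degree {zero} cs roots inj zeros = ℕ.z≤n
  #roots≤degree {suc k} [] roots inj zeros = contradiction (≡.sym (zeros Fin.zero)) 0≢1
  #roots≤degree {suc k} cs@(_ ∷ _) roots inj zeros =
    ℕ.s≤s (#roots≤degree (quotient a cs) (roots ∘ Fin.suc) (Fin.suc-injective ∘ inj) zeros′)
    where
    a = roots Fin.zero
    zeros′ : ∀ i → eval (quotient a cs) (roots (Fin.suc i)) ≡ 0#
    zeros′ i = *-zero-divisor (x + - a) (λ x-a≡0 → contradiction (inj (x∙y⁻¹≈ε⇒x≈y x a x-a≡0)) λ ()) (begin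
      (x + - a) * eval (quotient a cs) x                ≡⟨ +-identityˡ _ ⟨
      0# + (x + - a) * eval (quotient a cs) x
        ≡⟨ ≡.cong (_+ (x + - a) * eval (quotient a cs) x) (zeros Fin.zero) ⟨
      eval cs a + (x + - a) * eval (quotient a cs) x    ≡⟨ eval-quotient a cs x ⟨
      eval cs x                                         ≡⟨ zeros (Fin.suc i) ⟩
      0#                                                ∎)
      where x = roots (Fin.suc i)

  -- The fixed points are roots of x^q - x, which is monic of degree q once q ≥ 2; for `suc (suc m)`
  -- its lower coefficients are 0, -1 and then `m` zeros.
  #fixed-points≤exponent : ∀ q → 2 ℕ.≤ q → ∀ {k} (xs : Fin k → Carrier) →
    (∀ {i j} → xs i ≡ xs j → i ≡ j) → (∀ i → xs i ^ q ≡ xs i) → k ℕ.≤ q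
  #fixed-points≤exponent (suc (suc m)) _ xs inj fixed =
    #roots≤degree (0# ∷ - 1# ∷ replicate m 0#) xs inj λ i → let x = xs i in begin
      0# + x * (- 1# + x * eval (replicate m 0#) x)   ≡⟨ +-identityˡ _ ⟩
      x * (- 1# + x * eval (replicate m 0#) x)        ≡⟨ ≡.cong (λ z → x * (- 1# + x * z)) (eval-replicate m x) ⟩
      x * (- 1# + x * x ^ m)                          ≡⟨ distribˡ x (- 1#) (x * x ^ m) ⟩
      x * - 1# + x * (x * x ^ m)
        ≡⟨ ≡.cong₂ _+_ (≡.trans (≡.sym (-‿distribʳ-* x 1#)) (≡.cong -_ (*-identityʳ x))) (fixed i) ⟩
      - x + x                                         ≡⟨ -‿inverseˡ x ⟩
      0#                                              ∎
    where
    eval-replicate : ∀ m x → eval (replicate m 0#) x ≡ x ^ m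
    eval-replicate zero x = ≡.refl
    eval-replicate (suc m) x = ≡.trans (+-identityˡ _) (≡.cong (x *_) (eval-replicate m x))
  #fixed-points≤exponent (suc zero) (ℕ.s≤s ()) xs inj fixed

-- Matrices over a finite field.

module Matrices (F : FiniteField) where
  open FiniteField F
  open Field F
  open ≡.≡-Reasoning

  -- A record, so that the two matrices can be inferred from a proof of their equality.
  infix 4 _≃_
  record _≃_ {m : ℕ} (A B : Matrix F m) : Set where
    constructor entrywise
    field entry : ∀ i j → A i j ≡ B i j
  open _≃_ public

  infixl 7 _·_
  infixl 6 _⊕_
  _·_ _⊕_ : ∀ {m} → Matrix F m → Matrix F m → Matrix F m
  _·_ = _⊗_ F
  (A ⊕ B) i j = A i j + B i j

  O I : ∀ {m} → Matrix F m
  O i j = 0#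
  I = Id F

  ⊖_ : ∀ {m} → Matrix F m → Matrix F m
  (⊖ A) i j = - A i j

  scalar : ∀ {m} → Carrier → Matrix F m
  scalar c i j = c * I i j

  I-diagonal : ∀ {m} (i : Fin m) → I i i ≡ 1#
  I-diagonal i with i Fin.≟ i
  ... | yes _ = ≡.refl
  ... | no i≢i = contradiction ≡.refl i≢i

  I-off-diagonal : ∀ {m} {i j : Fin m} → i ≢ j → I i j ≡ 0#
  I-off-diagonal {i = i} {j} i≢j with i Fin.≟ j
  ... | yes i≡j = contradiction i≡j i≢j
  ... | no _ = ≡.refl

  ∑-I* : ∀ {m} (i : Fin m) (f : Fin m → Carrier) → ∑ (λ k → I i k * f k) ≡ f i
  ∑-I* i f = begin
    ∑ (λ k → I i k * f k)
      ≡⟨ ∑-single (λ k → I i k * f k) i (λ k k≢i → ≡.trans (≡.cong (_* f k) (I-off-diagonal (k≢i ∘ ≡.sym))) (zeroˡ _)) ⟩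
    I i i * f i             ≡⟨ ≡.cong (_* f i) (I-diagonal i) ⟩
    1# * f i                ≡⟨ *-identityˡ _ ⟩
    f i                     ∎

  ∑-*I : ∀ {m} (j : Fin m) (f : Fin m → Carrier) → ∑ (λ k → f k * I k j) ≡ f j
  ∑-*I j f = begin
    ∑ (λ k → f k * I k j)
      ≡⟨ ∑-single (λ k → f k * I k j) j (λ k k≢j → ≡.trans (≡.cong (f k *_) (I-off-diagonal k≢j)) (zeroʳ _)) ⟩
    f j * I j j             ≡⟨ ≡.cong (f j *_) (I-diagonal j) ⟩
    f j * 1#                ≡⟨ *-identityʳ _ ⟩
    f j                     ∎

  scalar-· : ∀ {m} c (A : Matrix F m) i j → (scalar c · A) i j ≡ c * A i j
  scalar-· c A i j = begin
    ∑ (λ k → c * I i k * A k j)     ≡⟨ ∑-cong (λ k → *-assoc c (I i k) (A k j)) ⟩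
    ∑ (λ k → c * (I i k * A k j))   ≡⟨ *-∑ c (λ k → I i k * A k j) ⟨
    c * ∑ (λ k → I i k * A k j)     ≡⟨ ≡.cong (c *_) (∑-I* i (λ k → A k j)) ⟩
    c * A i j                       ∎

  ·-scalar : ∀ {m} c (A : Matrix F m) i j → (A · scalar c) i j ≡ c * A i j
  ·-scalar c A i j = begin
    ∑ (λ k → A i k * (c * I k j))   ≡⟨ ∑-cong (λ k → ≡.trans (≡.sym (*-assoc (A i k) c (I k j)))
              (≡.trans (≡.cong (_* I k j) (*-comm (A i k) c)) (*-assoc c (A i k) (I k j)))) ⟩
    ∑ (λ k → c * (A i k * I k j))   ≡⟨ *-∑ c (λ k → A i k * I k j) ⟨
    c * ∑ (λ k → A i k * I k j)     ≡⟨ ≡.cong (c *_) (∑-*I j (A i)) ⟩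
    c * A i j                       ∎

  ·-assoc-entry : ∀ {m} (A B C : Matrix F m) i j → ((A · B) · C) i j ≡ (A · (B · C)) i j
  ·-assoc-entry A B C i j = begin
    ∑ (λ k → ∑ (λ l → A i l * B l k) * C k j)     ≡⟨ ∑-cong (λ k → ∑-* (λ l → A i l * B l k) (C k j)) ⟩
    ∑ (λ k → ∑ (λ l → A i l * B l k * C k j))     ≡⟨ ∑-swap (λ k l → A i l * B l k * C k j) ⟩
    ∑ (λ l → ∑ (λ k → A i l * B l k * C k j))     ≡⟨ ∑-cong (λ l → ∑-cong (λ k → *-assoc (A i l) (B l k) (C k j))) ⟩
    ∑ (λ l → ∑ (λ k → A i l * (B l k * C k j)))   ≡⟨ ∑-cong (λ l → *-∑ (A i l) (λ k → B l k * C k j)) ⟨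
    ∑ (λ l → A i l * ∑ (λ k → B l k * C k j))     ∎

  ≃-refl : ∀ {m} {A : Matrix F m} → A ≃ A
  ≃-refl = entrywise λ i j → ≡.refl

  matrixRing : ℕ → Ring 0ℓ 0ℓ
  matrixRing m = record
    { Carrier = Matrix F m
    ; _≈_ = _≃_
    ; _+_ = _⊕_
    ; _*_ = _·_
    ; -_ = ⊖_
    ; 0# = O
    ; 1# = I
    ; isRing = record
      { +-isAbelianGroup = record
        { isGroup = record
          { isMonoid = record
            { isSemigroup = record
              { isMagma = record
                { isEquivalence = record
                  { refl = ≃-refl
                  ; sym = λ A≃B → entrywise λ i j → ≡.sym (entry A≃B i j)
                  ; trans = λ A≃B B≃C → entrywise λ i j → ≡.trans (entry A≃B i j) (entry B≃C i j) }
                ; ∙-cong = λ A≃A′ B≃B′ → entrywise λ i j → ≡.cong₂ _+_ (entry A≃A′ i j) (entry B≃B′ i j) }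
              ; assoc = λ A B C → entrywise λ i j → +-assoc (A i j) (B i j) (C i j) }
            ; identity = (λ A → entrywise λ i j → +-identityˡ (A i j)) , (λ A → entrywise λ i j → +-identityʳ (A i j)) }
          ; inverse = (λ A → entrywise λ i j → -‿inverseˡ (A i j)) , (λ A → entrywise λ i j → -‿inverseʳ (A i j))
          ; ⁻¹-cong = λ A≃B → entrywise λ i j → ≡.cong -_ (entry A≃B i j) }
        ; comm = λ A B → entrywise λ i j → +-comm (A i j) (B i j) }
      ; *-cong = λ A≃A′ B≃B′ → entrywise λ i j → ∑-cong λ k → ≡.cong₂ _*_ (entry A≃A′ i k) (entry B≃B′ k j)
      ; *-assoc = λ A B C → entrywise (·-assoc-entry A B C)
      ; *-identity = (λ A → entrywise λ i j → ∑-I* i (λ k → A k j)) , (λ A → entrywise λ i j → ∑-*I j (A i))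
      ; distrib =
          (λ A B C → entrywise λ i j → ≡.trans (∑-cong (λ k → distribˡ (A i k) (B k j) (C k j)))
                                               (∑-+ (λ k → A i k * B k j) (λ k → A i k * C k j)))
        , (λ A B C → entrywise λ i j → ≡.trans (∑-cong (λ k → distribʳ (A k j) (B i k) (C i k)))
                                               (∑-+ (λ k → B i k * A k j) (λ k → C i k * A k j)))
      } }

  open module MatrixRing {m} = Ring (matrixRing m) public using () renaming
    ( *-assoc to ·-assoc; *-cong to ·-cong; *-congˡ to ·-congˡ; *-congʳ to ·-congʳ
    ; *-identityˡ to ·-identityˡ; *-identityʳ to ·-identityʳ; distribˡ to ·-distribˡ; distribʳ to ·-distribʳ
    ; zeroˡ to ·-zeroˡ; zeroʳ to ·-zeroʳ; +-cong to ⊕-cong; -‿cong to ⊖-cong; sym to ≃-sym; trans to ≃-trans; setoid to ≃-setoid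
    ; *-monoid to ·-monoid )

  matrixCode : ∀ {m} → Matrix F m → Fin ((size ℕ.^ m) ℕ.^ m)
  matrixCode A = Fin.funToFin λ i → Fin.funToFin λ j → index (A i j)

  decodeMatrix : ∀ {m} → Fin ((size ℕ.^ m) ℕ.^ m) → Matrix F m
  decodeMatrix {m} c i j = element (Fin.finToFun {size} {m} (Fin.finToFun {size ℕ.^ m} {m} c i) j)

  matrixCode-cong : ∀ {m} {A B : Matrix F m} → A ≃ B → matrixCode A ≡ matrixCode B
  matrixCode-cong A≃B = funToFin-cong λ i → funToFin-cong λ j → ≡.cong index (entry A≃B i j)

  matrixCode-injective : ∀ {m} {A B : Matrix F m} → matrixCode A ≡ matrixCode B → A ≃ B
  matrixCode-injective eq = entrywise λ i j → index-injective (funToFin-injective (funToFin-injective eq i) j)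

  decode-matrixCode : ∀ {m} (A : Matrix F m) → decodeMatrix (matrixCode A) ≃ A
  decode-matrixCode A = entrywise λ i j → ≡.trans
    (≡.cong (λ z → element (Fin.finToFun z j)) (Fin.finToFun-funToFin (λ i → Fin.funToFin λ j → index (A i j)) i))
    (≡.trans (≡.cong element (Fin.finToFun-funToFin (λ j → index (A i j)) j)) (element-index (A i j)))

  decodeMatrix-injective : ∀ {m} {a b : Fin ((size ℕ.^ m) ℕ.^ m)} → decodeMatrix {m} a ≃ decodeMatrix b → a ≡ b
  decodeMatrix-injective {m} eq = finToFun-injective {size ℕ.^ m} {m} λ i → finToFun-injective {size} {m} λ j →
    ≡.trans (≡.sym (index-element _)) (≡.trans (≡.cong index (entry eq i j)) (index-element _))

  _≃?_ : ∀ {m} (A B : Matrix F m) → Dec (A ≃ B)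
  A ≃? B = map′ entrywise entry (Fin.all? λ i → Fin.all? λ j → A i j ≟ B i j)

  -- All matrices can be searched through by their codes. This discharges the double negation left
  -- by the cohomological argument.
  ∃-matrix-stable : ∀ {p m} {P : Pred (Matrix F m) p} → Decidable P → (∀ {A B} → A ≃ B → P A → P B) →
    ¬ ¬ ∃ P → ∃ P
  ∃-matrix-stable P? P-resp ¬¬∃P with Fin.any? (P? ∘ decodeMatrix)
  ... | yes (i , p) = decodeMatrix i , p
  ... | no ¬∃ = contradiction (λ { (A , p) → ¬∃ (matrixCode A , P-resp (≃-sym (decode-matrixCode A)) p) }) ¬¬∃P

  -- Left multiplication by `B` is injective because `A` undoes it; by finiteness it attains `I`,
  -- and the right inverse of `B` so found must equal `A`.
  right-inverse⇒left-inverse : ∀ {m} (A B : Matrix F m) → A · B ≃ I → B · A ≃ I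
  right-inverse⇒left-inverse A B AB≃I =
    let C , BC≃I = injective⇒surjective (B ·_) B·-injective I
        A≃C : A ≃ C
        A≃C = ≃-trans (≃-sym (·-identityʳ A)) (≃-trans (·-congˡ (≃-sym BC≃I))
          (≃-trans (≃-sym (·-assoc A B C)) (≃-trans (·-congʳ AB≃I) (·-identityˡ C))))
    in ≃-trans (·-congˡ A≃C) BC≃I
    where
    open FinitelyCoded ≃-setoid matrixCode matrixCode-injective
    B·-injective : ∀ {X Y} → B · X ≃ B · Y → X ≃ Y
    B·-injective {X} {Y} eq = ≃-trans (≃-sym (cancel X)) (≃-trans (·-congˡ eq) (cancel Y))
      where
      cancel : ∀ X → A · (B · X) ≃ X
      cancel X = ≃-trans (≃-sym (·-assoc A B X)) (≃-trans (·-congʳ AB≃I) (·-identityˡ X))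

  fromIsInverse : ∀ {m} {A B : Matrix F m} → IsInverse F A B → A · B ≃ I × B · A ≃ I
  fromIsInverse (AB , BA) = entrywise AB , entrywise BA

  toIsInverse : ∀ {m} {A B : Matrix F m} → A · B ≃ I → B · A ≃ I → IsInverse F A B
  toIsInverse AB BA = entry AB , entry BA

-- The subfield K, conjugate transposes and coordinates.

module QuadraticSubfield (F : FiniteField) (q n : ℕ) .{{_ : ℕ.NonZero n}}
  (q-prime-power : IsPrimePower q) (size≡q^2n : FiniteField.size F ≡ q ℕ.^ (2 ℕ.* n)) where
  open FiniteField F
  open Field F
  open Matrices F
  open ≡.≡-Reasoning

  φ : ℕ → Carrier → Carrier
  φ m x = x ^ (q ℕ.^ m)

  φ-+ : ∀ m x y → φ m (x + y) ≡ φ m x + φ m y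
  φ-+ m = prime-power-frobenius-+ q-prime-power (2 ℕ.* n) m size≡q^2n

  φ-* : ∀ m x y → φ m (x * y) ≡ φ m x * φ m y
  φ-* m x y = ^-distrib x y (q ℕ.^ m)

  φ-1 : ∀ m → φ m 1# ≡ 1#
  φ-1 m = 1^ (q ℕ.^ m)

  φ-0 : ∀ m → φ m 0# ≡ 0#
  φ-0 m = +-identityˡ-unique _ _ (≡.trans (≡.sym (φ-+ m 0# 0#)) (≡.cong (φ m) (+-identityˡ 0#)))

  φ-neg : ∀ m x → φ m (- x) ≡ - φ m x
  φ-neg m x = +-inverseʳ-unique _ _ (≡.trans (≡.sym (φ-+ m x (- x))) (≡.trans (≡.cong (φ m) (-‿inverseʳ x)) (φ-0 m)))

  φ-∑ : ∀ m {k} (f : Fin k → Carrier) → φ m (∑ f) ≡ ∑ (λ i → φ m (f i))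
  φ-∑ m {zero} f = φ-0 m
  φ-∑ m {suc k} f = ≡.trans (φ-+ m (f Fin.zero) _) (≡.cong (φ m (f Fin.zero) +_) (φ-∑ m (f ∘ Fin.suc)))

  φ-φ : ∀ m k x → φ m (φ k x) ≡ φ (k ℕ.+ m) x
  φ-φ m k x = ≡.trans (^-^ x (q ℕ.^ k) (q ℕ.^ m)) (≡.cong (x ^_) (≡.sym (ℕ.^-distribˡ-+-* q k m)))

  φ-swap : ∀ m k x → φ m (φ k x) ≡ φ k (φ m x)
  φ-swap m k x = ≡.trans (φ-φ m k x) (≡.trans (≡.cong (λ z → φ z x) (ℕ.+-comm k m)) (≡.sym (φ-φ k m x)))

  φ-2n : ∀ x → φ (2 ℕ.* n) x ≡ x
  φ-2n x = ≡.trans (≡.cong (x ^_) (≡.sym size≡q^2n)) (fermat x)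

  bar : Carrier → Carrier
  bar x = x ^ q

  bar≡φ1 : ∀ x → bar x ≡ φ 1 x
  bar≡φ1 x = ≡.cong (x ^_) (≡.sym (ℕ.*-identityʳ q))

  bar-+ : ∀ x y → bar (x + y) ≡ bar x + bar y
  bar-+ x y rewrite bar≡φ1 (x + y) | bar≡φ1 x | bar≡φ1 y = φ-+ 1 x y

  bar-* : ∀ x y → bar (x * y) ≡ bar x * bar y
  bar-* x y = ^-distrib x y q

  bar-1 : bar 1# ≡ 1#
  bar-1 = 1^ q

  bar-0 : bar 0# ≡ 0#
  bar-0 = ≡.trans (bar≡φ1 0#) (φ-0 1)

  bar-∑ : ∀ {k} (f : Fin k → Carrier) → bar (∑ f) ≡ ∑ (λ i → bar (f i))
  bar-∑ f = ≡.trans (bar≡φ1 (∑ f)) (≡.trans (φ-∑ 1 f) (∑-cong (λ i → ≡.sym (bar≡φ1 (f i)))))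

  bar-φ : ∀ m x → bar (φ m x) ≡ φ m (bar x)
  bar-φ m x = ≡.trans (bar≡φ1 _) (≡.trans (φ-swap 1 m x) (≡.cong (φ m) (≡.sym (bar≡φ1 x))))

  bar-bar : ∀ x → bar (bar x) ≡ φ 2 x
  bar-bar x = ≡.trans (bar≡φ1 _) (≡.trans (≡.cong (φ 1) (bar≡φ1 x)) (φ-φ 1 1 x))

  K : Carrier → Set
  K = InSub F q

  K-+ : ∀ {x y} → K x → K y → K (x + y)
  K-+ {x} {y} kx ky = ≡.trans (φ-+ 2 x y) (≡.cong₂ _+_ kx ky)

  K-* : ∀ {x y} → K x → K y → K (x * y)
  K-* {x} {y} kx ky = ≡.trans (φ-* 2 x y) (≡.cong₂ _*_ kx ky)

  K-neg : ∀ {x} → K x → K (- x)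
  K-neg {x} kx = ≡.trans (φ-neg 2 x) (≡.cong -_ kx)

  K-∑ : ∀ {k} {f : Fin k → Carrier} → (∀ i → K (f i)) → K (∑ f)
  K-∑ {f = f} kf = ≡.trans (φ-∑ 2 f) (∑-cong kf)

  K-bar : ∀ {x} → K x → K (bar x)
  K-bar {x} kx = ≡.trans (≡.sym (bar-φ 2 x)) (≡.cong bar kx)

  K-1 : K 1#
  K-1 = φ-1 2

  K-0 : K 0#
  K-0 = φ-0 2

  K? : ∀ x → Dec (K x)
  K? x = (x ^ (q ℕ.^ 2)) ≟ x

  K-φ : ∀ {x} → K x → ∀ i → φ (2 ℕ.* i) x ≡ x
  K-φ {x} kx zero = *-identityʳ x
  K-φ {x} kx (suc i) = begin
    φ (2 ℕ.* suc i) x        ≡⟨ ≡.cong (λ m → φ m x) (ℕ.*-suc 2 i) ⟩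
    φ (2 ℕ.+ 2 ℕ.* i) x      ≡⟨ φ-φ (2 ℕ.* i) 2 x ⟨
    φ (2 ℕ.* i) (φ 2 x)      ≡⟨ ≡.cong (φ (2 ℕ.* i)) kx ⟩
    φ (2 ℕ.* i) x            ≡⟨ K-φ kx i ⟩
    x                        ∎

  2≤q : 2 ℕ.≤ q
  2≤q = prime-power≥2 q-prime-power

  KMatrix : ∀ {m} → Matrix F m → Set
  KMatrix A = ∀ i j → K (A i j)

  KMatrix? : ∀ {m} (A : Matrix F m) → Dec (KMatrix A)
  KMatrix? A = Fin.all? λ i → Fin.all? λ j → K? (A i j)

  KMatrix-resp : ∀ {m} {A B : Matrix F m} → A ≃ B → KMatrix A → KMatrix B
  KMatrix-resp A≃B kA i j = ≡.subst K (entry A≃B i j) (kA i j)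

  KMatrix-· : ∀ {m} {A B : Matrix F m} → KMatrix A → KMatrix B → KMatrix (A · B)
  KMatrix-· kA kB i j = K-∑ λ k → K-* (kA i k) (kB k j)

  KMatrix-⊕ : ∀ {m} {A B : Matrix F m} → KMatrix A → KMatrix B → KMatrix (A ⊕ B)
  KMatrix-⊕ kA kB i j = K-+ (kA i j) (kB i j)

  KMatrix-I : ∀ {m} → KMatrix {m} I
  KMatrix-I i j with i Fin.≟ j
  ... | yes _ = K-1
  ... | no _ = K-0

  infix 8 _*ᵗ
  _*ᵗ : ∀ {m} → Matrix F m → Matrix F m
  _*ᵗ = star F q

  KMatrix-*ᵗ : ∀ {m} {A : Matrix F m} → KMatrix A → KMatrix (A *ᵗ)
  KMatrix-*ᵗ kA i j = K-bar (kA j i)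

  *ᵗ-cong : ∀ {m} {A B : Matrix F m} → A ≃ B → A *ᵗ ≃ B *ᵗ
  *ᵗ-cong A≃B = entrywise λ i j → ≡.cong bar (entry A≃B j i)

  *ᵗ-⊕ : ∀ {m} (A B : Matrix F m) → (A ⊕ B) *ᵗ ≃ A *ᵗ ⊕ B *ᵗ
  *ᵗ-⊕ A B = entrywise λ i j → bar-+ (A j i) (B j i)

  *ᵗ-· : ∀ {m} (A B : Matrix F m) → (A · B) *ᵗ ≃ B *ᵗ · A *ᵗ
  *ᵗ-· A B = entrywise λ i j → ≡.trans (bar-∑ (λ k → A j k * B k i))
    (∑-cong λ k → ≡.trans (bar-* (A j k) (B k i)) (*-comm _ _))

  *ᵗ-scalar : ∀ {m} c → scalar {m} c *ᵗ ≃ scalar (bar c)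
  *ᵗ-scalar c = entrywise λ i j → ≡.trans (bar-* c (I j i)) (≡.cong (bar c *_) (bar-I i j))
    where
    bar-I : ∀ {m} (i j : Fin m) → bar (I j i) ≡ I i j
    bar-I i j with j Fin.≟ i | i Fin.≟ j
    ... | yes _ | yes _ = bar-1
    ... | no _ | no _ = bar-0
    ... | yes j≡i | no i≢j = contradiction (≡.sym j≡i) i≢j
    ... | no j≢i | yes i≡j = contradiction (≡.sym i≡j) j≢i

  *ᵗ-I : ∀ {m} → I {m} *ᵗ ≃ I
  *ᵗ-I = ≃-trans (*ᵗ-cong (entrywise λ i j → ≡.sym (*-identityˡ (I i j))))
        (≃-trans (*ᵗ-scalar 1#) (entrywise λ i j → ≡.trans (≡.cong (_* I i j) bar-1) (*-identityˡ (I i j))))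

  -- Two conjugate transpositions raise each entry to the power q², which fixes exactly the entries
  -- in K.
  *ᵗ-involutive : ∀ {m} {A : Matrix F m} → KMatrix A → (A *ᵗ) *ᵗ ≃ A
  *ᵗ-involutive {A = A} kA = entrywise λ i j → ≡.trans (bar-bar (A i j)) (kA i j)

  -- Raising the entries of `B` to the power q² gives another right inverse of `A`, and inverses are
  -- unique.
  KMatrix-inverse : ∀ {m} {A B : Matrix F m} → A · B ≃ I → B · A ≃ I → KMatrix A → KMatrix B
  KMatrix-inverse {A = A} {B} AB≃I BA≃I kA i j = entry Bφ≃B i j
    where
    Bφ : Matrix F _
    Bφ i j = φ 2 (B i j)
    ABφ≃I : A · Bφ ≃ I
    ABφ≃I = entrywise λ i j → begin
      ∑ (λ k → A i k * φ 2 (B k j))         ≡⟨ ∑-cong (λ k → ≡.cong (_* φ 2 (B k j)) (kA i k)) ⟨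
      ∑ (λ k → φ 2 (A i k) * φ 2 (B k j))   ≡⟨ ∑-cong (λ k → φ-* 2 (A i k) (B k j)) ⟨
      ∑ (λ k → φ 2 (A i k * B k j))         ≡⟨ φ-∑ 2 (λ k → A i k * B k j) ⟨
      φ 2 (∑ (λ k → A i k * B k j))         ≡⟨ ≡.cong (φ 2) (entry AB≃I i j) ⟩
      φ 2 (I i j)                           ≡⟨ KMatrix-I i j ⟩
      I i j                                 ∎
    Bφ≃B : Bφ ≃ B
    Bφ≃B = ≃-trans (≃-sym (·-identityˡ Bφ)) (≃-trans (·-congʳ (≃-sym BA≃I)) (≃-trans (·-assoc B A Bφ)
             (≃-trans (·-congˡ ABφ≃I) (·-identityʳ B))))

  module Coordinates (β : Fin n → Carrier) (β-basis : IsBasis F q n β) where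

    coordinate : Carrier → Fin n → Carrier
    coordinate x = proj₁ (proj₁ β-basis x)

    coordinate-K : ∀ x t → K (coordinate x t)
    coordinate-K x = proj₁ (proj₂ (proj₁ β-basis x))

    expansion : ∀ x → ∑ (λ t → coordinate x t * β t) ≡ x
    expansion x = ≡.sym (proj₂ (proj₂ (proj₁ β-basis x)))

    independence : ∀ {c d : Fin n → Carrier} → (∀ t → K (c t)) → (∀ t → K (d t)) →
      ∑ (λ t → c t * β t) ≡ ∑ (λ t → d t * β t) → ∀ t → c t ≡ d t
    independence {c} {d} kc kd eq t = x∙y⁻¹≈ε⇒x≈y (c t) (d t)
      (proj₂ β-basis (λ t → c t + - d t) (λ t → K-+ (kc t) (K-neg (kd t))) (begin
        ∑ (λ t → (c t + - d t) * β t)                          ≡⟨ ∑-cong (λ t → distribʳ (β t) (c t) (- d t)) ⟩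
        ∑ (λ t → c t * β t + - d t * β t)                      ≡⟨ ∑-+ (λ t → c t * β t) (λ t → - d t * β t) ⟩
        ∑ (λ t → c t * β t) + ∑ (λ t → - d t * β t)            ≡⟨ ≡.cong (_+ ∑ (λ t → - d t * β t)) eq ⟩
        ∑ (λ t → d t * β t) + ∑ (λ t → - d t * β t)            ≡⟨ ∑-+ (λ t → d t * β t) (λ t → - d t * β t) ⟨
        ∑ (λ t → d t * β t + - d t * β t)
          ≡⟨ ∑-0 _ (λ t → ≡.trans (≡.sym (distribʳ (β t) (d t) (- d t)))
              (≡.trans (≡.cong (_* β t) (-‿inverseʳ (d t))) (zeroˡ (β t)))) ⟩
        0#                                                     ∎) t)

    coordinate-unique : ∀ {x} {c : Fin n → Carrier} → (∀ t → K (c t)) → x ≡ ∑ (λ t → c t * β t) → ∀ t → coordinate x t ≡ c t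
    coordinate-unique {x} kc eq = independence (coordinate-K x) kc (≡.trans (expansion x) eq)

    -- F has q^2n elements, so K has at least q^2 > q, while x^q = x has at most q solutions.
    non-real : ∃ λ d → K d × bar d ≢ d
    non-real with Fin.any? (λ i → K? (element i) ×-dec ¬? (bar (element i) ≟ element i))
    ... | yes (i , kd , d̄≢d) = element i , kd , d̄≢d
    ... | no none = contradiction (ℕ.≤-trans q²≤#K #K≤q) (ℕ.<⇒≱ (≡.subst (q ℕ.<_) (≡.cong (q ℕ.*_) (≡.sym (ℕ.*-identityʳ q)))
                      (ℕ.m<m*n q q {{ℕ.>-nonZero (ℕ.<⇒≤ 2≤q)}} 2≤q)))
      where
      K∘element? : Decidable (K ∘ element)
      K∘element? i = K? (element i)

      #K = count K∘element?

      real : ∀ {x} → K x → bar x ≡ x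
      real {x} kx with bar x ≟ x
      ... | yes eq = eq
      ... | no x̄≢x = contradiction
        (index x , ≡.subst K (≡.sym (element-index x)) kx , λ eq → x̄≢x (≡.subst (λ z → bar z ≡ z) (element-index x) eq)) none

      #K≤q : #K ℕ.≤ q
      #K≤q = MonicPolynomials.#fixed-points≤exponent F q 2≤q (element ∘ proj₁ ∘ select K∘element?)
        (λ eq → select-injective K∘element? (≡.trans (≡.sym (index-element _)) (≡.trans (≡.cong index eq) (index-element _))))
        (λ i → real (proj₂ (select K∘element? i)))

      ranks : Carrier → Fin n → Fin #K
      ranks x t = rank K∘element? (index (coordinate x t) , ≡.subst K (≡.sym (element-index _)) (coordinate-K x t))

      ranks-injective : ∀ {x y} → (∀ t → ranks x t ≡ ranks y t) → x ≡ y
      ranks-injective {x} {y} eq = begin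
        x                                      ≡⟨ expansion x ⟨
        ∑ (λ t → coordinate x t * β t)
          ≡⟨ ∑-cong (λ t → ≡.cong (_* β t) (index-injective (rank-injective K∘element? (eq t)))) ⟩
        ∑ (λ t → coordinate y t * β t)         ≡⟨ expansion y ⟩
        y                                      ∎

      -- Coordinates embed F into the n-tuples over K, and n-th roots are taken in q^(2n) ≤ #K^n.
      q²≤#K : q ℕ.^ 2 ℕ.≤ #K
      q²≤#K = ^-cancelˡ-≤ (q ℕ.^ 2) #K n (≡.subst (ℕ._≤ #K ℕ.^ n) (≡.trans size≡q^2n (≡.sym (ℕ.^-*-assoc q 2 n)))
        (Fin.injective⇒≤ {f = λ i → Fin.funToFin (ranks (element i))}
          (λ eq → ≡.trans (≡.sym (index-element _)) (≡.trans (≡.cong index (ranks-injective (funToFin-injective eq))) (index-element _)))))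

-- Descent of conjugacy to the subfield.

count-cong : ∀ {p r m} {P : Pred (Fin m) p} {R : Pred (Fin m) r} (P? : Decidable P) (R? : Decidable R) →
  (∀ {i} → P i → R i) → (∀ {i} → R i → P i) → count P? ≡ count R?
count-cong {m = zero} P? R? to from = ≡.refl
count-cong {m = suc m} P? R? to from with P? Fin.zero | R? Fin.zero
... | yes _ | yes _ = ≡.cong suc (count-cong (P? ∘ Fin.suc) (R? ∘ Fin.suc) to from)
... | no _ | no _ = count-cong (P? ∘ Fin.suc) (R? ∘ Fin.suc) to from
... | yes p | no ¬r = contradiction (to p) ¬r
... | no ¬p | yes r = contradiction (from r) ¬p

-- Suppose A and B over K are conjugate over F, and let S and S′ be the spaces of
-- K-matrices X with X A = A X, respectively X A = B X. For any U, the numbers of X in S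
-- and in S′ with X U = 0 agree, because their n-th powers count the solutions over F.
-- By inclusion-exclusion as many X in S as in S′ are injective.
module Descent (F : FiniteField) (q n : ℕ) .{{_ : ℕ.NonZero n}}
  (q-prime-power : IsPrimePower q) (size≡q^2n : FiniteField.size F ≡ q ℕ.^ (2 ℕ.* n))
  (β : Fin n → FiniteField.Carrier F) (β-basis : IsBasis F q n β) where
  open FiniteField F
  open Field F
  open Matrices F
  open QuadraticSubfield F q n q-prime-power size≡q^2n
  open Coordinates β β-basis

  -- An F-matrix amounts to an n-tuple of K-matrices, its coordinates along `β`. A homogeneous
  -- linear system with coefficients in K holds for the F-matrix exactly when it holds for every
  -- coordinate.
  combine : ∀ {m} → (Fin n → Matrix F m) → Matrix F m
  combine X i j = ∑ λ t → X t i j * β t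

  coordinates : ∀ {m} → Matrix F m → Fin n → Matrix F m
  coordinates W t i j = coordinate (W i j) t

  coordinates-K : ∀ {m} (W : Matrix F m) t → KMatrix (coordinates W t)
  coordinates-K W t i j = coordinate-K (W i j) t

  combine-coordinates : ∀ {m} (W : Matrix F m) → combine (coordinates W) ≃ W
  combine-coordinates W = entrywise λ i j → expansion (W i j)

  combine-cong : ∀ {m} {X Y : Fin n → Matrix F m} → (∀ t → X t ≃ Y t) → combine X ≃ combine Y
  combine-cong X≃Y = entrywise λ i j → ∑-cong λ t → ≡.cong (_* β t) (entry (X≃Y t) i j)

  combine-injective : ∀ {m} {X Y : Fin n → Matrix F m} → (∀ t → KMatrix (X t)) → (∀ t → KMatrix (Y t)) →
    combine X ≃ combine Y → ∀ t → X t ≃ Y t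
  combine-injective kX kY eq t = entrywise λ i j →
    independence (λ t → kX t i j) (λ t → kY t i j) (entry eq i j) t

  combine-O : ∀ {m} → combine {m} (λ _ → O) ≃ O
  combine-O = entrywise λ i j → ∑-0 (λ t → 0# * β t) (λ t → zeroˡ (β t))

  combine-· : ∀ {m} (X : Fin n → Matrix F m) A → combine X · A ≃ combine (λ t → X t · A)
  combine-· X A = entrywise λ i j → begin
    ∑ (λ k → ∑ (λ t → X t i k * β t) * A k j)     ≡⟨ ∑-cong (λ k → ∑-* (λ t → X t i k * β t) (A k j)) ⟩
    ∑ (λ k → ∑ (λ t → X t i k * β t * A k j))     ≡⟨ ∑-swap (λ k t → X t i k * β t * A k j) ⟩
    ∑ (λ t → ∑ (λ k → X t i k * β t * A k j))     ≡⟨ ∑-cong (λ t → ∑-cong (λ k → ≡.trans (*-assoc _ _ _)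
              (≡.trans (≡.cong (X t i k *_) (*-comm _ _)) (≡.sym (*-assoc _ _ _))))) ⟩
    ∑ (λ t → ∑ (λ k → X t i k * A k j * β t))     ≡⟨ ∑-cong (λ t → ∑-* (λ k → X t i k * A k j) (β t)) ⟨
    ∑ (λ t → ∑ (λ k → X t i k * A k j) * β t)     ∎
    where open ≡.≡-Reasoning

  ·-combine : ∀ {m} A (X : Fin n → Matrix F m) → A · combine X ≃ combine (λ t → A · X t)
  ·-combine A X = entrywise λ i j → begin
    ∑ (λ k → A i k * ∑ (λ t → X t k j * β t))     ≡⟨ ∑-cong (λ k → *-∑ (A i k) (λ t → X t k j * β t)) ⟩
    ∑ (λ k → ∑ (λ t → A i k * (X t k j * β t)))   ≡⟨ ∑-swap (λ k t → A i k * (X t k j * β t)) ⟩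
    ∑ (λ t → ∑ (λ k → A i k * (X t k j * β t)))   ≡⟨ ∑-cong (λ t → ∑-cong (λ k → *-assoc (A i k) (X t k j) (β t))) ⟨
    ∑ (λ t → ∑ (λ k → A i k * X t k j * β t))     ≡⟨ ∑-cong (λ t → ∑-* (λ k → A i k * X t k j) (β t)) ⟨
    ∑ (λ t → ∑ (λ k → A i k * X t k j) * β t)     ∎
    where open ≡.≡-Reasoning

  -- Square matrices `v` stand in for vectors, so that everything happens in one ring: a K-matrix is
  -- invertible over K as soon as it annihilates no nonzero K-matrix.
  Annihilates : ∀ {m} → Matrix F m → Pred (Matrix F m) _
  Annihilates X v = X · v ≃ O

  Intertwiner : ∀ {m} (A B : Matrix F m) (U : List (Matrix F m)) → Pred (Matrix F m) _
  Intertwiner A B U X = KMatrix X × X · A ≃ B · X × All (Annihilates X) U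

  Intertwiner-resp : ∀ {m} {A B : Matrix F m} {U X Y} → X ≃ Y → Intertwiner A B U X → Intertwiner A B U Y
  Intertwiner-resp X≃Y (kX , XA≃BX , XU≃0) =
    KMatrix-resp X≃Y kX ,
    ≃-trans (·-congʳ (≃-sym X≃Y)) (≃-trans XA≃BX (·-congˡ X≃Y)) ,
    All.map (≃-trans (·-congʳ (≃-sym X≃Y))) XU≃0

  Intertwiner? : ∀ {m} (A B : Matrix F m) U → Decidable (Intertwiner A B U)
  Intertwiner? A B U X = KMatrix? X ×-dec ((X · A) ≃? (B · X)) ×-dec All.all? (λ u → (X · u) ≃? O) U

  module _ {m : ℕ} (A B B′ : Matrix F m)
    (kA : KMatrix A) (kB′ : KMatrix B′) (U : List (Matrix F m)) (kU : All KMatrix U)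
    (G H : Matrix F m) (HG≃I : H · G ≃ I) (GB≃B′G : G · B ≃ B′ · G) where
    open Relation.Binary.Reasoning.Setoid (≃-setoid {m})

    private
      -- A tuple of solutions over K is assembled into one over F and multiplied by `G`; its
      -- coordinates are again solutions over K. As `G` has entries in F, it mixes the members of
      -- the tuple.
      transported : (Fin n → ∃ (Intertwiner A B U ∘ decodeMatrix)) → Matrix F m
      transported X = G · combine (λ t → decodeMatrix (proj₁ (X t)))

      transported-intertwines : ∀ X t → Intertwiner A B′ U (coordinates (transported X) t)
      transported-intertwines X t = kY t , combine-injective (λ t → KMatrix-· (kY t) kA) (λ t → KMatrix-· kB′ (kY t)) YA≃B′Y t ,
        annihilates U kU (λ t → proj₂ (proj₂ (proj₂ (X t))))
        where
        X′ = λ t → decodeMatrix (proj₁ (X t))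
        W = transported X
        Y = coordinates W
        kY = coordinates-K W

        YA≃B′Y : combine (λ t → Y t · A) ≃ combine (λ t → B′ · Y t)
        YA≃B′Y = begin
          combine (λ t → Y t · A)            ≈⟨ combine-· Y A ⟨
          combine Y · A                      ≈⟨ ·-congʳ (combine-coordinates W) ⟩
          G · combine X′ · A                 ≈⟨ ·-assoc G (combine X′) A ⟩
          G · (combine X′ · A)               ≈⟨ ·-congˡ (combine-· X′ A) ⟩
          G · combine (λ t → X′ t · A)       ≈⟨ ·-congˡ (combine-cong (λ t → proj₁ (proj₂ (proj₂ (X t))))) ⟩
          G · combine (λ t → B · X′ t)       ≈⟨ ·-congˡ (·-combine B X′) ⟨
          G · (B · combine X′)               ≈⟨ ·-assoc G B (combine X′) ⟨
          G · B · combine X′                 ≈⟨ ·-congʳ GB≃B′G ⟩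
          B′ · G · combine X′                ≈⟨ ·-assoc B′ G (combine X′) ⟩
          B′ · W                             ≈⟨ ·-congˡ (combine-coordinates W) ⟨
          B′ · combine Y                     ≈⟨ ·-combine B′ Y ⟩
          combine (λ t → B′ · Y t)           ∎

        annihilates : ∀ U → All KMatrix U → (∀ t → All (Annihilates (X′ t)) U) → All (Annihilates (Y t)) U
        annihilates [] _ _ = []
        annihilates (u ∷ U) (ku ∷ kU) XU≃0 =
          combine-injective (λ t → KMatrix-· (kY t) ku) (λ _ _ _ → K-0) (begin
            combine (λ t → Y t · u)          ≈⟨ combine-· Y u ⟨
            combine Y · u                    ≈⟨ ·-congʳ (combine-coordinates W) ⟩
            G · combine X′ · u               ≈⟨ ·-assoc G (combine X′) u ⟩
            G · (combine X′ · u)             ≈⟨ ·-congˡ (combine-· X′ u) ⟩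
            G · combine (λ t → X′ t · u)     ≈⟨ ·-congˡ (combine-cong (λ t → All.head (XU≃0 t))) ⟩
            G · combine (λ _ → O)            ≈⟨ ·-congˡ combine-O ⟩
            G · O                            ≈⟨ ·-zeroʳ G ⟩
            O                                ≈⟨ combine-O ⟨
            combine (λ _ → O)                ∎) t
          ∷ annihilates U kU (λ t → All.tail (XU≃0 t))

    #intertwiners-≤ : count (Intertwiner? A B U ∘ decodeMatrix) ℕ.≤ count (Intertwiner? A B′ U ∘ decodeMatrix)
    #intertwiners-≤ = count-≤-by-powers (Intertwiner? A B U ∘ decodeMatrix) (Intertwiner? A B′ U ∘ decodeMatrix) n
      (λ X t → matrixCode (coordinates (transported X) t) ,
               Intertwiner-resp (≃-sym (decode-matrixCode _)) (transported-intertwines X t))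
      (λ {X} {Y} eq t → decodeMatrix-injective
        (combine-injective (λ t → proj₁ (proj₂ (X t))) (λ t → proj₁ (proj₂ (Y t)))
          (begin
            combine (λ t → decodeMatrix (proj₁ (X t)))         ≈⟨ cancel _ ⟨
            H · transported X                                  ≈⟨ ·-congˡ (combine-coordinates _) ⟨
            H · combine (coordinates (transported X))
              ≈⟨ ·-congˡ (combine-cong (λ t → matrixCode-injective (eq t))) ⟩
            H · combine (coordinates (transported Y))          ≈⟨ ·-congˡ (combine-coordinates _) ⟩
            H · transported Y                                  ≈⟨ cancel _ ⟩
            combine (λ t → decodeMatrix (proj₁ (Y t)))         ∎) t))
      where
      cancel : ∀ Z → H · (G · Z) ≃ Z
      cancel Z = ≃-trans (≃-sym (·-assoc H G Z)) (≃-trans (·-congʳ HG≃I) (·-identityˡ Z))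

  -- `U` collects what must be killed and `N` what must survive; the induction moves members of `N`
  -- to `U` until only linear conditions remain.
  InjectiveOn : ∀ {m} → Matrix F m → Matrix F m → List (Matrix F m) → List (Matrix F m) → Pred (Matrix F m) _
  InjectiveOn A B U [] X = Intertwiner A B U X
  InjectiveOn A B U (v ∷ N) X = InjectiveOn A B U N X × ¬ Annihilates X v

  InjectiveOn? : ∀ {m} (A B : Matrix F m) U N → Decidable (InjectiveOn A B U N)
  InjectiveOn? A B U [] X = Intertwiner? A B U X
  InjectiveOn? A B U (v ∷ N) X = InjectiveOn? A B U N X ×-dec ¬? ((X · v) ≃? O)

  module _ {m : ℕ} {A B : Matrix F m} where
    to-constraint : ∀ {U} v N {X} → InjectiveOn A B U N X × Annihilates X v → InjectiveOn A B (v ∷ U) N X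
    to-constraint v [] ((kX , XA , XU) , Xv) = kX , XA , Xv ∷ XU
    to-constraint v (w ∷ N) ((inj , Xw) , Xv) = to-constraint v N (inj , Xv) , Xw

    from-constraint : ∀ {U} v N {X} → InjectiveOn A B (v ∷ U) N X → InjectiveOn A B U N X × Annihilates X v
    from-constraint v [] (kX , XA , Xv ∷ XU) = (kX , XA , XU) , Xv
    from-constraint v (w ∷ N) (inj , Xw) = let inj′ , Xv = from-constraint v N inj in (inj′ , Xw) , Xv

    InjectiveOn⇒Intertwiner : ∀ {U} N {X} → InjectiveOn A B U N X → Intertwiner A B U X
    InjectiveOn⇒Intertwiner [] X-int = X-int
    InjectiveOn⇒Intertwiner (v ∷ N) (inj , _) = InjectiveOn⇒Intertwiner N inj

    InjectiveOn⇒¬Annihilates : ∀ {U} N {X v} → InjectiveOn A B U N X → v ∈ N → ¬ Annihilates X v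
    InjectiveOn⇒¬Annihilates (v ∷ N) (_ , ¬Xv) (here ≡.refl) = ¬Xv
    InjectiveOn⇒¬Annihilates (v ∷ N) (inj , _) (there v∈N) = InjectiveOn⇒¬Annihilates N inj v∈N

    intro-InjectiveOn : ∀ {U} N {X} → Intertwiner A B U X → (∀ {v} → v ∈ N → ¬ Annihilates X v) → InjectiveOn A B U N X
    intro-InjectiveOn [] X-int _ = X-int
    intro-InjectiveOn (v ∷ N) X-int ¬ann = intro-InjectiveOn N X-int (¬ann ∘ there) , ¬ann (here ≡.refl)

  #injective : ∀ {m} (A B : Matrix F m) U N → ℕ
  #injective A B U N = count (InjectiveOn? A B U N ∘ decodeMatrix)

  module _ {m : ℕ} (A B : Matrix F m) (kA : KMatrix A) (kB : KMatrix B)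
    (G H : Matrix F m) (GH≃I : G · H ≃ I) (HG≃I : H · G ≃ I) (GA≃BG : G · A ≃ B · G) where

    private
      HB≃AH : H · B ≃ A · H
      HB≃AH = begin
        H · B                 ≈⟨ ·-identityʳ _ ⟨
        H · B · I             ≈⟨ ·-congˡ GH≃I ⟨
        H · B · (G · H)       ≈⟨ ·-assoc (H · B) G H ⟨
        H · B · G · H         ≈⟨ ·-congʳ (·-assoc H B G) ⟩
        H · (B · G) · H       ≈⟨ ·-congʳ (·-congˡ GA≃BG) ⟨
        H · (G · A) · H       ≈⟨ ·-congʳ (·-assoc H G A) ⟨
        H · G · A · H         ≈⟨ ·-congʳ (·-congʳ HG≃I) ⟩
        I · A · H             ≈⟨ ·-congʳ (·-identityˡ A) ⟩
        A · H                 ∎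
        where open Relation.Binary.Reasoning.Setoid (≃-setoid {m})

    -- Inclusion-exclusion one vector at a time: the solutions split into those that kill `v` and
    -- those that do not, and killing `v` is one more linear condition. For empty `N` the two
    -- solution spaces are compared in both directions, by `G` and by its inverse `H`.
    #injective-≡ : ∀ U N → All KMatrix U → All KMatrix N → #injective A A U N ≡ #injective A B U N
    #injective-≡ U [] kU kN = ℕ.≤-antisym
      (#intertwiners-≤ A A B kA kB U kU G H HG≃I GA≃BG)
      (#intertwiners-≤ A B A kA kA U kU H G GH≃I HB≃AH)
    #injective-≡ U (v ∷ N) kU (kv ∷ kN) = ℕ.+-cancelʳ-≡ _ _ _ (begin
      #injective A A U (v ∷ N) ℕ.+ #injective A A (v ∷ U) N   ≡⟨ split A ⟨
      #injective A A U N                                      ≡⟨ #injective-≡ U N kU kN ⟩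
      #injective A B U N                                      ≡⟨ split B ⟩
      #injective A B U (v ∷ N) ℕ.+ #injective A B (v ∷ U) N
        ≡⟨ ≡.cong (#injective A B U (v ∷ N) ℕ.+_) (#injective-≡ (v ∷ U) N (kv ∷ kU) kN) ⟨
      #injective A B U (v ∷ N) ℕ.+ #injective A A (v ∷ U) N   ∎)
      where
      open ≡.≡-Reasoning
      split : ∀ C → #injective A C U N ≡ #injective A C U (v ∷ N) ℕ.+ #injective A C (v ∷ U) N
      split C = ≡.trans
        (count-split (InjectiveOn? A C U N ∘ decodeMatrix) (λ c → (decodeMatrix c · v) ≃? O))
        (≡.cong (#injective A C U (v ∷ N) ℕ.+_) (count-cong
          (λ c → InjectiveOn? A C U N (decodeMatrix c) ×-dec ((decodeMatrix c · v) ≃? O))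
          (InjectiveOn? A C (v ∷ U) N ∘ decodeMatrix)
          (to-constraint v N) (from-constraint v N)))

    private
      KNonzero : Pred (Matrix F m) _
      KNonzero v = KMatrix v × ¬ v ≃ O

      KNonzero? : Decidable KNonzero
      KNonzero? v = KMatrix? v ×-dec ¬? (v ≃? O)

      nonzero : List (Matrix F m)
      nonzero = List.filter KNonzero? (List.map decodeMatrix (List.allFin _))

      nonzero-KNonzero : ∀ {v} → v ∈ nonzero → KNonzero v
      nonzero-KNonzero v∈ = proj₂ (List.∈-filter⁻ KNonzero? {xs = List.map decodeMatrix (List.allFin _)} v∈)

      -- Matrices are functions, so the list contains a decoded copy of `v`, equal to it only
      -- entrywise.
      nonzero-complete : ∀ {v} → KNonzero v → decodeMatrix (matrixCode v) ∈ nonzero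
      nonzero-complete {v} (kv , v≄O) = List.∈-filter⁺ KNonzero? (List.∈-map⁺ decodeMatrix (List.∈-allFin (matrixCode v)))
        (KMatrix-resp (≃-sym (decode-matrixCode v)) kv , v≄O ∘ ≃-trans (≃-sym (decode-matrixCode v)))

      I-injective : InjectiveOn A A [] nonzero (decodeMatrix {m} (matrixCode {m} I))
      I-injective = intro-InjectiveOn nonzero
        (Intertwiner-resp (≃-sym (decode-matrixCode I)) (KMatrix-I , ≃-trans (·-identityˡ A) (≃-sym (·-identityʳ A)) , []))
        (λ {v} v∈ Iv≃O → proj₂ (nonzero-KNonzero v∈)
          (≃-trans (≃-sym (·-identityˡ v)) (≃-trans (·-congʳ (≃-sym (decode-matrixCode I))) Iv≃O)))

      KSetoid : Setoid _ _
      KSetoid = record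
        { Carrier = ∃ (KMatrix {m})
        ; _≈_ = λ X Y → proj₁ X ≃ proj₁ Y
        ; isEquivalence = record { refl = ≃-refl ; sym = ≃-sym ; trans = ≃-trans } }

    conjugate-over-subfield : ∃₂ λ X Y → KMatrix X × KMatrix Y × X · Y ≃ I × Y · X ≃ I × X · A ≃ B · X
    conjugate-over-subfield =
      -- The identity shows that injective intertwiners from A to itself exist. Its position among
      -- them, read as a position among the equally many from A to B, selects `X`.
      let c , inj = select (InjectiveOn? A B [] nonzero ∘ decodeMatrix)
            (≡.subst Fin (#injective-≡ [] nonzero [] (All.tabulate (proj₁ ∘ nonzero-KNonzero)))
              (rank (InjectiveOn? A A [] nonzero ∘ decodeMatrix) (matrixCode {m} I , I-injective)))
          X = decodeMatrix c
          kX , XA≃BX , _ = InjectiveOn⇒Intertwiner nonzero inj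
          (Y , kY) , XY≃I = injective⇒surjective (λ Z → X · proj₁ Z , KMatrix-· kX (proj₂ Z))
            (λ {Z} {Z′} → X·-injective X inj (proj₂ Z) (proj₂ Z′)) (I , KMatrix-I)
      in X , Y , kX , kY , XY≃I , right-inverse⇒left-inverse X Y XY≃I , XA≃BX
      where
      open FinitelyCoded KSetoid (matrixCode ∘ proj₁) matrixCode-injective
      open Algebra.Properties.Ring (matrixRing m) using (x[y-z]≈xy-xz)
        renaming (x∙y⁻¹≈ε⇒x≈y to x-y≃O⇒x≃y; x≈y⇒x∙y⁻¹≈ε to x≃y⇒x-y≃O)

      X·-injective : ∀ X → InjectiveOn A B [] nonzero X → ∀ {Z Z′} → KMatrix Z → KMatrix Z′ → X · Z ≃ X · Z′ → Z ≃ Z′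
      X·-injective X inj {Z} {Z′} kZ kZ′ eq with (Z ⊕ (⊖ Z′)) ≃? O
      ... | yes Z-Z′≃O = x-y≃O⇒x≃y Z Z′ Z-Z′≃O
      ... | no Z-Z′≄O = contradiction
        (≃-trans (·-congˡ (decode-matrixCode (Z ⊕ (⊖ Z′)))) (≃-trans (x[y-z]≈xy-xz X Z Z′) (x≃y⇒x-y≃O eq)))
        (InjectiveOn⇒¬Annihilates nonzero inj (nonzero-complete ((λ i j → K-+ (kZ i j) (K-neg (kZ′ i j))) , Z-Z′≄O)))

-- Congruence of matrices with equal cosquares.

module _ (F : FiniteField) (q n : ℕ) .{{_ : ℕ.NonZero n}}
  (q-prime-power : IsPrimePower q) (size≡q^2n : FiniteField.size F ≡ q ℕ.^ (2 ℕ.* n)) where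
  open FiniteField F
  open Field F
  open Matrices F
  open QuadraticSubfield F q n q-prime-power size≡q^2n

  -- If A and B have the same cosquare, then T = A B⁻¹ is fixed by the adjunction
  -- X ↦ B X* B⁻¹, which restricts to an involution of the commutative ring K[T].
  -- There T is a norm, T = Z (B Z* B⁻¹), that is, A = Z B Z*.
  module EqualCosquares
    (d : Carrier) (kd : K d) (d̄≢d : bar d ≢ d)
    {m : ℕ} (A B A⁻¹ B⁻¹ : Matrix F m) (kA : KMatrix A) (kB : KMatrix B)
    (A⁻¹A≃I : A⁻¹ · A ≃ I) (BB⁻¹≃I : B · B⁻¹ ≃ I) (B⁻¹B≃I : B⁻¹ · B ≃ I)
    (cosquares≃ : A *ᵗ · A⁻¹ ≃ B *ᵗ · B⁻¹) where

    open Algebra.Properties.Monoid (·-monoid {m}) using (cancelʳ; cancelˡ; cancelᶜ)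
    open Relation.Binary.Reasoning.Setoid (≃-setoid {m})

    T : Matrix F m
    T = A · B⁻¹

    kT : KMatrix T
    kT = KMatrix-· kA (KMatrix-inverse BB⁻¹≃I B⁻¹B≃I kB)

    -- For row vectors and the form u B v* this moves `X` from the second argument to the first. On
    -- general K-matrices it reverses products and squares to conjugation by the inverse of the
    -- cosquare of B.
    adjoint : Matrix F m → Matrix F m
    adjoint X = B · X *ᵗ · B⁻¹

    adjoint-cong : ∀ {X Y} → X ≃ Y → adjoint X ≃ adjoint Y
    adjoint-cong X≃Y = ·-congʳ (·-congˡ (*ᵗ-cong X≃Y))

    adjoint-⊕ : ∀ X Y → adjoint (X ⊕ Y) ≃ adjoint X ⊕ adjoint Y
    adjoint-⊕ X Y = ≃-trans (·-congʳ (≃-trans (·-congˡ (*ᵗ-⊕ X Y)) (·-distribˡ B (X *ᵗ) (Y *ᵗ)))) (·-distribʳ B⁻¹ (B · X *ᵗ) (B · Y *ᵗ))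

    adjoint-· : ∀ X Y → adjoint (X · Y) ≃ adjoint Y · adjoint X
    adjoint-· X Y = ≃-sym (begin
      B · Y *ᵗ · B⁻¹ · (B · X *ᵗ · B⁻¹)     ≈⟨ ·-congˡ (·-assoc B (X *ᵗ) B⁻¹) ⟩
      B · Y *ᵗ · B⁻¹ · (B · (X *ᵗ · B⁻¹))   ≈⟨ cancelᶜ B⁻¹B≃I (B · Y *ᵗ) (X *ᵗ · B⁻¹) ⟩
      B · Y *ᵗ · (X *ᵗ · B⁻¹)               ≈⟨ ·-assoc (B · Y *ᵗ) (X *ᵗ) B⁻¹ ⟨
      B · Y *ᵗ · X *ᵗ · B⁻¹                 ≈⟨ ·-congʳ (·-assoc B (Y *ᵗ) (X *ᵗ)) ⟩
      B · (Y *ᵗ · X *ᵗ) · B⁻¹               ≈⟨ ·-congʳ (·-congˡ (*ᵗ-· X Y)) ⟨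
      B · (X · Y) *ᵗ · B⁻¹                  ∎)

    scalar-commutes : ∀ c (X : Matrix F m) → scalar c · X ≃ X · scalar c
    scalar-commutes c X = entrywise λ i j → ≡.trans (scalar-· c X i j) (≡.sym (·-scalar c X i j))

    adjoint-scalar : ∀ c → adjoint (scalar c) ≃ scalar (bar c)
    adjoint-scalar c = begin
      B · scalar c *ᵗ · B⁻¹       ≈⟨ ·-congʳ (·-congˡ (*ᵗ-scalar c)) ⟩
      B · scalar (bar c) · B⁻¹    ≈⟨ ·-congʳ (scalar-commutes (bar c) B) ⟨
      scalar (bar c) · B · B⁻¹    ≈⟨ cancelʳ BB⁻¹≃I (scalar (bar c)) ⟩
      scalar (bar c)              ∎

    scalar-1 : scalar 1# ≃ I {m}
    scalar-1 = entrywise λ i j → *-identityˡ (I i j)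

    adjoint-I : adjoint I ≃ I
    adjoint-I = ≃-trans (·-congʳ (≃-trans (·-congˡ *ᵗ-I) (·-identityʳ B))) BB⁻¹≃I

    -- The hypothesis on cosquares enters here: it gives A* = B* B⁻¹ A, after which the adjoint of A
    -- B⁻¹ collapses to A B⁻¹.
    adjoint-T : adjoint T ≃ T
    adjoint-T = ·-congʳ (begin
      B · (A · B⁻¹) *ᵗ                  ≈⟨ ·-congˡ (*ᵗ-· A B⁻¹) ⟩
      B · (B⁻¹ *ᵗ · A *ᵗ)               ≈⟨ ·-congˡ (·-congˡ A*≃) ⟩
      B · (B⁻¹ *ᵗ · (B *ᵗ · (B⁻¹ · A))) ≈⟨ ·-congˡ (cancelˡ B⁻¹*B*≃I (B⁻¹ · A)) ⟩
      B · (B⁻¹ · A)                     ≈⟨ cancelˡ BB⁻¹≃I A ⟩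
      A                                 ∎)
      where
      B⁻¹*B*≃I : B⁻¹ *ᵗ · B *ᵗ ≃ I
      B⁻¹*B*≃I = ≃-trans (≃-sym (*ᵗ-· B B⁻¹)) (≃-trans (*ᵗ-cong BB⁻¹≃I) *ᵗ-I)

      A*≃ : A *ᵗ ≃ B *ᵗ · (B⁻¹ · A)
      A*≃ = begin
        A *ᵗ                  ≈⟨ cancelʳ A⁻¹A≃I (A *ᵗ) ⟨
        A *ᵗ · A⁻¹ · A        ≈⟨ ·-congʳ cosquares≃ ⟩
        B *ᵗ · B⁻¹ · A        ≈⟨ ·-assoc (B *ᵗ) B⁻¹ A ⟩
        B *ᵗ · (B⁻¹ · A)      ∎

    -- Membership is generated by the ring operations, so properties of K[T] follow by induction
    -- from scalars and T. `respᴷ` is there because entrywise equal matrices need not be identical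
    -- functions.
    data K[T] : Matrix F m → Set where
      scalarᴷ : ∀ {c} → K c → K[T] (scalar c)
      Tᴷ : K[T] T
      _⊕ᴷ_ : ∀ {X Y} → K[T] X → K[T] Y → K[T] (X ⊕ Y)
      _·ᴷ_ : ∀ {X Y} → K[T] X → K[T] Y → K[T] (X · Y)
      ⊖ᴷ_ : ∀ {X} → K[T] X → K[T] (⊖ X)
      respᴷ : ∀ {X Y} → X ≃ Y → K[T] X → K[T] Y

    K[T]⇒KMatrix : ∀ {X} → K[T] X → KMatrix X
    K[T]⇒KMatrix (scalarᴷ kc) i j = K-* kc (KMatrix-I i j)
    K[T]⇒KMatrix Tᴷ = kT
    K[T]⇒KMatrix (x ⊕ᴷ y) = KMatrix-⊕ (K[T]⇒KMatrix x) (K[T]⇒KMatrix y)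
    K[T]⇒KMatrix (x ·ᴷ y) = KMatrix-· (K[T]⇒KMatrix x) (K[T]⇒KMatrix y)
    K[T]⇒KMatrix (⊖ᴷ x) i j = K-neg (K[T]⇒KMatrix x i j)
    K[T]⇒KMatrix (respᴷ X≃Y x) = KMatrix-resp X≃Y (K[T]⇒KMatrix x)

    open Algebra.Properties.Ring (matrixRing m) using ()
      renaming (-‿distribˡ-* to ⊖-distribˡ-·; -‿distribʳ-* to ⊖-distribʳ-·; +-inverseʳ-unique to ⊖-unique)

    centralizes : ∀ {Y} → Y · T ≃ T · Y → ∀ {X} → K[T] X → Y · X ≃ X · Y
    centralizes {Y} YT≃TY (scalarᴷ {c} _) = ≃-sym (scalar-commutes c Y)
    centralizes YT≃TY Tᴷ = YT≃TY
    centralizes {Y} YT≃TY (_⊕ᴷ_ {X} {X′} x x′) = ≃-trans (·-distribˡ Y X X′)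
      (≃-trans (⊕-cong (centralizes YT≃TY x) (centralizes YT≃TY x′)) (≃-sym (·-distribʳ Y X X′)))
    centralizes {Y} YT≃TY (_·ᴷ_ {X} {X′} x x′) = begin
      Y · (X · X′)    ≈⟨ ·-assoc Y X X′ ⟨
      Y · X · X′      ≈⟨ ·-congʳ (centralizes YT≃TY x) ⟩
      X · Y · X′      ≈⟨ ·-assoc X Y X′ ⟩
      X · (Y · X′)    ≈⟨ ·-congˡ (centralizes YT≃TY x′) ⟩
      X · (X′ · Y)    ≈⟨ ·-assoc X X′ Y ⟨
      X · X′ · Y      ∎
    centralizes {Y} YT≃TY (⊖ᴷ_ {X} x) = ≃-trans (≃-sym (⊖-distribʳ-· Y X)) (≃-trans (⊖-cong (centralizes YT≃TY x)) (⊖-distribˡ-· X Y))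
    centralizes YT≃TY (respᴷ X≃X′ x) = ≃-trans (·-congˡ (≃-sym X≃X′)) (≃-trans (centralizes YT≃TY x) (·-congʳ X≃X′))

    -- `centralizes` acts twice: T commutes with `X` because `X` is in K[T], and then `X`, commuting
    -- with T, commutes with `Y`.
    K[T]-comm : ∀ {X Y} → K[T] X → K[T] Y → X · Y ≃ Y · X
    K[T]-comm x y = centralizes (≃-sym (centralizes ≃-refl x)) y

    adjoint-⊖ : ∀ X → adjoint (⊖ X) ≃ ⊖ adjoint X
    adjoint-⊖ X = ⊖-unique (adjoint X) (adjoint (⊖ X)) (begin
      adjoint X ⊕ adjoint (⊖ X)   ≈⟨ adjoint-⊕ X (⊖ X) ⟨
      adjoint (X ⊕ (⊖ X))         ≈⟨ adjoint-cong (entrywise λ i j → -‿inverseʳ (X i j)) ⟩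
      adjoint O                   ≈⟨ ·-congʳ (≃-trans (·-congˡ (entrywise λ i j → bar-0)) (·-zeroʳ B)) ⟩
      O · B⁻¹                     ≈⟨ ·-zeroˡ B⁻¹ ⟩
      O                           ∎)

    K[T]-adjoint : ∀ {X} → K[T] X → K[T] (adjoint X)
    K[T]-adjoint (scalarᴷ {c} kc) = respᴷ (≃-sym (adjoint-scalar c)) (scalarᴷ (K-bar kc))
    K[T]-adjoint Tᴷ = respᴷ (≃-sym adjoint-T) Tᴷ
    K[T]-adjoint (_⊕ᴷ_ {X} {Y} x y) = respᴷ (≃-sym (adjoint-⊕ X Y)) (K[T]-adjoint x ⊕ᴷ K[T]-adjoint y)
    K[T]-adjoint (_·ᴷ_ {X} {Y} x y) = respᴷ (≃-sym (adjoint-· X Y)) (K[T]-adjoint y ·ᴷ K[T]-adjoint x)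
    K[T]-adjoint (⊖ᴷ_ {X} x) = respᴷ (≃-sym (adjoint-⊖ X)) (⊖ᴷ K[T]-adjoint x)
    K[T]-adjoint (respᴷ X≃Y x) = respᴷ (adjoint-cong X≃Y) (K[T]-adjoint x)

    adjoint-involutive : ∀ {X} → K[T] X → adjoint (adjoint X) ≃ X
    adjoint-involutive (scalarᴷ {c} kc) = ≃-trans (adjoint-cong (adjoint-scalar c)) (≃-trans (adjoint-scalar (bar c))
      (entrywise λ i j → ≡.cong (_* I i j) (≡.trans (bar-bar c) kc)))
    adjoint-involutive Tᴷ = ≃-trans (adjoint-cong adjoint-T) adjoint-T
    adjoint-involutive (_⊕ᴷ_ {X} {Y} x y) = ≃-trans (adjoint-cong (adjoint-⊕ X Y))
      (≃-trans (adjoint-⊕ (adjoint X) (adjoint Y)) (⊕-cong (adjoint-involutive x) (adjoint-involutive y)))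
    adjoint-involutive (_·ᴷ_ {X} {Y} x y) = ≃-trans (adjoint-cong (adjoint-· X Y))
      (≃-trans (adjoint-· (adjoint Y) (adjoint X)) (·-cong (adjoint-involutive x) (adjoint-involutive y)))
    adjoint-involutive (⊖ᴷ_ {X} x) = ≃-trans (adjoint-cong (adjoint-⊖ X)) (≃-trans (adjoint-⊖ (adjoint X)) (⊖-cong (adjoint-involutive x)))
    adjoint-involutive (respᴷ X≃Y x) = ≃-trans (adjoint-cong (adjoint-cong (≃-sym X≃Y))) (≃-trans (adjoint-involutive x) X≃Y)

    K[T]-ring : CommutativeRing 0ℓ 0ℓ
    K[T]-ring = record
      { Carrier = ∃ K[T]
      ; _≈_ = λ X Y → proj₁ X ≃ proj₁ Y
      ; _+_ = λ (X , x) (Y , y) → X ⊕ Y , x ⊕ᴷ y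
      ; _*_ = λ (X , x) (Y , y) → X · Y , x ·ᴷ y
      ; -_ = λ (X , x) → ⊖ X , ⊖ᴷ x
      ; 0# = O , respᴷ (entrywise λ i j → zeroˡ (I i j)) (scalarᴷ K-0)
      ; 1# = I , respᴷ scalar-1 (scalarᴷ K-1)
      ; isCommutativeRing = record
        { isRing = record
          { +-isAbelianGroup = record
            { isGroup = record
              { isMonoid = record
                { isSemigroup = record
                  { isMagma = record
                    { isEquivalence = record { refl = ≃-refl ; sym = ≃-sym ; trans = ≃-trans }
                    ; ∙-cong = ⊕-cong }
                  ; assoc = λ X Y Z → MatRing.+-assoc (proj₁ X) (proj₁ Y) (proj₁ Z) }
                ; identity = (λ X → MatRing.+-identityˡ (proj₁ X)) , (λ X → MatRing.+-identityʳ (proj₁ X)) }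
              ; inverse = (λ X → MatRing.-‿inverseˡ (proj₁ X)) , (λ X → MatRing.-‿inverseʳ (proj₁ X))
              ; ⁻¹-cong = ⊖-cong }
            ; comm = λ X Y → MatRing.+-comm (proj₁ X) (proj₁ Y) }
          ; *-cong = ·-cong
          ; *-assoc = λ X Y Z → ·-assoc (proj₁ X) (proj₁ Y) (proj₁ Z)
          ; *-identity = (λ X → ·-identityˡ (proj₁ X)) , (λ X → ·-identityʳ (proj₁ X))
          ; distrib = (λ X Y Z → ·-distribˡ (proj₁ X) (proj₁ Y) (proj₁ Z)) , (λ X Y Z → ·-distribʳ (proj₁ X) (proj₁ Y) (proj₁ Z)) }
        ; *-comm = λ X Y → K[T]-comm (proj₂ X) (proj₂ Y) } }
      where module MatRing = MatrixRing {m}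

    private
      module R = CommutativeRing K[T]-ring
      code : R.Carrier → Fin ((size ℕ.^ m) ℕ.^ m)
      code = matrixCode ∘ proj₁

      open FiniteRing K[T]-ring code matrixCode-injective using (Unit; regular⇒unit)

      _† : R.Carrier → R.Carrier
      (X , x) † = adjoint X , K[T]-adjoint x

      -- The matrix `Y` may lie outside K[T]; it only shows that `X` is regular, and finiteness of
      -- K[T] supplies an inverse inside.
      invertible⇒unit : ∀ X {Y} → Y · proj₁ X ≃ I → Unit X
      invertible⇒unit X {Y} YX≃I = regular⇒unit X λ Z XZ≃O →
        ≃-trans (≃-sym (cancelˡ YX≃I (proj₁ Z))) (≃-trans (·-congˡ XZ≃O) (·-zeroʳ Y))

      D δ : R.Carrier
      D = scalar d , scalarᴷ kd
      δ = D R.- D †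

      -- `δ` is the scalar d - d^q, which is nonzero by the choice of `d`.
      δ-unit : Unit δ
      δ-unit = let e , δe≡1 = inverse (d + - bar d) (λ eq → d̄≢d (≡.sym (x∙y⁻¹≈ε⇒x≈y d (bar d) eq))) in
        invertible⇒unit δ {scalar e} (begin
          scalar e · (scalar d ⊕ (⊖ adjoint (scalar d)))    ≈⟨ ·-congˡ (⊕-cong ≃-refl (⊖-cong (adjoint-scalar d))) ⟩
          scalar e · (scalar d ⊕ (⊖ scalar (bar d)))        ≈⟨ entrywise (λ i j → let u = I i j in
            ≡.trans (scalar-· e (scalar d ⊕ (⊖ scalar (bar d))) i j)
           (≡.trans (≡.cong (λ z → e * (d * u + z)) (-‿distribˡ-* (bar d) u))
           (≡.trans (≡.cong (e *_) (≡.sym (distribʳ u d (- bar d))))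
           (≡.trans (≡.sym (*-assoc e (d + - bar d) u))
           (≡.trans (≡.cong (_* u) (≡.trans (*-comm e _) δe≡1)) (*-identityˡ u)))))) ⟩
          I                                                 ∎)

      D≃δ+D† : D R.≈ (δ R.+ D †)
      D≃δ+D† = R.sym {δ R.+ D †} {D} (R.trans {δ R.+ D †} {D R.+ (R.- D † R.+ D †)} {D} (R.+-assoc D (R.- D †) (D †))
        (R.trans {D R.+ (R.- D † R.+ D †)} {D R.+ R.0#} {D} (R.+-congˡ {D} {R.- D † R.+ D †} {R.0#} (R.-‿inverseˡ (D †))) (R.+-identityʳ D)))

      module Involution = FiniteRingWithInvolution K[T]-ring code matrixCode-cong matrixCode-injective
        _† adjoint-cong (λ (_ , x) → adjoint-involutive x) (λ (X , _) (Y , _) → adjoint-⊕ X Y)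
        -- The adjoint reverses products; commutativity of K[T] restores the order.
        (λ X Y → ≃-trans (adjoint-· (proj₁ X) (proj₁ Y)) (K[T]-comm (K[T]-adjoint (proj₂ Y)) (K[T]-adjoint (proj₂ X))))
        adjoint-I D δ D≃δ+D† δ-unit

    congruent : ∃ λ Z → KMatrix Z × Z · B · Z *ᵗ ≃ A
    congruent = ∃-matrix-stable
      (λ Z → KMatrix? Z ×-dec ((Z · B · Z *ᵗ) ≃? A))
      (λ X≃Y (kX , eq) → KMatrix-resp X≃Y kX , ≃-trans (·-cong (·-congʳ (≃-sym X≃Y)) (*ᵗ-cong (≃-sym X≃Y))) eq)
      (λ ¬∃ → Involution.selfadjoint-unit-is-norm (T , Tᴷ) (invertible⇒unit (T , Tᴷ) {B · A⁻¹} T⁻¹T≃I) adjoint-T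
        λ ((Z , z) , eq) → ¬∃ (Z , K[T]⇒KMatrix z , (begin
          Z · B · Z *ᵗ                   ≈⟨ cancelʳ B⁻¹B≃I (Z · B · Z *ᵗ) ⟨
          Z · B · Z *ᵗ · B⁻¹ · B         ≈⟨ ·-congʳ (·-congʳ (·-assoc Z B (Z *ᵗ))) ⟩
          Z · (B · Z *ᵗ) · B⁻¹ · B       ≈⟨ ·-congʳ (·-assoc Z (B · Z *ᵗ) B⁻¹) ⟩
          Z · adjoint Z · B              ≈⟨ ·-congʳ eq ⟩
          A · B⁻¹ · B                    ≈⟨ cancelʳ B⁻¹B≃I A ⟩
          A                              ∎)))
      where
      T⁻¹T≃I : B · A⁻¹ · (A · B⁻¹) ≃ I
      T⁻¹T≃I = ≃-trans (cancelᶜ A⁻¹A≃I B B⁻¹) BB⁻¹≃I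

-- Cyclic rotation of indices.

module Rotation (n : ℕ) .{{_ : ℕ.NonZero n}} where
  open ≡.≡-Reasoning

  toℕ-mod : ∀ a → toℕ (a ℕ.mod n) ≡ a ℕ.% n
  toℕ-mod a = Fin.toℕ-fromℕ< (ℕ.m%n<n a n)

  %-+ : ∀ a b → (a ℕ.% n ℕ.+ b) ℕ.% n ≡ (a ℕ.+ b) ℕ.% n
  %-+ a b = begin
    (a ℕ.% n ℕ.+ b) ℕ.% n                    ≡⟨ ℕ.%-distribˡ-+ (a ℕ.% n) b n ⟩
    (a ℕ.% n ℕ.% n ℕ.+ b ℕ.% n) ℕ.% n        ≡⟨ ≡.cong (λ z → (z ℕ.+ b ℕ.% n) ℕ.% n) (ℕ.m%n%n≡m%n a n) ⟩
    (a ℕ.% n ℕ.+ b ℕ.% n) ℕ.% n              ≡⟨ ℕ.%-distribˡ-+ a b n ⟨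
    (a ℕ.+ b) ℕ.% n                          ∎

  -- `backward` copies the index formula of `ML`, so that row `k` of `ML` reads its coefficients at
  -- `backward (toℕ k)` by definition.
  forward backward : ℕ → Fin n → Fin n
  forward k i = (toℕ i ℕ.+ k) ℕ.mod n
  backward k i = ((toℕ i ℕ.+ n) ℕ.∸ k) ℕ.mod n

  full-turn : ∀ (i : Fin n) → (toℕ i ℕ.+ n) ℕ.% n ≡ toℕ i
  full-turn i = ≡.trans (ℕ.[m+n]%n≡m%n (toℕ i) n) (ℕ.m<n⇒m%n≡m (Fin.toℕ<n i))

  forward-backward : ∀ k → k ℕ.≤ n → ∀ i → forward k (backward k i) ≡ i
  forward-backward k k≤n i = Fin.toℕ-injective (begin
    toℕ (forward k (backward k i))                    ≡⟨ toℕ-mod _ ⟩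
    (toℕ (backward k i) ℕ.+ k) ℕ.% n                  ≡⟨ ≡.cong (λ z → (z ℕ.+ k) ℕ.% n) (toℕ-mod _) ⟩
    (((toℕ i ℕ.+ n) ℕ.∸ k) ℕ.% n ℕ.+ k) ℕ.% n         ≡⟨ %-+ ((toℕ i ℕ.+ n) ℕ.∸ k) k ⟩
    ((toℕ i ℕ.+ n) ℕ.∸ k ℕ.+ k) ℕ.% n
      ≡⟨ ≡.cong (ℕ._% n) (ℕ.m∸n+n≡m (ℕ.≤-trans k≤n (ℕ.m≤n+m n (toℕ i)))) ⟩
    (toℕ i ℕ.+ n) ℕ.% n                               ≡⟨ full-turn i ⟩
    toℕ i                                             ∎)

  backward-forward : ∀ k → k ℕ.≤ n → ∀ i → backward k (forward k i) ≡ i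
  backward-forward k k≤n i = Fin.toℕ-injective (begin
    toℕ (backward k (forward k i))                    ≡⟨ toℕ-mod _ ⟩
    (toℕ (forward k i) ℕ.+ n ℕ.∸ k) ℕ.% n             ≡⟨ ≡.cong (λ z → (z ℕ.+ n ℕ.∸ k) ℕ.% n) (toℕ-mod _) ⟩
    ((toℕ i ℕ.+ k) ℕ.% n ℕ.+ n ℕ.∸ k) ℕ.% n           ≡⟨ ≡.cong (ℕ._% n) (ℕ.+-∸-assoc ((toℕ i ℕ.+ k) ℕ.% n) k≤n) ⟩
    ((toℕ i ℕ.+ k) ℕ.% n ℕ.+ (n ℕ.∸ k)) ℕ.% n         ≡⟨ %-+ (toℕ i ℕ.+ k) (n ℕ.∸ k) ⟩
    (toℕ i ℕ.+ k ℕ.+ (n ℕ.∸ k)) ℕ.% n                 ≡⟨ ≡.cong (ℕ._% n) (≡.trans (ℕ.+-assoc (toℕ i) k (n ℕ.∸ k))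
                                                           (≡.cong (toℕ i ℕ.+_) (ℕ.m+[n∸m]≡n k≤n))) ⟩
    (toℕ i ℕ.+ n) ℕ.% n                               ≡⟨ full-turn i ⟩
    toℕ i                                             ∎)

  rotation : ∀ k → k ℕ.≤ n → Perm.Permutation n n
  rotation k k≤n = Perm.permutation (forward k) (backward k) (forward-backward k k≤n) (backward-forward k k≤n)

-- Trace forms and the factorization of their coefficient matrices.

module SesquilinearForm (F : FiniteField) (q n : ℕ) .{{_ : ℕ.NonZero n}}
  (q-prime-power : IsPrimePower q) (size≡q^2n : FiniteField.size F ≡ q ℕ.^ (2 ℕ.* n)) (a : Fin n → FiniteField.Carrier F) where
  open FiniteField F
  open Field F
  open Matrices F
  open QuadraticSubfield F q n q-prime-power size≡q^2n
  open Rotation n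
  open ≡.≡-Reasoning

  form : Carrier → Carrier → Carrier
  form = σ F q n a

  -- The q²-power map has n-th iterate the identity on F, so full turns drop out of the exponent.
  φ-% : ∀ s x → φ (2 ℕ.* (s ℕ.% n)) x ≡ φ (2 ℕ.* s) x
  φ-% s x = ≡.sym (begin
    φ (2 ℕ.* s) x
      ≡⟨ ≡.cong (λ z → φ (2 ℕ.* z) x) (≡.trans (ℕ.m≡m%n+[m/n]*n s n) (ℕ.+-comm (s ℕ.% n) _)) ⟩
    φ (2 ℕ.* (s ℕ./ n ℕ.* n ℕ.+ s ℕ.% n)) x                ≡⟨ turns (s ℕ./ n) ⟩
    φ (2 ℕ.* (s ℕ.% n)) x                                  ∎)
    where
    turns : ∀ t → φ (2 ℕ.* (t ℕ.* n ℕ.+ s ℕ.% n)) x ≡ φ (2 ℕ.* (s ℕ.% n)) x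
    turns zero = ≡.refl
    turns (suc t) = begin
      φ (2 ℕ.* (n ℕ.+ t ℕ.* n ℕ.+ s ℕ.% n)) x
        ≡⟨ ≡.cong (λ z → φ (2 ℕ.* z) x) (ℕ.+-assoc n (t ℕ.* n) (s ℕ.% n)) ⟩
      φ (2 ℕ.* (n ℕ.+ (t ℕ.* n ℕ.+ s ℕ.% n))) x
        ≡⟨ ≡.cong (λ z → φ z x) (ℕ.*-distribˡ-+ 2 n (t ℕ.* n ℕ.+ s ℕ.% n)) ⟩
      φ (2 ℕ.* n ℕ.+ 2 ℕ.* (t ℕ.* n ℕ.+ s ℕ.% n)) x        ≡⟨ φ-φ (2 ℕ.* (t ℕ.* n ℕ.+ s ℕ.% n)) (2 ℕ.* n) x ⟨
      φ (2 ℕ.* (t ℕ.* n ℕ.+ s ℕ.% n)) (φ (2 ℕ.* n) x)      ≡⟨ ≡.cong (φ (2 ℕ.* (t ℕ.* n ℕ.+ s ℕ.% n))) (φ-2n x) ⟩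
      φ (2 ℕ.* (t ℕ.* n ℕ.+ s ℕ.% n)) x                    ≡⟨ turns t ⟩
      φ (2 ℕ.* (s ℕ.% n)) x                                ∎

  φ-forward : ∀ k (i : Fin n) x → φ (2 ℕ.* toℕ (forward k i)) x ≡ φ (2 ℕ.* k) (φ (2 ℕ.* toℕ i) x)
  φ-forward k i x = begin
    φ (2 ℕ.* toℕ (forward k i)) x                ≡⟨ ≡.cong (λ z → φ (2 ℕ.* z) x) (toℕ-mod (toℕ i ℕ.+ k)) ⟩
    φ (2 ℕ.* ((toℕ i ℕ.+ k) ℕ.% n)) x            ≡⟨ φ-% (toℕ i ℕ.+ k) x ⟩
    φ (2 ℕ.* (toℕ i ℕ.+ k)) x                    ≡⟨ ≡.cong (λ z → φ z x) (ℕ.*-distribˡ-+ 2 (toℕ i) k) ⟩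
    φ (2 ℕ.* toℕ i ℕ.+ 2 ℕ.* k) x                ≡⟨ φ-φ (2 ℕ.* k) (2 ℕ.* toℕ i) x ⟨
    φ (2 ℕ.* k) (φ (2 ℕ.* toℕ i) x)              ∎

  φ² : Fin n → Carrier → Carrier
  φ² i = φ (2 ℕ.* toℕ i)

  -- Raising to the power q² permutes the summands of the trace cyclically.
  Tr-K : ∀ x → K (Tr F q n x)
  Tr-K x = begin
    φ 2 (∑ (λ i → φ² i x))                       ≡⟨ φ-∑ 2 (λ i → φ² i x) ⟩
    ∑ (λ i → φ 2 (φ² i x))                       ≡⟨ ∑-cong (λ i → φ-forward 1 i x) ⟨
    ∑ (λ i → φ² (forward 1 i) x)                 ≡⟨ ∑-permute (λ i → φ² i x) (rotation 1 (ℕ.>-nonZero⁻¹ n)) ⟨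
    ∑ (λ i → φ² i x)                             ∎

  Tr-+ : ∀ x y → Tr F q n (x + y) ≡ Tr F q n x + Tr F q n y
  Tr-+ x y = ≡.trans (∑-cong {n} (λ i → φ-+ (2 ℕ.* toℕ i) x y)) (∑-+ (λ i → φ² i x) (λ i → φ² i y))

  Tr-* : ∀ {c} → K c → ∀ x → Tr F q n (c * x) ≡ c * Tr F q n x
  Tr-* {c} kc x = ≡.trans (∑-cong (λ i → ≡.trans (φ-* (2 ℕ.* toℕ i) c x) (≡.cong (_* φ² i x) (K-φ kc (toℕ i)))))
    (≡.sym (*-∑ c (λ i → φ² i x)))

  Tr-0 : Tr F q n 0# ≡ 0#
  Tr-0 = ∑-0 (λ i → φ² i 0#) (λ i → φ-0 (2 ℕ.* toℕ i))

  evalLin-+ : ∀ x y → evalLin F q a (x + y) ≡ evalLin F q a x + evalLin F q a y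
  evalLin-+ x y = ≡.trans (∑-cong (λ i → ≡.trans (≡.cong (a i *_) (φ-+ (2 ℕ.* toℕ i) x y)) (distribˡ (a i) _ _)))
    (∑-+ (λ i → a i * φ² i x) (λ i → a i * φ² i y))

  evalLin-* : ∀ {c} → K c → ∀ x → evalLin F q a (c * x) ≡ c * evalLin F q a x
  evalLin-* {c} kc x = ≡.trans (∑-cong (λ i → begin
    a i * φ² i (c * x)             ≡⟨ ≡.cong (a i *_) (φ-* (2 ℕ.* toℕ i) c x) ⟩
    a i * (φ² i c * φ² i x)        ≡⟨ ≡.cong (λ z → a i * (z * φ² i x)) (K-φ kc (toℕ i)) ⟩
    a i * (c * φ² i x)             ≡⟨ *-assoc (a i) c _ ⟨
    a i * c * φ² i x               ≡⟨ ≡.cong (_* φ² i x) (*-comm (a i) c) ⟩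
    c * a i * φ² i x               ≡⟨ *-assoc c (a i) _ ⟩
    c * (a i * φ² i x)             ∎)) (≡.sym (*-∑ c (λ i → a i * φ² i x)))

  evalLin-0 : evalLin F q a 0# ≡ 0#
  evalLin-0 = ∑-0 (λ i → a i * φ² i 0#) (λ i → ≡.trans (≡.cong (a i *_) (φ-0 (2 ℕ.* toℕ i))) (zeroʳ (a i)))

  form-K : ∀ u v → K (form u v)
  form-K u v = Tr-K _

  form-∑ˡ : ∀ {m} {c : Fin m → Carrier} → (∀ k → K (c k)) → ∀ (u : Fin m → Carrier) v →
    form (∑ (λ k → c k * u k)) v ≡ ∑ (λ k → c k * form (u k) v)
  form-∑ˡ {zero} kc u v = ≡.trans (≡.cong (Tr F q n) (zeroˡ _)) Tr-0
  form-∑ˡ {suc m} {c} kc u v = begin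
    Tr F q n ((c Fin.zero * u Fin.zero + rest) * L)
      ≡⟨ ≡.cong (Tr F q n) (distribʳ L (c Fin.zero * u Fin.zero) rest) ⟩
    Tr F q n (c Fin.zero * u Fin.zero * L + rest * L)           ≡⟨ Tr-+ _ _ ⟩
    Tr F q n (c Fin.zero * u Fin.zero * L) + form rest v
      ≡⟨ ≡.cong₂ _+_ (≡.trans (≡.cong (Tr F q n) (*-assoc (c Fin.zero) (u Fin.zero) L)) (Tr-* (kc Fin.zero) _))
                                                                    (form-∑ˡ (kc ∘ Fin.suc) (u ∘ Fin.suc) v) ⟩
    c Fin.zero * form (u Fin.zero) v + ∑ (λ k → c (Fin.suc k) * form (u (Fin.suc k)) v)  ∎
    where
    L = evalLin F q a (bar v)
    rest = ∑ (λ k → c (Fin.suc k) * u (Fin.suc k))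

  form-∑ʳ : ∀ {m} {c : Fin m → Carrier} → (∀ k → K (c k)) → ∀ u (v : Fin m → Carrier) →
    form u (∑ (λ k → c k * v k)) ≡ ∑ (λ k → form u (v k) * bar (c k))
  form-∑ʳ {zero} kc u v = begin
    Tr F q n (u * evalLin F q a (bar 0#))    ≡⟨ ≡.cong (λ z → Tr F q n (u * evalLin F q a z)) bar-0 ⟩
    Tr F q n (u * evalLin F q a 0#)          ≡⟨ ≡.cong (λ z → Tr F q n (u * z)) evalLin-0 ⟩
    Tr F q n (u * 0#)                        ≡⟨ ≡.cong (Tr F q n) (zeroʳ u) ⟩
    Tr F q n 0#                              ≡⟨ Tr-0 ⟩
    0#                                       ∎
  form-∑ʳ {suc m} {c} kc u v = begin
    form u (c₀ * v₀ + rest)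
      ≡⟨ ≡.cong (λ z → Tr F q n (u * evalLin F q a z)) (bar-+ (c₀ * v₀) rest) ⟩
    Tr F q n (u * evalLin F q a (bar (c₀ * v₀) + bar rest))       ≡⟨ ≡.cong (λ z → Tr F q n (u * z)) (evalLin-+ _ _) ⟩
    Tr F q n (u * (evalLin F q a (bar (c₀ * v₀)) + evalLin F q a (bar rest)))
                                                                  ≡⟨ ≡.cong (Tr F q n) (distribˡ u _ _) ⟩
    Tr F q n (u * evalLin F q a (bar (c₀ * v₀)) + u * evalLin F q a (bar rest))
                                                                  ≡⟨ Tr-+ _ _ ⟩
    Tr F q n (u * evalLin F q a (bar (c₀ * v₀))) + form u rest
      ≡⟨ ≡.cong₂ _+_ first (form-∑ʳ (kc ∘ Fin.suc) u (v ∘ Fin.suc)) ⟩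
    form u v₀ * bar c₀ + ∑ (λ k → form u (v (Fin.suc k)) * bar (c (Fin.suc k)))  ∎
    where
    c₀ = c Fin.zero
    v₀ = v Fin.zero
    rest = ∑ (λ k → c (Fin.suc k) * v (Fin.suc k))
    first : Tr F q n (u * evalLin F q a (bar (c₀ * v₀))) ≡ form u v₀ * bar c₀
    first = begin
      Tr F q n (u * evalLin F q a (bar (c₀ * v₀)))
        ≡⟨ ≡.cong (λ z → Tr F q n (u * evalLin F q a z)) (bar-* c₀ v₀) ⟩
      Tr F q n (u * evalLin F q a (bar c₀ * bar v₀))
        ≡⟨ ≡.cong (λ z → Tr F q n (u * z)) (evalLin-* (K-bar (kc Fin.zero)) (bar v₀)) ⟩
      Tr F q n (u * (bar c₀ * evalLin F q a (bar v₀)))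
        ≡⟨ ≡.cong (Tr F q n) (≡.trans (≡.sym (*-assoc u (bar c₀) _))
              (≡.trans (≡.cong (_* evalLin F q a (bar v₀)) (*-comm u (bar c₀))) (*-assoc (bar c₀) u _))) ⟩
      Tr F q n (bar c₀ * (u * evalLin F q a (bar v₀)))     ≡⟨ Tr-* (K-bar (kc Fin.zero)) _ ⟩
      bar c₀ * form u v₀                                   ≡⟨ *-comm _ _ ⟩
      form u v₀ * bar c₀                                   ∎

  gram : (Fin n → Carrier) → Matrix F n
  gram = coefMatrix F q n a

  gram-K : ∀ β → KMatrix (gram β)
  gram-K β i j = form-K (β i) (β j)

  gram-change-of-basis : ∀ (X : Matrix F n) → KMatrix X → ∀ β γ → (∀ i → γ i ≡ ∑ (λ k → X i k * β k)) →
    gram γ ≃ X · gram β · X *ᵗ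
  gram-change-of-basis X kX β γ γ≡ = entrywise λ i j → begin
    form (γ i) (γ j)                                                 ≡⟨ ≡.cong₂ form (γ≡ i) (γ≡ j) ⟩
    form (∑ (λ k → X i k * β k)) (∑ (λ l → X j l * β l))             ≡⟨ form-∑ʳ (kX j) _ β ⟩
    ∑ (λ l → form (∑ (λ k → X i k * β k)) (β l) * bar (X j l))
      ≡⟨ ∑-cong (λ l → ≡.cong (_* bar (X j l)) (form-∑ˡ (kX i) β (β l))) ⟩
    ∑ (λ l → ∑ (λ k → X i k * form (β k) (β l)) * bar (X j l))       ∎

  form-in-coordinates : ∀ {c d : Fin n → Carrier} → (∀ i → K (c i)) → (∀ i → K (d i)) → ∀ β →
    form (∑ (λ i → c i * β i)) (∑ (λ j → d j * β j)) ≡ ∑ (λ j → ∑ (λ i → c i * gram β i j) * bar (d j))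
  form-in-coordinates {c} {d} kc kd β = ≡.trans (form-∑ʳ kd _ β)
    (∑-cong (λ j → ≡.cong (_* bar (d j)) (form-∑ˡ kc β (β j))))

  moore : (Fin n → Carrier) → Matrix F n
  moore β i k = φ² k (β i)

  -- The k-th summand of the trace is the k-th conjugate of β i times that of L((β j)^q). The latter
  -- is row k of M_L applied to the conjugates of (β j)^q, and these form a column of the conjugate
  -- transpose of the Moore matrix.
  gram-factorization : ∀ β → gram β ≃ moore β · ML F q n a · moore β *ᵗ
  gram-factorization β = ≃-trans (entrywise factor) (≃-sym (·-assoc (moore β) (ML F q n a) (moore β *ᵗ)))
    where
    factor : ∀ i j → gram β i j ≡ (moore β · (ML F q n a · moore β *ᵗ)) i j
    factor i j = ∑-cong λ k → ≡.trans (φ-* (2 ℕ.* toℕ k) (β i) _) (≡.cong (φ² k (β i) *_) (row k))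
      where
      row : ∀ k → φ² k (evalLin F q a (bar (β j))) ≡ ∑ (λ l → ML F q n a k l * bar (φ² l (β j)))
      row k = begin
        φ² k (∑ (λ l → a l * φ² l (bar (β j))))
          ≡⟨ φ-∑ (2 ℕ.* toℕ k) (λ l → a l * φ² l (bar (β j))) ⟩
        ∑ (λ l → φ² k (a l * φ² l (bar (β j))))                      ≡⟨ ∑-cong (λ l → φ-* (2 ℕ.* toℕ k) (a l) _) ⟩
        -- Composition moves the exponent `l` to `l + k` modulo n; this is the cyclic shift in row
        -- `k` of `ML`.
        ∑ (λ l → φ² k (a l) * φ² k (φ² l (bar (β j))))               ≡⟨ ∑-cong (λ l → ≡.cong₂ _*_
              (≡.cong (λ z → φ² k (a z)) (≡.sym (backward-forward (toℕ k) k≤n l)))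
              (≡.trans (≡.sym (φ-forward (toℕ k) l (bar (β j)))) (≡.sym (bar-φ (2 ℕ.* toℕ (forward (toℕ k) l)) (β j))))) ⟩
        ∑ (λ l → ML F q n a k (forward (toℕ k) l) * bar (φ² (forward (toℕ k) l) (β j)))
              ≡⟨ ∑-permute (λ l → ML F q n a k l * bar (φ² l (β j))) (rotation (toℕ k) k≤n) ⟨
        ∑ (λ l → ML F q n a k l * bar (φ² l (β j)))                  ∎
        where
        k≤n : toℕ k ℕ.≤ n
        k≤n = ℕ.<⇒≤ (Fin.toℕ<n k)

  -- The power q² turns each column of the Moore matrix into the next one, cyclically. This is the
  -- origin of P in the third condition.
  moore-*ᵗ*ᵗ : ∀ β → (moore β *ᵗ) *ᵗ ≃ moore β · Pmat F n
  moore-*ᵗ*ᵗ β = entrywise λ i j → begin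
    bar (bar (φ² j (β i)))                            ≡⟨ bar-bar _ ⟩
    φ 2 (φ² j (β i))                                  ≡⟨ φ-forward 1 j (β i) ⟨
    φ² (forward 1 j) (β i)                            ≡⟨ *-identityʳ _ ⟨
    φ² (forward 1 j) (β i) * 1#                       ≡⟨ ≡.cong (φ² (forward 1 j) (β i) *_) (P-one j) ⟨
    φ² (forward 1 j) (β i) * Pmat F n (forward 1 j) j ≡⟨ ∑-single (λ l → φ² l (β i) * Pmat F n l j) (forward 1 j)
              (λ l l≢ → ≡.trans (≡.cong (φ² l (β i) *_) (P-zero j l l≢)) (zeroʳ _)) ⟨
    ∑ (λ l → φ² l (β i) * Pmat F n l j)               ∎
    where
    toℕ-forward-1 : ∀ j → toℕ (forward 1 j) ≡ suc (toℕ j) ℕ.% n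
    toℕ-forward-1 j = ≡.trans (toℕ-mod _) (≡.cong (ℕ._% n) (ℕ.+-comm (toℕ j) 1))

    if-true : ∀ {b} → Bool.T b → (if b then 1# else 0#) ≡ 1#
    if-true {true} _ = ≡.refl

    if-false : ∀ {b} → ¬ Bool.T b → (if b then 1# else 0#) ≡ 0#
    if-false {true} ¬t = contradiction _ ¬t
    if-false {false} _ = ≡.refl

    P-one : ∀ j → Pmat F n (forward 1 j) j ≡ 1#
    P-one j = if-true (ℕ.≡⇒≡ᵇ _ _ (toℕ-forward-1 j))

    P-zero : ∀ j l → l ≢ forward 1 j → Pmat F n l j ≡ 0#
    P-zero j l l≢ = if-false λ t → l≢ (Fin.toℕ-injective (≡.trans (ℕ.≡ᵇ⇒≡ _ _ t) (≡.sym (toℕ-forward-1 j))))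

-- Matrix identities and the equivalence of the three conditions.

module Equivalences (F : FiniteField) (q n : ℕ) .{{_ : ℕ.NonZero n}}
  (q-prime-power : IsPrimePower q) (size≡q^2n : FiniteField.size F ≡ q ℕ.^ (2 ℕ.* n)) where
  open FiniteField F
  open Field F
  open Matrices F
  open QuadraticSubfield F q n q-prime-power size≡q^2n
  open SesquilinearForm F q n q-prime-power size≡q^2n
    using (gram; gram-K; gram-change-of-basis; form; form-in-coordinates; moore; moore-*ᵗ*ᵗ; gram-factorization)

  module _ {m : ℕ} where
    open Algebra.Properties.Monoid (·-monoid {m}) using (cancelʳ; cancelˡ; cancelᶜ)
    open Relation.Binary.Reasoning.Setoid (≃-setoid {m})

    inverse-unique : {A B C : Matrix F m} → A · B ≃ I → C · A ≃ I → B ≃ C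
    inverse-unique {A} {B} {C} AB≃I CA≃I = begin
      B              ≈⟨ cancelˡ CA≃I B ⟨
      C · (A · B)    ≈⟨ ·-congˡ AB≃I ⟩
      C · I          ≈⟨ ·-identityʳ C ⟩
      C              ∎

    *ᵗ-inverse : {X Y : Matrix F m} → Y · X ≃ I → X *ᵗ · Y *ᵗ ≃ I
    *ᵗ-inverse {X} {Y} YX≃I = ≃-trans (≃-sym (*ᵗ-· Y X)) (≃-trans (*ᵗ-cong YX≃I) *ᵗ-I)

    congruent-inverse : {X X⁻¹ A A⁻¹ : Matrix F m} → X · X⁻¹ ≃ I → X⁻¹ · X ≃ I → A · A⁻¹ ≃ I →
      X · A · X *ᵗ · (X⁻¹ *ᵗ · (A⁻¹ · X⁻¹)) ≃ I
    congruent-inverse {X} {X⁻¹} {A} {A⁻¹} XX⁻¹≃I X⁻¹X≃I AA⁻¹≃I = begin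
      X · A · X *ᵗ · (X⁻¹ *ᵗ · (A⁻¹ · X⁻¹))   ≈⟨ cancelᶜ (*ᵗ-inverse X⁻¹X≃I) (X · A) (A⁻¹ · X⁻¹) ⟩
      X · A · (A⁻¹ · X⁻¹)                     ≈⟨ cancelᶜ AA⁻¹≃I X X⁻¹ ⟩
      X · X⁻¹                                 ≈⟨ XX⁻¹≃I ⟩
      I                                       ∎

    -- The factor P accounts for X ** ≠ X when X is not defined over K.
    cosquare-of-congruent : {C C⁻¹ X X⁻¹ A A⁻¹ P : Matrix F m} → C ≃ X · A · X *ᵗ →
      C⁻¹ · C ≃ I → X · X⁻¹ ≃ I → X⁻¹ · X ≃ I → A · A⁻¹ ≃ I → (X *ᵗ) *ᵗ ≃ X · P →
      C *ᵗ · C⁻¹ ≃ X · (P · (A *ᵗ · A⁻¹)) · X⁻¹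
    cosquare-of-congruent {C} {C⁻¹} {X} {X⁻¹} {A} {A⁻¹} {P} C≃ C⁻¹C≃I XX⁻¹≃I X⁻¹X≃I AA⁻¹≃I X**≃ = begin
      C *ᵗ · C⁻¹                                              ≈⟨ ·-cong C*≃ C⁻¹≃ ⟩
      X · P · A *ᵗ · X *ᵗ · (X⁻¹ *ᵗ · (A⁻¹ · X⁻¹))
        ≈⟨ cancelᶜ (*ᵗ-inverse X⁻¹X≃I) (X · P · A *ᵗ) (A⁻¹ · X⁻¹) ⟩
      X · P · A *ᵗ · (A⁻¹ · X⁻¹)                              ≈⟨ ·-assoc (X · P · A *ᵗ) A⁻¹ X⁻¹ ⟨
      X · P · A *ᵗ · A⁻¹ · X⁻¹                                ≈⟨ ·-congʳ (·-assoc (X · P) (A *ᵗ) A⁻¹) ⟩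
      X · P · (A *ᵗ · A⁻¹) · X⁻¹                              ≈⟨ ·-congʳ (·-assoc X P (A *ᵗ · A⁻¹)) ⟩
      X · (P · (A *ᵗ · A⁻¹)) · X⁻¹                            ∎
      where
      C*≃ : C *ᵗ ≃ X · P · A *ᵗ · X *ᵗ
      C*≃ = begin
        C *ᵗ                       ≈⟨ *ᵗ-cong C≃ ⟩
        (X · A · X *ᵗ) *ᵗ          ≈⟨ *ᵗ-· (X · A) (X *ᵗ) ⟩
        X *ᵗ *ᵗ · (X · A) *ᵗ       ≈⟨ ·-cong X**≃ (*ᵗ-· X A) ⟩
        X · P · (A *ᵗ · X *ᵗ)      ≈⟨ ·-assoc (X · P) (A *ᵗ) (X *ᵗ) ⟨
        X · P · A *ᵗ · X *ᵗ        ∎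
      C⁻¹≃ : C⁻¹ ≃ X⁻¹ *ᵗ · (A⁻¹ · X⁻¹)
      C⁻¹≃ = ≃-sym (inverse-unique (≃-trans (·-congʳ C≃) (congruent-inverse XX⁻¹≃I X⁻¹X≃I AA⁻¹≃I)) C⁻¹C≃I)

    move-conjugator : {X Y A B : Matrix F m} → Y · X ≃ I → X · (A · Y) ≃ B → X · A ≃ B · X
    move-conjugator {X} {Y} {A} {B} YX≃I XAY≃B = begin
      X · A                ≈⟨ cancelʳ YX≃I (X · A) ⟨
      X · A · Y · X        ≈⟨ ·-congʳ (·-assoc X A Y) ⟩
      X · (A · Y) · X      ≈⟨ ·-congʳ XAY≃B ⟩
      B · X                ∎

    conjugate-from-intertwiner : {X Y A B : Matrix F m} → X · Y ≃ I → X · A ≃ B · X → X · (A · Y) ≃ B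
    conjugate-from-intertwiner {X} {Y} {A} {B} XY≃I XA≃BX = begin
      X · (A · Y)    ≈⟨ ·-assoc X A Y ⟨
      X · A · Y      ≈⟨ ·-congʳ XA≃BX ⟩
      B · X · Y      ≈⟨ cancelʳ XY≃I B ⟩
      B              ∎

    -- Coordinate matrices and Moore matrices both obtain their invertibility in this way from a
    -- nonsingular coefficient matrix.
    outer-left-factor-invertible : {C C⁻¹ X A Y : Matrix F m} → C ≃ X · A · Y → C · C⁻¹ ≃ I →
      ∃ λ X⁻¹ → X · X⁻¹ ≃ I × X⁻¹ · X ≃ I
    outer-left-factor-invertible {C} {C⁻¹} {X} {A} {Y} C≃XAY CC⁻¹≃I =
      A · Y · C⁻¹ , XX⁻¹≃I , right-inverse⇒left-inverse X (A · Y · C⁻¹) XX⁻¹≃I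
      where
      XX⁻¹≃I : X · (A · Y · C⁻¹) ≃ I
      XX⁻¹≃I = begin
        X · (A · Y · C⁻¹)    ≈⟨ ·-assoc X (A · Y) C⁻¹ ⟨
        X · (A · Y) · C⁻¹    ≈⟨ ·-congʳ (·-assoc X A Y) ⟨
        X · A · Y · C⁻¹      ≈⟨ ·-congʳ C≃XAY ⟨
        C · C⁻¹              ≈⟨ CC⁻¹≃I ⟩
        I                    ∎

    intertwiner-of-conjugates : {X X⁻¹ Y Y⁻¹ A B G : Matrix F m} → X⁻¹ · X ≃ I → Y⁻¹ · Y ≃ I → G · A ≃ B · G →
      Y · G · X⁻¹ · (X · A · X⁻¹) ≃ Y · B · Y⁻¹ · (Y · G · X⁻¹)
    intertwiner-of-conjugates {X} {X⁻¹} {Y} {Y⁻¹} {A} {B} {G} X⁻¹X≃I Y⁻¹Y≃I GA≃BG = begin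
      Y · G · X⁻¹ · (X · A · X⁻¹)      ≈⟨ ·-congˡ (·-assoc X A X⁻¹) ⟩
      Y · G · X⁻¹ · (X · (A · X⁻¹))    ≈⟨ cancelᶜ X⁻¹X≃I (Y · G) (A · X⁻¹) ⟩
      Y · G · (A · X⁻¹)                ≈⟨ ·-assoc (Y · G) A X⁻¹ ⟨
      Y · G · A · X⁻¹
        ≈⟨ ·-congʳ (≃-trans (·-assoc Y G A) (≃-trans (·-congˡ GA≃BG) (≃-sym (·-assoc Y B G)))) ⟩
      Y · B · G · X⁻¹                  ≈⟨ ·-assoc (Y · B) G X⁻¹ ⟩
      Y · B · (G · X⁻¹)                ≈⟨ cancelᶜ Y⁻¹Y≃I (Y · B) (G · X⁻¹) ⟨
      Y · B · Y⁻¹ · (Y · (G · X⁻¹))    ≈⟨ ·-congˡ (·-assoc Y G X⁻¹) ⟨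
      Y · B · Y⁻¹ · (Y · G · X⁻¹)      ∎

    conjugator-inverse : {X X⁻¹ Y Y⁻¹ G H : Matrix F m} → X⁻¹ · X ≃ I → G · H ≃ I → Y · Y⁻¹ ≃ I →
      Y · G · X⁻¹ · (X · H · Y⁻¹) ≃ I
    conjugator-inverse {X} {X⁻¹} {Y} {Y⁻¹} {G} {H} X⁻¹X≃I GH≃I YY⁻¹≃I = begin
      Y · G · X⁻¹ · (X · H · Y⁻¹)      ≈⟨ ·-congˡ (·-assoc X H Y⁻¹) ⟩
      Y · G · X⁻¹ · (X · (H · Y⁻¹))    ≈⟨ cancelᶜ X⁻¹X≃I (Y · G) (H · Y⁻¹) ⟩
      Y · G · (H · Y⁻¹)                ≈⟨ cancelᶜ GH≃I Y Y⁻¹ ⟩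
      Y · Y⁻¹                          ≈⟨ YY⁻¹≃I ⟩
      I                                ∎

    unconjugate : {X X⁻¹ A Q : Matrix F m} → X⁻¹ · X ≃ I → A ≃ X · Q · X⁻¹ → Q ≃ X⁻¹ · A · X
    unconjugate {X} {X⁻¹} {A} {Q} X⁻¹X≃I A≃ = ≃-sym (begin
      X⁻¹ · A · X              ≈⟨ ·-congʳ (·-congˡ (≃-trans A≃ (·-assoc X Q X⁻¹))) ⟩
      X⁻¹ · (X · (Q · X⁻¹)) · X ≈⟨ ·-congʳ (cancelˡ X⁻¹X≃I (Q · X⁻¹)) ⟩
      Q · X⁻¹ · X              ≈⟨ cancelʳ X⁻¹X≃I Q ⟩
      Q                        ∎)

  module _ (a₀ a₁ β₀ β₁ : Fin n → Carrier) (basis₀ : IsBasis F q n β₀) (basis₁ : IsBasis F q n β₁)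
    (nonsingular₀ : Nonsingular F (gram a₀ β₀)) (nonsingular₁ : Nonsingular F (gram a₁ β₁)) where

    private
      C₀ C₁ D₀ D₁ : Matrix F n
      C₀ = gram a₀ β₀
      C₁ = gram a₁ β₁
      D₀ = proj₁ nonsingular₀
      D₁ = proj₁ nonsingular₁

      C₀D₀≃I : C₀ · D₀ ≃ I
      C₀D₀≃I = proj₁ (fromIsInverse {A = C₀} {D₀} (proj₂ nonsingular₀))
      D₀C₀≃I : D₀ · C₀ ≃ I
      D₀C₀≃I = proj₂ (fromIsInverse {A = C₀} {D₀} (proj₂ nonsingular₀))
      C₁D₁≃I : C₁ · D₁ ≃ I
      C₁D₁≃I = proj₁ (fromIsInverse {A = C₁} {D₁} (proj₂ nonsingular₁))
      D₁C₁≃I : D₁ · C₁ ≃ I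
      D₁C₁≃I = proj₂ (fromIsInverse {A = C₁} {D₁} (proj₂ nonsingular₁))

      module β₀ = Coordinates β₀ basis₀
      module β₁ = Coordinates β₁ basis₁

      open Algebra.Properties.Monoid (·-monoid {n}) using (cancelʳ; cancelˡ; cancelᶜ)

    -- The coordinates of τ(β₀ i) along β₁ form a K-matrix `X` with C₀ = X C₁ X*. As X** = X, the
    -- factor P of `cosquare-of-congruent` is `I` here, and `X` conjugates the cosquares.
    equivalent⇒conjugate : EquivalentForms F q n a₀ a₁ → Cond2 F q C₀ C₁
    equivalent⇒conjugate (τ , _ , form-τ) =
      let Y , XY≃I , YX≃I = outer-left-factor-invertible C₀≃XC₁X* C₀D₀≃I in
      D₀ , D₁ , proj₂ nonsingular₀ , proj₂ nonsingular₁ , Y , X , KMatrix-inverse XY≃I YX≃I kX , kX , toIsInverse YX≃I XY≃I ,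
      entry (begin
        Y · (C₀ *ᵗ · D₀ · X)
          ≈⟨ ·-congˡ (·-congʳ (cosquare-of-congruent C₀≃XC₁X* D₀C₀≃I XY≃I YX≃I C₁D₁≃I (≃-trans (*ᵗ-involutive kX) (≃-sym (·-identityʳ X))))) ⟩
        Y · (X · (I · (C₁ *ᵗ · D₁)) · Y · X)  ≈⟨ ·-congˡ (cancelʳ YX≃I _) ⟩
        Y · (X · (I · (C₁ *ᵗ · D₁)))          ≈⟨ cancelˡ YX≃I _ ⟩
        I · (C₁ *ᵗ · D₁)                      ≈⟨ ·-identityˡ _ ⟩
        C₁ *ᵗ · D₁                            ∎)
      where
      open Relation.Binary.Reasoning.Setoid (≃-setoid {n})
      X : Matrix F n
      X i k = β₁.coordinate (τ (β₀ i)) k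
      kX : KMatrix X
      kX i k = β₁.coordinate-K (τ (β₀ i)) k
      C₀≃XC₁X* : C₀ ≃ X · C₁ · X *ᵗ
      C₀≃XC₁X* = ≃-trans (entrywise λ i j → form-τ (β₀ i) (β₀ j))
        (gram-change-of-basis a₁ X kX β₁ (τ ∘ β₀) (λ i → ≡.sym (β₁.expansion (τ (β₀ i)))))

    -- The congruent matrix Y C₁ Y* has the cosquare of C₁ conjugated by Y, which by hypothesis is
    -- exactly that of C₀. Conjugate cosquares are thus reduced to equal ones.
    congruent-if-conjugate : Cond2 F q C₀ C₁ → ∃ λ W → KMatrix W × C₀ ≃ W · C₁ · W *ᵗ
    congruent-if-conjugate (E₀ , E₁ , C₀E₀ , C₁E₁ , X , Y , kX , kY , XY , conj) =
      Z · Y , KMatrix-· kZ kY , (begin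
        C₀                                  ≈⟨ ZBZ*≃C₀ ⟨
        Z · (Y · C₁ · Y *ᵗ) · Z *ᵗ          ≈⟨ ·-congʳ (·-assoc Z (Y · C₁) (Y *ᵗ)) ⟨
        Z · (Y · C₁) · Y *ᵗ · Z *ᵗ          ≈⟨ ·-assoc (Z · (Y · C₁)) (Y *ᵗ) (Z *ᵗ) ⟩
        Z · (Y · C₁) · (Y *ᵗ · Z *ᵗ)        ≈⟨ ·-cong (·-assoc Z Y C₁) (*ᵗ-· Z Y) ⟨
        Z · Y · C₁ · (Z · Y) *ᵗ             ∎)
      where
      open Relation.Binary.Reasoning.Setoid (≃-setoid {n})
      E₀C₀≃I = proj₂ (fromIsInverse {A = C₀} {E₀} C₀E₀)
      C₁E₁≃I = proj₁ (fromIsInverse {A = C₁} {E₁} C₁E₁)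
      XY≃I = proj₁ (fromIsInverse {A = X} {Y} XY)
      YX≃I = proj₂ (fromIsInverse {A = X} {Y} XY)

      B B⁻¹ : Matrix F n
      B = Y · C₁ · Y *ᵗ
      B⁻¹ = X *ᵗ · (E₁ · X)

      BB⁻¹≃I : B · B⁻¹ ≃ I
      BB⁻¹≃I = congruent-inverse YX≃I XY≃I C₁E₁≃I

      B⁻¹B≃I : B⁻¹ · B ≃ I
      B⁻¹B≃I = right-inverse⇒left-inverse B B⁻¹ BB⁻¹≃I

      cosquares≃ : C₀ *ᵗ · E₀ ≃ B *ᵗ · B⁻¹
      cosquares≃ = ≃-sym (begin
        B *ᵗ · B⁻¹
          ≈⟨ cosquare-of-congruent ≃-refl B⁻¹B≃I YX≃I XY≃I C₁E₁≃I (≃-trans (*ᵗ-involutive kY) (≃-sym (·-identityʳ Y))) ⟩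
        Y · (I · (C₁ *ᵗ · E₁)) · X
          ≈⟨ ·-congʳ (·-congˡ (≃-trans (·-identityˡ _) (≃-sym (entrywise conj)))) ⟩
        Y · (X · (C₀ *ᵗ · E₀ · Y)) · X        ≈⟨ ·-congʳ (cancelˡ YX≃I (C₀ *ᵗ · E₀ · Y)) ⟩
        C₀ *ᵗ · E₀ · Y · X                    ≈⟨ cancelʳ YX≃I (C₀ *ᵗ · E₀) ⟩
        C₀ *ᵗ · E₀                            ∎)

      d,kd,d̄≢d = β₀.non-real

      Z,kZ,ZBZ*≃C₀ : ∃ λ Z → KMatrix Z × Z · B · Z *ᵗ ≃ C₀
      Z,kZ,ZBZ*≃C₀ = EqualCosquares.congruent F q n q-prime-power size≡q^2n
        (proj₁ d,kd,d̄≢d) (proj₁ (proj₂ d,kd,d̄≢d)) (proj₂ (proj₂ d,kd,d̄≢d))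
        C₀ B E₀ B⁻¹ (gram-K a₀ β₀) (KMatrix-· (KMatrix-· kY (gram-K a₁ β₁)) (KMatrix-*ᵗ kY))
        E₀C₀≃I BB⁻¹≃I B⁻¹B≃I cosquares≃

      Z = proj₁ Z,kZ,ZBZ*≃C₀
      kZ = proj₁ (proj₂ Z,kZ,ZBZ*≃C₀)
      ZBZ*≃C₀ = proj₂ (proj₂ Z,kZ,ZBZ*≃C₀)

    private
      module Transfer (β γ : Fin n → Carrier) (β-basis : IsBasis F q n β) (W : Matrix F n) (kW : KMatrix W) where
        open Coordinates β β-basis
        open ≡.≡-Reasoning

        image : Fin n → Carrier
        image i = ∑ λ k → W i k * γ k

        transfer : Carrier → Carrier
        transfer x = ∑ λ i → coordinate x i * image i

        transfer-∑ : ∀ {c : Fin n → Carrier} → (∀ i → K (c i)) → transfer (∑ λ i → c i * β i) ≡ ∑ (λ i → c i * image i)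
        transfer-∑ kc = ∑-cong λ i → ≡.cong (_* image i) (coordinate-unique kc ≡.refl i)

        transfer-+ : ∀ x y → transfer (x + y) ≡ transfer x + transfer y
        transfer-+ x y = begin
          transfer (x + y)
            ≡⟨ ∑-cong (λ i → ≡.cong (_* image i) (coordinate-unique (λ t → K-+ (coordinate-K x t) (coordinate-K y t)) sum≡ i)) ⟩
          ∑ (λ i → (coordinate x i + coordinate y i) * image i)
            ≡⟨ ∑-cong (λ i → distribʳ (image i) (coordinate x i) (coordinate y i)) ⟩
          ∑ (λ i → coordinate x i * image i + coordinate y i * image i)
            ≡⟨ ∑-+ (λ i → coordinate x i * image i) (λ i → coordinate y i * image i) ⟩
          transfer x + transfer y ∎
          where
          sum≡ : x + y ≡ ∑ (λ t → (coordinate x t + coordinate y t) * β t)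
          sum≡ = begin
            x + y
              ≡⟨ ≡.cong₂ _+_ (expansion x) (expansion y) ⟨
            ∑ (λ t → coordinate x t * β t) + ∑ (λ t → coordinate y t * β t)
              ≡⟨ ∑-+ (λ t → coordinate x t * β t) (λ t → coordinate y t * β t) ⟨
            ∑ (λ t → coordinate x t * β t + coordinate y t * β t)
              ≡⟨ ∑-cong (λ t → distribʳ (β t) (coordinate x t) (coordinate y t)) ⟨
            ∑ (λ t → (coordinate x t + coordinate y t) * β t)                ∎

        transfer-* : ∀ c x → K c → transfer (c * x) ≡ c * transfer x
        transfer-* c x kc = begin
          transfer (c * x)
            ≡⟨ ∑-cong (λ i → ≡.cong (_* image i) (coordinate-unique (λ t → K-* kc (coordinate-K x t)) multiple≡ i)) ⟩
          ∑ (λ i → c * coordinate x i * image i)          ≡⟨ ∑-cong (λ i → *-assoc c (coordinate x i) (image i)) ⟩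
          ∑ (λ i → c * (coordinate x i * image i))        ≡⟨ *-∑ c (λ i → coordinate x i * image i) ⟨
          c * transfer x                                  ∎
          where
          multiple≡ : c * x ≡ ∑ (λ t → c * coordinate x t * β t)
          multiple≡ = begin
            c * x                                         ≡⟨ ≡.cong (c *_) (expansion x) ⟨
            c * ∑ (λ t → coordinate x t * β t)            ≡⟨ *-∑ c (λ t → coordinate x t * β t) ⟩
            ∑ (λ t → c * (coordinate x t * β t))          ≡⟨ ∑-cong (λ t → *-assoc c (coordinate x t) (β t)) ⟨
            ∑ (λ t → c * coordinate x t * β t)            ∎

        transfer-in-γ : ∀ x → transfer x ≡ ∑ (λ k → ∑ (λ i → coordinate x i * W i k) * γ k)
        transfer-in-γ x = begin
          ∑ (λ i → coordinate x i * ∑ (λ k → W i k * γ k))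
            ≡⟨ ∑-cong (λ i → *-∑ (coordinate x i) (λ k → W i k * γ k)) ⟩
          ∑ (λ i → ∑ (λ k → coordinate x i * (W i k * γ k)))   ≡⟨ ∑-swap (λ i k → coordinate x i * (W i k * γ k)) ⟩
          ∑ (λ k → ∑ (λ i → coordinate x i * (W i k * γ k)))
            ≡⟨ ∑-cong (λ k → ∑-cong (λ i → *-assoc (coordinate x i) (W i k) (γ k))) ⟨
          ∑ (λ k → ∑ (λ i → coordinate x i * W i k * γ k))
            ≡⟨ ∑-cong (λ k → ∑-* (λ i → coordinate x i * W i k) (γ k)) ⟨
          ∑ (λ k → ∑ (λ i → coordinate x i * W i k) * γ k)     ∎

      -- In coordinates a transfer multiplies row vectors by its matrix on the right, so the
      -- composite multiplies them by W W′.
      transfer-inverse : ∀ {β γ} (β-basis : IsBasis F q n β) (γ-basis : IsBasis F q n γ) {W W′ : Matrix F n}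
        (kW : KMatrix W) (kW′ : KMatrix W′) →
        W · W′ ≃ I → ∀ x → Transfer.transfer γ β γ-basis W′ kW′ (Transfer.transfer β γ β-basis W kW x) ≡ x
      transfer-inverse {β} {γ} β-basis γ-basis {W} {W′} kW kW′ WW′≃I x = begin
        T′.transfer (T.transfer x)                             ≡⟨ ≡.cong T′.transfer (T.transfer-in-γ x) ⟩
        T′.transfer (∑ (λ k → cW k * γ k))
          ≡⟨ T′.transfer-∑ (λ k → K-∑ (λ i → K-* (coordinate-K x i) (kW i k))) ⟩
        ∑ (λ k → cW k * ∑ (λ l → W′ k l * β l))                ≡⟨ ∑-cong (λ k → *-∑ (cW k) (λ l → W′ k l * β l)) ⟩
        ∑ (λ k → ∑ (λ l → cW k * (W′ k l * β l)))              ≡⟨ ∑-swap (λ k l → cW k * (W′ k l * β l)) ⟩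
        ∑ (λ l → ∑ (λ k → cW k * (W′ k l * β l)))
          ≡⟨ ∑-cong (λ l → ≡.trans (∑-cong (λ k → ≡.sym (*-assoc (cW k) (W′ k l) (β l))))
                                                                    (≡.sym (∑-* (λ k → cW k * W′ k l) (β l)))) ⟩
        ∑ (λ l → ∑ (λ k → cW k * W′ k l) * β l)                ≡⟨ ∑-cong (λ l → ≡.cong (_* β l) (cWW′ l)) ⟩
        ∑ (λ l → coordinate x l * β l)                         ≡⟨ expansion x ⟩
        x                                                      ∎
        where
        open ≡.≡-Reasoning
        open Coordinates β β-basis
        module T = Transfer β γ β-basis W kW
        module T′ = Transfer γ β γ-basis W′ kW′

        cW : Fin n → Carrier
        cW k = ∑ λ i → coordinate x i * W i k

        -- Row vectors are treated as matrices with constant rows, to reuse associativity.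
        c : Matrix F n
        c _ = coordinate x

        cWW′ : ∀ l → ∑ (λ k → cW k * W′ k l) ≡ coordinate x l
        cWW′ l = ≡.trans (entry (·-assoc c W W′) l l) (≡.trans (entry (·-congˡ {x = c} WW′≃I) l l) (entry (·-identityʳ c) l l))

    conjugate⇒equivalent : Cond2 F q C₀ C₁ → EquivalentForms F q n a₀ a₁
    conjugate⇒equivalent cond2 = transfer , (transfer-+ , transfer-* , Transfer.transfer β₁ β₀ basis₁ W⁻¹ kW⁻¹ ,
      transfer-inverse basis₀ basis₁ kW kW⁻¹ WW⁻¹≃I , transfer-inverse basis₁ basis₀ kW⁻¹ kW W⁻¹W≃I) , preserves
      where
      open ≡.≡-Reasoning
      W,kW,C₀≃ = congruent-if-conjugate cond2
      W = proj₁ W,kW,C₀≃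
      kW = proj₁ (proj₂ W,kW,C₀≃)
      C₀≃WC₁W* = proj₂ (proj₂ W,kW,C₀≃)
      W-invertible = outer-left-factor-invertible C₀≃WC₁W* C₀D₀≃I
      W⁻¹ = proj₁ W-invertible
      WW⁻¹≃I = proj₁ (proj₂ W-invertible)
      W⁻¹W≃I = proj₂ (proj₂ W-invertible)
      kW⁻¹ = KMatrix-inverse WW⁻¹≃I W⁻¹W≃I kW
      open Transfer β₀ β₁ basis₀ W kW

      -- The congruence makes the two forms agree on β₀ and its images; sesquilinearity extends this
      -- to all arguments.
      gram-image : C₀ ≃ gram a₁ image
      gram-image = ≃-trans C₀≃WC₁W* (≃-sym (gram-change-of-basis a₁ W kW β₁ image (λ _ → ≡.refl)))

      preserves : ∀ u v → σ F q n a₀ u v ≡ σ F q n a₁ (transfer u) (transfer v)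
      preserves u v = begin
        form a₀ u v
          ≡⟨ ≡.cong₂ (form a₀) (β₀.expansion u) (β₀.expansion v) ⟨
        form a₀ (∑ (λ i → c i * β₀ i)) (∑ (λ j → d j * β₀ j))
          ≡⟨ form-in-coordinates a₀ (β₀.coordinate-K u) (β₀.coordinate-K v) β₀ ⟩
        ∑ (λ j → ∑ (λ i → c i * C₀ i j) * bar (d j))
          ≡⟨ ∑-cong (λ j → ≡.cong (_* bar (d j)) (∑-cong (λ i → ≡.cong (c i *_) (entry gram-image i j)))) ⟩
        ∑ (λ j → ∑ (λ i → c i * gram a₁ image i j) * bar (d j))
          ≡⟨ form-in-coordinates a₁ (β₀.coordinate-K u) (β₀.coordinate-K v) image ⟨
        form a₁ (transfer u) (transfer v)                      ∎
        where
        c = β₀.coordinate u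
        d = β₀.coordinate v

    private
      module Moore (a β : Fin n → Carrier) (C⁻¹ : Matrix F n) (CC⁻¹≃I : gram a β · C⁻¹ ≃ I) (C⁻¹C≃I : C⁻¹ · gram a β ≃ I) where
        open Relation.Binary.Reasoning.Setoid (≃-setoid {n})

        C V V⁻¹ M M⁻¹ : Matrix F n
        C = gram a β
        V = moore a β
        M = ML F q n a

        V-invertible : ∃ λ V⁻¹ → V · V⁻¹ ≃ I × V⁻¹ · V ≃ I
        V-invertible = outer-left-factor-invertible (gram-factorization a β) CC⁻¹≃I

        V⁻¹ = proj₁ V-invertible
        VV⁻¹≃I = proj₁ (proj₂ V-invertible)
        V⁻¹V≃I = proj₂ (proj₂ V-invertible)

        -- Read off from C = V M V*.
        M⁻¹ = V *ᵗ · (C⁻¹ · V)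

        MM⁻¹≃I : M · M⁻¹ ≃ I
        MM⁻¹≃I = begin
          M · (V *ᵗ · (C⁻¹ · V))                  ≈⟨ ·-assoc M (V *ᵗ) (C⁻¹ · V) ⟨
          M · V *ᵗ · (C⁻¹ · V)                    ≈⟨ cancelˡ V⁻¹V≃I _ ⟨
          V⁻¹ · (V · (M · V *ᵗ · (C⁻¹ · V)))
            ≈⟨ ·-congˡ (≃-trans (≃-sym (·-assoc V (M · V *ᵗ) (C⁻¹ · V))) (·-congʳ (≃-sym (·-assoc V M (V *ᵗ))))) ⟩
          V⁻¹ · (V · M · V *ᵗ · (C⁻¹ · V))        ≈⟨ ·-congˡ (·-congʳ (gram-factorization a β)) ⟨
          V⁻¹ · (C · (C⁻¹ · V))                   ≈⟨ ·-congˡ (cancelˡ CC⁻¹≃I V) ⟩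
          V⁻¹ · V                                 ≈⟨ V⁻¹V≃I ⟩
          I                                       ∎

        M⁻¹M≃I : M⁻¹ · M ≃ I
        M⁻¹M≃I = right-inverse⇒left-inverse M M⁻¹ MM⁻¹≃I

        -- `N` is left general so that the inverses supplied by the third condition fit as well.
        cosquare : ∀ {N} → M · N ≃ I → C *ᵗ · C⁻¹ ≃ V · (Pmat F n · (M *ᵗ · N)) · V⁻¹
        cosquare MN≃I = cosquare-of-congruent (gram-factorization a β) C⁻¹C≃I VV⁻¹≃I V⁻¹V≃I MN≃I (moore-*ᵗ*ᵗ a β)

      C*C⁻¹-K : ∀ a β {C⁻¹} → gram a β · C⁻¹ ≃ I → C⁻¹ · gram a β ≃ I → KMatrix (gram a β *ᵗ · C⁻¹)
      C*C⁻¹-K a β CC⁻¹≃I C⁻¹C≃I = KMatrix-· (KMatrix-*ᵗ (gram-K a β)) (KMatrix-inverse CC⁻¹≃I C⁻¹C≃I (gram-K a β))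

    subfield-conjugate⇒conjugate : Cond2 F q C₀ C₁ → Cond3 F q n a₀ a₁
    subfield-conjugate⇒conjugate (E₀ , E₁ , C₀E₀ , C₁E₁ , X , Y , _ , _ , XY , conj) =
      M₀.M⁻¹ , M₁.M⁻¹ , toIsInverse M₀.MM⁻¹≃I M₀.M⁻¹M≃I , toIsInverse M₁.MM⁻¹≃I M₁.M⁻¹M≃I ,
      G , H , toIsInverse GH≃I HG≃I ,
      entry (conjugate-from-intertwiner {X = G} {H} GH≃I (≃-trans (·-congˡ (unconjugate M₀.V⁻¹V≃I (M₀.cosquare M₀.MM⁻¹≃I)))
        (≃-trans (intertwiner-of-conjugates M₀.VV⁻¹≃I M₁.VV⁻¹≃I (move-conjugator YX≃I (entrywise conj)))
          (·-congʳ (≃-sym (unconjugate M₁.V⁻¹V≃I (M₁.cosquare M₁.MM⁻¹≃I)))))))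
      where
      module M₀ = Moore a₀ β₀ E₀ (proj₁ (fromIsInverse {A = C₀} {E₀} C₀E₀)) (proj₂ (fromIsInverse {A = C₀} {E₀} C₀E₀))
      module M₁ = Moore a₁ β₁ E₁ (proj₁ (fromIsInverse {A = C₁} {E₁} C₁E₁)) (proj₂ (fromIsInverse {A = C₁} {E₁} C₁E₁))
      XY≃I = proj₁ (fromIsInverse {A = X} {Y} XY)
      YX≃I = proj₂ (fromIsInverse {A = X} {Y} XY)
      G H : Matrix F n
      -- The Moore matrices translate a conjugator of the cosquares into one of the matrices P M*
      -- M⁻¹.
      G = M₁.V⁻¹ · X · M₀.V
      H = M₀.V⁻¹ · Y · M₁.V
      GH≃I : G · H ≃ I
      GH≃I = conjugator-inverse M₀.VV⁻¹≃I XY≃I M₁.V⁻¹V≃I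
      HG≃I : H · G ≃ I
      HG≃I = conjugator-inverse M₁.VV⁻¹≃I YX≃I M₀.V⁻¹V≃I

    -- Translated by the Moore matrices, the conjugator acts on the cosquares but has entries in F.
    -- The cosquares themselves have entries in K, which is what the descent asks for.
    conjugate⇒subfield-conjugate : Cond3 F q n a₀ a₁ → Cond2 F q C₀ C₁
    conjugate⇒subfield-conjugate (N₀ , N₁ , M₀N₀ , M₁N₁ , X , Y , XY , conj) =
      let Z , Z⁻¹ , kZ , kZ⁻¹ , ZZ⁻¹≃I , Z⁻¹Z≃I , intertwines =
            Descent.conjugate-over-subfield F q n q-prime-power size≡q^2n β₀ basis₀
              (C₀ *ᵗ · D₀) (C₁ *ᵗ · D₁) (C*C⁻¹-K a₀ β₀ C₀D₀≃I D₀C₀≃I) (C*C⁻¹-K a₁ β₁ C₁D₁≃I D₁C₁≃I) G H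
              (conjugator-inverse M₀.V⁻¹V≃I XY≃I M₁.VV⁻¹≃I) (conjugator-inverse M₁.V⁻¹V≃I YX≃I M₀.VV⁻¹≃I)
              (≃-trans (·-congˡ (M₀.cosquare (entrywise (proj₁ M₀N₀))))
                (≃-trans (intertwiner-of-conjugates M₀.V⁻¹V≃I M₁.V⁻¹V≃I (move-conjugator YX≃I (entrywise conj)))
                  (·-congʳ (≃-sym (M₁.cosquare (entrywise (proj₁ M₁N₁)))))))
      in D₀ , D₁ , proj₂ nonsingular₀ , proj₂ nonsingular₁ , Z , Z⁻¹ , kZ , kZ⁻¹ , toIsInverse ZZ⁻¹≃I Z⁻¹Z≃I ,
         entry (conjugate-from-intertwiner {X = Z} {Z⁻¹} ZZ⁻¹≃I intertwines)
      where
      module M₀ = Moore a₀ β₀ D₀ C₀D₀≃I D₀C₀≃I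
      module M₁ = Moore a₁ β₁ D₁ C₁D₁≃I D₁C₁≃I
      XY≃I = proj₁ (fromIsInverse {A = X} {Y} XY)
      YX≃I = proj₂ (fromIsInverse {A = X} {Y} XY)
      G H : Matrix F n
      G = M₁.V · X · M₀.V⁻¹
      H = M₀.V · Y · M₁.V⁻¹

open import Data.Nat using (NonZero; _^_; _*_)

theorem2p4 : (F : FiniteField) (q n : ℕ) .{{_ : NonZero n}} →
    IsPrimePower q → FiniteField.size F ≡ q ^ (2 * n) →
    (a₀ a₁ β₀ β₁ : Fin n → FiniteField.Carrier F) →
    IsBasis F q n β₀ → IsBasis F q n β₁ →
    Nonsingular F (coefMatrix F q n a₀ β₀) → Nonsingular F (coefMatrix F q n a₁ β₁) →
    (EquivalentForms F q n a₀ a₁ ⇔ Cond2 F q (coefMatrix F q n a₀ β₀) (coefMatrix F q n a₁ β₁))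
    × (Cond2 F q (coefMatrix F q n a₀ β₀) (coefMatrix F q n a₁ β₁) ⇔ Cond3 F q n a₀ a₁)
theorem2p4 F q n q-prime-power size≡q^2n a₀ a₁ β₀ β₁ basis₀ basis₁ nonsingular₀ nonsingular₁ =
  mk⇔ (equivalent⇒conjugate a₀ a₁ β₀ β₁ basis₀ basis₁ nonsingular₀ nonsingular₁)
      (conjugate⇒equivalent a₀ a₁ β₀ β₁ basis₀ basis₁ nonsingular₀ nonsingular₁) ,
  mk⇔ (subfield-conjugate⇒conjugate a₀ a₁ β₀ β₁ basis₀ basis₁ nonsingular₀ nonsingular₁)
      (conjugate⇒subfield-conjugate a₀ a₁ β₀ β₁ basis₀ basis₁ nonsingular₀ nonsingular₁)
  where open Equivalences F q n q-prime-power size≡q^2n
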